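{- Fix nonzero integers $a_1,\dots,a_5$ with $a_1+\cdots+a_5=0$. For every $\epsilon>0$ there exist $\delta>0$ and $n_0$ such that for every $n\ge n_0$ the following holds. Suppose $X_1,\dots,X_5\subseteq[n]$ satisfy (a) for each $i$, the number of nontrivial solutions $(x_1,x_2,x_3,x_4)\in X_i^4$ to $x_1+x_2=x_3+x_4$ is at most $\delta n$, where a solution is trivial if $(x_1,x_2)=(x_3,x_4)$ or $(x_1,x_2)=(x_4,x_3)$; and (b) the number of solutions to $a_1x_1+\cdots+a_5x_5=0$ with $x_1\in X_1,\dots,x_5\in X_5$ is at most $\delta n^{3/2}$. Then one can remove at most $\epsilon\sqrt n$ elements from each $X_i$ so that the resulting sets $X_1',\dots,X_5'$ admit no solution to $a_1x_1+\cdots+a_5x_5=0$ with $x_i\in X_i'$ for all $i$.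
   Context: $[n]=\{1,\dots,n\}$. (Paper's form: hypotheses $o(n)$ and $o(n^{3/2})$, conclusion removal of $o(\sqrt n)$ elements from each $X_i$.) -}

module Defs where

open import Data.Nat as ℕ using (ℕ; zero; suc)
open import Data.Integer as ℤ using (ℤ; +_)
open import Data.Fin using (Fin; toℕ)
open import Data.Fin.Subset using (Subset)
open import Data.Fin.Subset.Properties using (_∈?_)
open import Data.List using (List; []; _∷_; [_]; map; concatMap; filter; length; allFin)
open import Data.Vec as Vec using (Vec; lookup)
import Data.Vec as V
open import Data.Product using (_×_; _,_)
open import Data.Sum using (_⊎_)
open import Relation.Nullary using (¬_; Dec)
open import Relation.Nullary.Decidable using (¬?; _×-dec_; _⊎-dec_)
open import Relation.Binary.PropositionalEquality using (_≡_)

-- [n] = {1,…,n}; element i : Fin n of a Subset n stands for the integer toℕ i + 1.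
val : {n : ℕ} → Fin n → ℤ
val i = + suc (toℕ i)

elems : {n : ℕ} → Subset n → List ℤ
elems {n} X = map val (filter (_∈? X) (allFin n))

tuples : ∀ {A : Set} (k : ℕ) → (Fin k → List A) → List (Vec A k)
tuples zero L = [ V.[] ]
tuples (suc k) L = concatMap (λ x → map (x V.∷_) (tuples k (λ i → L (Fin.suc i)))) (L Fin.zero)
  where import Data.Fin as Fin

count : ∀ {A : Set} {P : A → Set} → ((x : A) → Dec (P x)) → List A → ℕ
count P? xs = length (filter P? xs)

AddSol : Vec ℤ 4 → Set
AddSol v = lookup v 0F ℤ.+ lookup v 1F ≡ lookup v 2F ℤ.+ lookup v 3F
  where open import Data.Fin.Literals using ()
        open import Data.Fin.Patterns using (0F; 1F; 2F; 3F)

Trivial : Vec ℤ 4 → Set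
Trivial v = ((lookup v 0F ≡ lookup v 2F) × (lookup v 1F ≡ lookup v 3F))
          ⊎ ((lookup v 0F ≡ lookup v 3F) × (lookup v 1F ≡ lookup v 2F))
  where open import Data.Fin.Patterns using (0F; 1F; 2F; 3F)

NontrivAddSol : Vec ℤ 4 → Set
NontrivAddSol v = AddSol v × ¬ Trivial v

nontrivAddSol? : (v : Vec ℤ 4) → Dec (NontrivAddSol v)
nontrivAddSol? v =
  (lookup v 0F ℤ.+ lookup v 1F ℤ.≟ lookup v 2F ℤ.+ lookup v 3F)
  ×-dec ¬? (((lookup v 0F ℤ.≟ lookup v 2F) ×-dec (lookup v 1F ℤ.≟ lookup v 3F))
           ⊎-dec ((lookup v 0F ℤ.≟ lookup v 3F) ×-dec (lookup v 1F ℤ.≟ lookup v 2F)))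
  where open import Data.Fin.Patterns using (0F; 1F; 2F; 3F)

nontrivEnergy : {n : ℕ} → Subset n → ℕ
nontrivEnergy X = count nontrivAddSol? (tuples 4 (λ _ → elems X))

linComb : {k : ℕ} → (Fin k → ℤ) → Vec ℤ k → ℤ
linComb {zero} a V.[] = + 0
linComb {suc k} a (x V.∷ xs) = a Fin.zero ℤ.* x ℤ.+ linComb (λ i → a (Fin.suc i)) xs
  where import Data.Fin as Fin

numSols : {n : ℕ} → (Fin 5 → ℤ) → (Fin 5 → Subset n) → ℕ
numSols a X = count (λ v → linComb a v ℤ.≟ + 0) (tuples 5 (λ i → elems (X i)))

-- Join the integers u and v by an edge of the i-th graph if v - u = a_i x for some x ∈ X_i, inside
-- an interval of N = S² ≥ L n integers, and give every edge weight S = √N.  Solutions become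
-- five-cycles with n translates each, and nontrivial additive quadruples become four-cycles.
--
-- Since there are few four-cycles, the conditional expectation of each graph on any partition into
-- boundedly many large classes has bounded L² norm.  Hence energy increments give a coarse and a
-- fine partition with almost the same energy, the fine one being cut-regular with an accuracy that
-- depends on the coarse one.  Only a lower bound for the number of five-cycles is needed, so a
-- one-sided notion of regularity suffices, and the graphs of paths of length two, which are dense
-- with bounded L² norm, may be truncated: a five-cycle is a triangle made of two such dense graphs
-- and one sparse graph.
--
-- An edge is bad if its cell in the coarse partition is small, sparse, or changes much in the fine
-- partition; there are few bad edges.  A five-cycle without bad edges would force more than
-- δ n^{3/2} solutions.  So every translate of every solution has a bad edge, and it is enough to
-- remove the elements that occur on many bad edges.

module Submission where

module _ where

  open import Defs
  open import Data.Bool using (Bool; true; false; _∧_; _∨_; not)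
  open import Data.Fin using (Fin; zero; suc; toℕ; fromℕ<)
  open import Data.Fin.Patterns using (0F; 1F; 2F; 3F; 4F)
  open import Data.Fin.Properties using (any?; toℕ-injective; toℕ-fromℕ<; toℕ<n) renaming (_≟_ to _≟ᶠ_)
  open import Data.Fin.Subset using (Subset; _∈_; _⊆_; ∣_∣)
  open import Data.Fin.Subset.Properties using (_∈?_; anySubset?; p⊆q⇒∣p∣≤∣q∣)
  open import Data.Integer as ℤ using (ℤ; +_; -[1+_])
  import Data.Integer.Properties as ℤ
  import Data.Integer.Tactic.RingSolver as ℤ-Solver
  open import Data.List using (List; []; _∷_; _++_; map; concatMap; filter; length; allFin)
  open import Data.List.Properties using (map-tabulate)
  open import Data.Maybe using (Maybe; just; nothing)
  open import Data.Nat as ℕ using (ℕ; zero; suc; _∸_)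
  import Data.Nat.Properties as ℕ
  import Data.Nat.Tactic.RingSolver as ℕ-Solver
  open import Data.Product using (Σ; ∃; _×_; _,_; proj₁; proj₂)
  open import Data.Rational hiding (∣_∣; truncate)
  open import Data.Rational.Properties
  open import Data.Rational.Unnormalised as ℚᵘ using (ℚᵘ; mkℚᵘ; *≡*; *≤*)
  import Data.Rational.Unnormalised.Properties as ℚᵘ
  open import Data.Sum using (_⊎_; inj₁; inj₂; [_,_])
  open import Data.Vec as Vec using (Vec; []; _∷_; lookup; tabulate)
  open import Data.Vec.Properties using (lookup∘tabulate; []=⇒lookup; lookup⇒[]=)
  open import Level using (0ℓ)
  open import Relation.Binary.PropositionalEquality hiding ([_])
  open import Relation.Nullary using (Dec; yes; no; does; ¬_; contradiction)
  open import Relation.Nullary.Decidable using (_×-dec_)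
  open import Tactic.RingSolver using (solve-∀)
  open import Tactic.RingSolver.Core.AlmostCommutativeRing using (AlmostCommutativeRing; fromCommutativeRing)

  -- The weight `S` is dictated by the size of the sets: with only O(n) nontrivial additive
  -- quadruples a set has O(√n) elements, so its graph has O(N^(3/2)) edges and the factor √N brings
  -- the mean density to constant order. Taking N to be a perfect square keeps this weight rational,
  -- and bounds that involve √n are stated and proved in squared form. The obstacle to averaging is
  -- a very light class: its averaging kernel is as large as the inverse of its weight, and then a
  -- small number of four-cycles no longer controls the L² norm. The vertex set is therefore
  -- enlarged by fake vertices of total mass κ², which carry no edges and are halved by every cut.
  -- No class is too light any more, and the fake vertices can only dilute an average, which is
  -- harmless for a regularity condition from below. The obstacle to counting is that the weighted
  -- graphs are unbounded and cannot serve as test functions. This fixes the order of the exchanges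
  -- in `triangle-counting`: the fifth graph, which is never truncated, comes last.

  ℚ-ring : AlmostCommutativeRing 0ℓ 0ℓ
  ℚ-ring = fromCommutativeRing +-*-commutativeRing isZero
    where
    isZero : ∀ x → Maybe (0ℚ ≡ x)
    isZero x with 0ℚ ≟ x
    ... | yes p = just p
    ... | no _ = nothing

  -- Ordered-field arithmetic of the rationals

  2ℚ 4ℚ : ℚ
  2ℚ = 1ℚ + 1ℚ
  4ℚ = 2ℚ + 2ℚ

  gap : ∀ {p q} → p ≤ q → 0ℚ ≤ q - p
  gap {p} {q} h = subst (_≤ q - p) (+-inverseʳ p) (+-monoˡ-≤ (- p) h)

  -- The pattern of most inequalities below: the ring solver checks an identity that exhibits the
  -- difference `d`, and `d` is built from visibly nonnegative pieces. Helpers called `certificate`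
  -- or `identity` supply the identity.
  ≤-by : ∀ {p q} d → q ≡ p + d → 0ℚ ≤ d → p ≤ q
  ≤-by {p} {q} d e h = subst (p ≤_) (sym e) (subst (_≤ p + d) (+-identityʳ p) (+-monoʳ-≤ p h))

  0≤+ : ∀ {p q} → 0ℚ ≤ p → 0ℚ ≤ q → 0ℚ ≤ p + q
  0≤+ = +-mono-≤

  0≤* : ∀ {p q} → 0ℚ ≤ p → 0ℚ ≤ q → 0ℚ ≤ p * q
  0≤* {p} {q} a b = subst (_≤ p * q) (*-zeroʳ p) (*-monoˡ-≤-nonNeg p {{nonNegative a}} b)

  *-monoˡ-≤ : ∀ {r p q} → 0ℚ ≤ r → p ≤ q → r * p ≤ r * q
  *-monoˡ-≤ {r} a = *-monoˡ-≤-nonNeg r {{nonNegative a}}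

  *-monoʳ-≤ : ∀ {r p q} → 0ℚ ≤ r → p ≤ q → p * r ≤ q * r
  *-monoʳ-≤ {r} a = *-monoʳ-≤-nonNeg r {{nonNegative a}}

  *-mono-≤ : ∀ {p q r s} → 0ℚ ≤ p → 0ℚ ≤ r → p ≤ q → r ≤ s → p * r ≤ q * s
  *-mono-≤ a b h k = ≤-trans (*-monoʳ-≤ b h) (*-monoˡ-≤ (≤-trans a h) k)

  0<* : ∀ {p q} → 0ℚ < p → 0ℚ < q → 0ℚ < p * q
  0<* {p} {q} a b = subst (_< p * q) (*-zeroʳ p) (*-monoʳ-<-pos p {{positive a}} b)

  0<+ : ∀ {p q} → 0ℚ < p → 0ℚ ≤ q → 0ℚ < p + q
  0<+ = +-mono-<-≤

  *-cancelˡ-≤ : ∀ {r p q} → 0ℚ < r → r * p ≤ r * q → p ≤ q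
  *-cancelˡ-≤ {r} a = *-cancelˡ-≤-pos r {{positive a}}

  0≤1 : 0ℚ ≤ 1ℚ
  0≤1 = nonNegative⁻¹ 1ℚ

  0<1 : 0ℚ < 1ℚ
  0<1 = positive⁻¹ 1ℚ

  0≤2 : 0ℚ ≤ 2ℚ
  0≤2 = nonNegative⁻¹ 2ℚ

  0≤½ : 0ℚ ≤ ½
  0≤½ = nonNegative⁻¹ ½

  0≤sq : ∀ p → 0ℚ ≤ p * p
  0≤sq p with ≤-total 0ℚ p
  ... | inj₁ a = 0≤* a a
  ... | inj₂ a = subst (0ℚ ≤_) (neg-sq p) (0≤* (neg-antimono-≤ a) (neg-antimono-≤ a))
    where
    neg-sq : ∀ p → (- p) * (- p) ≡ p * p
    neg-sq = solve-∀ ℚ-ring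

  ≤-by-sq : ∀ p q → p * q + p * q ≤ p * p + q * q
  ≤-by-sq p q = ≤-by ((p - q) * (p - q)) (identity p q) (0≤sq (p - q))
    where
    identity : ∀ p q → p * p + q * q ≡ p * q + p * q + (p - q) * (p - q)
    identity = solve-∀ ℚ-ring

  sq-cancel-≤ : ∀ {p q} → 0ℚ ≤ q → p * p ≤ q * q → p ≤ q
  sq-cancel-≤ {p} {q} a h with p ≤? q
  ... | yes k = k
  ... | no k = contradiction h (<⇒≱ (≤-<-trans (*-monoˡ-≤ a (<⇒≤ q<p)) (*-monoˡ-<-pos p
      {{positive (≤-<-trans a q<p)}} q<p)))
    where
    q<p = ≰⇒> k
    <⇒≱ : ∀ {x y} → x < y → ¬ (y ≤ x)
    <⇒≱ u v = <-irrefl refl (<-≤-trans u v)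

  abstract
    -- Total, with value 0 at 0, so that no nonzero instance travels through later terms; `*-inv`
    -- asks for positivity instead. Being abstract, it is an atom for the ring solver.
    inv : ℚ → ℚ
    inv q with q ≟ 0ℚ
    ... | yes _ = 0ℚ
    ... | no q≢0 = (1/ q) {{≢-nonZero q≢0}}

    *-inv : ∀ {q} → 0ℚ < q → q * inv q ≡ 1ℚ
    *-inv {q} a with q ≟ 0ℚ
    ... | yes e = contradiction (sym e) (<⇒≢ a)
    ... | no q≢0 = *-inverseʳ q {{≢-nonZero q≢0}}

    inv>0 : ∀ {q} → 0ℚ < q → 0ℚ < inv q
    inv>0 {q} a with inv q ≤? 0ℚ
    ... | no h = ≰⇒> h
    ... | yes h = contradiction 0<1 (λ b → <-irrefl refl (<-≤-trans b bound))
      where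
      bound : 1ℚ ≤ 0ℚ
      bound = subst₂ _≤_ (*-inv a) (*-zeroʳ q) (*-monoˡ-≤ (<⇒≤ a) h)

  inv≥0 : ∀ {q} → 0ℚ < q → 0ℚ ≤ inv q
  inv≥0 a = <⇒≤ (inv>0 a)

  inv-antimono : ∀ {p q} → 0ℚ < p → p ≤ q → inv q ≤ inv p
  inv-antimono {p} {q} a h = ≤-by ((q - p) * (inv p * inv q)) (identity (inv p) (inv q) p q (*-inv a) (*-inv 0<q))
      (0≤* (gap h) (0≤* (inv≥0 a) (inv≥0 0<q)))
    where
    0<q = <-≤-trans a h
    rearrange : ∀ ip iq p q → iq * (p * ip) + (q - p) * (ip * iq) ≡ ip * (q * iq)
    rearrange = solve-∀ ℚ-ring
    identity : ∀ ip iq p q → p * ip ≡ 1ℚ → q * iq ≡ 1ℚ → ip ≡ iq + (q - p) * (ip * iq)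
    identity ip iq p q e f = trans (sym (trans (cong (ip *_) f) (*-identityʳ ip)))
      (trans (sym (rearrange ip iq p q)) (cong (λ z → z + (q - p) * (ip * iq)) (trans (cong (iq *_) e)
          (*-identityʳ iq))))

  -- Indicators and Boolean comparisons

  𝟙 : Bool → ℚ
  𝟙 true = 1ℚ
  𝟙 false = 0ℚ

  𝟙≥0 : ∀ b → 0ℚ ≤ 𝟙 b
  𝟙≥0 true = 0≤1
  𝟙≥0 false = ≤-refl

  𝟙≤1 : ∀ b → 𝟙 b ≤ 1ℚ
  𝟙≤1 true = ≤-refl
  𝟙≤1 false = 0≤1

  𝟙-∧ : ∀ b c → 𝟙 (b ∧ c) ≡ 𝟙 b * 𝟙 c
  𝟙-∧ true c = sym (*-identityˡ (𝟙 c))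
  𝟙-∧ false c = sym (*-zeroˡ (𝟙 c))

  -- Indexed by the outcome of the test, so that matching on `comparison p q` reveals the inequality
  -- and the value of the abstract Boolean `p ≤ᵗ q` together.
  data Comparison (p q : ℚ) : Bool → Set where
    below : p ≤ q → Comparison p q true
    above : q < p → Comparison p q false

  infix 4 _≤ᵗ_

  abstract

    _≤ᵗ_ : ℚ → ℚ → Bool
    p ≤ᵗ q = does (p ≤? q)

    comparison : ∀ p q → Comparison p q (p ≤ᵗ q)
    comparison p q = compare (p ≤? q)
      where
      compare : (d : Dec (p ≤ q)) → Comparison p q (does d)
      compare (yes h) = below h
      compare (no h) = above (≰⇒> h)

  -- Natural numbers as rationals

  ♯ : ℕ → ℚ
  ♯ n = + n / 1

  ♯ᵘ : ℕ → ℚᵘ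
  ♯ᵘ n = mkℚᵘ (+ n) 0

  toℚᵘ-♯ : ∀ n → toℚᵘ (♯ n) ℚᵘ.≃ ♯ᵘ n
  toℚᵘ-♯ n = toℚᵘ-fromℚᵘ (♯ᵘ n)

  ♯-+ : ∀ m n → ♯ (m ℕ.+ n) ≡ ♯ m + ♯ n
  ♯-+ m n = toℚᵘ-injective (begin
    toℚᵘ (♯ (m ℕ.+ n)) ≈⟨ toℚᵘ-♯ (m ℕ.+ n) ⟩
    ♯ᵘ (m ℕ.+ n) ≈⟨ *≡* (cong (ℤ._* (+ 1)) (trans (ℤ.pos-+ m n) (sym (cong₂ ℤ._+_ (ℤ.*-identityʳ (+ m))
        (ℤ.*-identityʳ (+ n)))))) ⟩
    ♯ᵘ m ℚᵘ.+ ♯ᵘ n ≈⟨ ℚᵘ.+-cong (ℚᵘ.≃-sym (toℚᵘ-♯ m)) (ℚᵘ.≃-sym (toℚᵘ-♯ n)) ⟩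
    toℚᵘ (♯ m) ℚᵘ.+ toℚᵘ (♯ n) ≈⟨ ℚᵘ.≃-sym (toℚᵘ-homo-+ (♯ m) (♯ n)) ⟩
    toℚᵘ (♯ m + ♯ n) ∎)
    where open ℚᵘ.≃-Reasoning

  ♯-* : ∀ m n → ♯ (m ℕ.* n) ≡ ♯ m * ♯ n
  ♯-* m n = toℚᵘ-injective (begin
    toℚᵘ (♯ (m ℕ.* n)) ≈⟨ toℚᵘ-♯ (m ℕ.* n) ⟩
    ♯ᵘ (m ℕ.* n) ≈⟨ *≡* (cong (ℤ._* (+ 1)) (ℤ.pos-* m n)) ⟩
    ♯ᵘ m ℚᵘ.* ♯ᵘ n ≈⟨ ℚᵘ.*-cong (ℚᵘ.≃-sym (toℚᵘ-♯ m)) (ℚᵘ.≃-sym (toℚᵘ-♯ n)) ⟩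
    toℚᵘ (♯ m) ℚᵘ.* toℚᵘ (♯ n) ≈⟨ ℚᵘ.≃-sym (toℚᵘ-homo-* (♯ m) (♯ n)) ⟩
    toℚᵘ (♯ m * ♯ n) ∎)
    where open ℚᵘ.≃-Reasoning

  ♯-suc : ∀ n → ♯ (suc n) ≡ 1ℚ + ♯ n
  ♯-suc n = ♯-+ 1 n

  ♯-mono : ∀ {m n} → m ℕ.≤ n → ♯ m ≤ ♯ n
  ♯-mono {m} {n} h = toℚᵘ-cancel-≤ (ℚᵘ.≤-trans (ℚᵘ.≤-reflexive (toℚᵘ-♯ m))
    (ℚᵘ.≤-trans (*≤* (ℤ.*-monoʳ-≤-nonNeg (+ 1) (ℤ.+≤+ h))) (ℚᵘ.≤-reflexive (ℚᵘ.≃-sym (toℚᵘ-♯ n)))))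

  ♯-cancel-≤ : ∀ {m n} → ♯ m ≤ ♯ n → m ℕ.≤ n
  ♯-cancel-≤ {m} {n} h with ℚᵘ.≤-trans (ℚᵘ.≤-reflexive (ℚᵘ.≃-sym (toℚᵘ-♯ m))) (ℚᵘ.≤-trans (toℚᵘ-mono-≤ h)
      (ℚᵘ.≤-reflexive (toℚᵘ-♯ n)))
  ... | *≤* k = ℤ.drop‿+≤+ (subst₂ ℤ._≤_ (ℤ.*-identityʳ (+ m)) (ℤ.*-identityʳ (+ n)) k)

  ♯≥0 : ∀ n → 0ℚ ≤ ♯ n
  ♯≥0 n = ♯-mono {0} {n} ℕ.z≤n

  ♯-injective : ∀ {m n} → ♯ m ≡ ♯ n → m ≡ n
  ♯-injective e = ℕ.≤-antisym (♯-cancel-≤ (≤-reflexive e)) (♯-cancel-≤ (≤-reflexive (sym e)))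

  ≤-♯ : ∀ q → q ≤ ♯ ℤ.∣ ↥ q ∣
  ≤-♯ q@(mkℚ n d _) = toℚᵘ-cancel-≤ (ℚᵘ.≤-trans (*≤* (bound n)) (ℚᵘ.≤-reflexive (ℚᵘ.≃-sym (toℚᵘ-♯ ℤ.∣ n ∣))))
    where
    bound : ∀ n → n ℤ.* + 1 ℤ.≤ + ℤ.∣ n ∣ ℤ.* + suc d
    bound (+ k) = subst₂ ℤ._≤_ (ℤ.pos-* k 1) (ℤ.pos-* k (suc d)) (ℤ.+≤+ (ℕ.*-monoʳ-≤ k (ℕ.s≤s ℕ.z≤n)))
    bound -[1+ k ] = ℤ.≤-trans (ℤ.≤-reflexive (ℤ.*-identityʳ -[1+ k ])) (subst (-[1+ k ] ℤ.≤_) (ℤ.pos-* (suc k)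
        (suc d)) ℤ.-≤+)

  1≤denominator* : ∀ {q} → 0ℚ < q → 1ℚ ≤ ♯ (↧ₙ q) * q
  1≤denominator* {q@(mkℚ (+ suc n) d _)} 0<q = toℚᵘ-cancel-≤ (ℚᵘ.≤-trans (*≤* bound)
    (ℚᵘ.≤-reflexive (ℚᵘ.≃-trans (ℚᵘ.*-congʳ {toℚᵘ q} (ℚᵘ.≃-sym (toℚᵘ-♯ (suc d)))) (ℚᵘ.≃-sym (toℚᵘ-homo-* (♯ (suc d))
        q)))))
    where
    bound : + 1 ℤ.* + (1 ℕ.* suc d) ℤ.≤ (+ suc d ℤ.* + suc n) ℤ.* + 1
    bound = ℤ.≤-trans (ℤ.≤-reflexive (trans (ℤ.*-identityˡ _) (cong +_ (ℕ.*-identityˡ (suc d)))))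
      (ℤ.≤-trans (ℤ.+≤+ (ℕ.m≤m*n (suc d) (suc n))) (ℤ.≤-reflexive (trans (ℤ.pos-* (suc d) (suc n))
          (sym (ℤ.*-identityʳ _)))))
  1≤denominator* {mkℚ (+ zero) d _} (*<* (ℤ.+<+ ()))
  1≤denominator* {mkℚ -[1+ n ] d _} (*<* ())

  -- With `d` the denominator of `q`, the product `d * q` is a positive integer, hence at least 1,
  -- and `B` is at most the absolute value of its numerator; `m` is the successor of that value
  -- times `d`.
  archimedes : ∀ B {q} → 0ℚ < q → Σ ℕ λ m → B < ♯ m * q
  archimedes B {q} 0<q = suc b ℕ.* d , ≤-<-trans (≤-♯ B) (<-≤-trans step (subst (♯ (suc b) ≤_) (sym assoc) scaled))
    where
    b d : ℕ
    b = ℤ.∣ ↥ B ∣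
    d = ↧ₙ q
    step : ♯ b < ♯ (suc b)
    step = subst₂ _<_ (+-identityˡ (♯ b)) (sym (♯-suc b)) (+-monoˡ-< (♯ b) 0<1)
    assoc : ♯ (suc b ℕ.* d) * q ≡ ♯ (suc b) * (♯ d * q)
    assoc = trans (cong (_* q) (♯-* (suc b) d)) (*-assoc (♯ (suc b)) (♯ d) q)
    scaled : ♯ (suc b) ≤ ♯ (suc b) * (♯ d * q)
    scaled = subst (_≤ ♯ (suc b) * (♯ d * q)) (*-identityʳ (♯ (suc b))) (*-monoˡ-≤ (♯≥0 (suc b)) (1≤denominator* 0<q))

  -- Weighted finite sums

  record Measure (A : Set) : Set where
    field
      points : List A
      mass : A → ℚ
      mass≥0 : ∀ x → 0ℚ ≤ mass x

  open Measure

  private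
    interchange : ∀ a b c d → (a + b) + (c + d) ≡ (a + c) + (b + d)
    interchange = solve-∀ ℚ-ring
    left-comm : ∀ a b c → a * (b * c) ≡ b * (a * c)
    left-comm = solve-∀ ℚ-ring

    module _ {A : Set} where
      ∑ : List A → (A → ℚ) → ℚ
      ∑ [] f = 0ℚ
      ∑ (x ∷ xs) f = f x + ∑ xs f

      ∑-cong : ∀ xs {f g} → (∀ x → f x ≡ g x) → ∑ xs f ≡ ∑ xs g
      ∑-cong [] h = refl
      ∑-cong (x ∷ xs) h = cong₂ _+_ (h x) (∑-cong xs h)

      ∑-mono : ∀ xs {f g} → (∀ x → f x ≤ g x) → ∑ xs f ≤ ∑ xs g
      ∑-mono [] h = ≤-refl
      ∑-mono (x ∷ xs) h = +-mono-≤ (h x) (∑-mono xs h)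

      ∑-+ : ∀ xs f g → ∑ xs (λ x → f x + g x) ≡ ∑ xs f + ∑ xs g
      ∑-+ [] f g = refl
      ∑-+ (x ∷ xs) f g = trans (cong (λ ζ → f x + g x + ζ) (∑-+ xs f g)) (interchange (f x) (g x) (∑ xs f) (∑ xs g))

      ∑-*ˡ : ∀ xs c f → ∑ xs (λ x → c * f x) ≡ c * ∑ xs f
      ∑-*ˡ [] c f = sym (*-zeroʳ c)
      ∑-*ˡ (x ∷ xs) c f = trans (cong (λ ζ → c * f x + ζ) (∑-*ˡ xs c f)) (sym (*-distribˡ-+ c (f x) (∑ xs f)))

      ∑-0 : ∀ xs → ∑ xs (λ _ → 0ℚ) ≡ 0ℚ
      ∑-0 [] = refl
      ∑-0 (x ∷ xs) = trans (+-identityˡ _) (∑-0 xs)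

      ∑-++ : ∀ xs ys f → ∑ (xs ++ ys) f ≡ ∑ xs f + ∑ ys f
      ∑-++ [] ys f = sym (+-identityˡ _)
      ∑-++ (x ∷ xs) ys f = trans (cong (λ ζ → f x + ζ) (∑-++ xs ys f)) (sym (+-assoc (f x) _ _))

    ∑-map : ∀ {A B : Set} (h : A → B) xs f → ∑ (map h xs) f ≡ ∑ xs (λ x → f (h x))
    ∑-map h [] f = refl
    ∑-map h (x ∷ xs) f = cong (λ ζ → f (h x) + ζ) (∑-map h xs f)

    ∑-swap : ∀ {A B : Set} xs ys (f : A → B → ℚ) → ∑ xs (λ x → ∑ ys (f x)) ≡ ∑ ys (λ y → ∑ xs (λ x → f x y))
    ∑-swap [] ys f = sym (∑-0 ys)
    ∑-swap (x ∷ xs) ys f = trans (cong (λ ζ → ∑ ys (f x) + ζ) (∑-swap xs ys f)) (sym (∑-+ ys (f x) _))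

  abstract
    counting : {A : Set} → List A → Measure A
    counting xs = record { points = xs ; mass = λ _ → 1ℚ ; mass≥0 = λ _ → 0≤1 }

    scale : {A : Set} (c : ℚ) → 0ℚ ≤ c → Measure A → Measure A
    scale c c≥0 μ = record { points = points μ ; mass = λ x → c * mass μ x ; mass≥0 = λ x → 0≤* c≥0 (mass≥0 μ x) }

    _⊕_ : {A B : Set} → Measure A → Measure B → Measure (A ⊎ B)
    μ ⊕ ν = record
      { points = map inj₁ (points μ) ++ map inj₂ (points ν)
      ; mass = [ mass μ , mass ν ]
      ; mass≥0 = λ { (inj₁ x) → mass≥0 μ x ; (inj₂ y) → mass≥0 ν y }
      }

    -- Opaque outside this block: integrals are manipulated through the lemmas only and remain atoms
    -- for the ring solver.
    ∫ : {A : Set} → Measure A → (A → ℚ) → ℚ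
    ∫ μ f = ∑ (points μ) (λ x → mass μ x * f x)

    ∫-mono : ∀ {A} {μ : Measure A} {f g} → (∀ x → f x ≤ g x) → ∫ μ f ≤ ∫ μ g
    ∫-mono {μ = μ} h = ∑-mono (points μ) (λ x → *-monoˡ-≤ (mass≥0 μ x) (h x))

    ∫-cong : ∀ {A} {μ : Measure A} {f g} → (∀ x → f x ≡ g x) → ∫ μ f ≡ ∫ μ g
    ∫-cong {μ = μ} h = ∑-cong (points μ) (λ x → cong (mass μ x *_) (h x))

    ∫-+ : ∀ {A} {μ : Measure A} f g → ∫ μ (λ x → f x + g x) ≡ ∫ μ f + ∫ μ g
    ∫-+ {μ = μ} f g = trans (∑-cong (points μ) (λ x → *-distribˡ-+ (mass μ x) (f x) (g x))) (∑-+ (points μ) _ _)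

    ∫-*ˡ : ∀ {A} {μ : Measure A} c f → ∫ μ (λ x → c * f x) ≡ c * ∫ μ f
    ∫-*ˡ {μ = μ} c f = trans (∑-cong (points μ) (λ x → left-comm (mass μ x) c (f x))) (∑-*ˡ (points μ) c _)

    ∫-swap : ∀ {A B} {μ : Measure A} {ν : Measure B} (f : A → B → ℚ) →
      ∫ μ (λ x → ∫ ν (λ y → f x y)) ≡ ∫ ν (λ y → ∫ μ (λ x → f x y))
    ∫-swap {μ = μ} {ν} f = begin
      ∑ (points μ) (λ x → mass μ x * ∑ (points ν) (λ y → mass ν y * f x y))
        ≡⟨ ∑-cong (points μ) (λ x → sym (∑-*ˡ (points ν) (mass μ x) _)) ⟩
      ∑ (points μ) (λ x → ∑ (points ν) (λ y → mass μ x * (mass ν y * f x y)))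
        ≡⟨ ∑-swap (points μ) (points ν) _ ⟩
      ∑ (points ν) (λ y → ∑ (points μ) (λ x → mass μ x * (mass ν y * f x y)))
        ≡⟨ ∑-cong (points ν) (λ y → ∑-cong (points μ) (λ x → left-comm (mass μ x) (mass ν y) (f x y))) ⟩
      ∑ (points ν) (λ y → ∑ (points μ) (λ x → mass ν y * (mass μ x * f x y)))
        ≡⟨ ∑-cong (points ν) (λ y → ∑-*ˡ (points μ) (mass ν y) _) ⟩
      ∑ (points ν) (λ y → mass ν y * ∑ (points μ) (λ x → mass μ x * f x y)) ∎
      where open ≡-Reasoning

    ∫-⊕ : ∀ {A B} {μ : Measure A} {ν : Measure B} f → ∫ (μ ⊕ ν) f ≡ ∫ μ (λ x → f (inj₁ x)) + ∫ ν (λ y → f (inj₂ y))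
    ∫-⊕ {μ = μ} {ν} f = trans (∑-++ (map inj₁ (points μ)) _ _) (cong₂ _+_ (∑-map inj₁ (points μ) _)
        (∑-map inj₂ (points ν) _))

    ∫-scale : ∀ {A} {c} {c≥0 : 0ℚ ≤ c} {μ : Measure A} f → ∫ (scale c c≥0 μ) f ≡ c * ∫ μ f
    ∫-scale {c = c} {μ = μ} f = trans (∑-cong (points μ) (λ x → *-assoc c (mass μ x) (f x))) (∑-*ˡ (points μ) c _)

    ∫-[] : ∀ {A} (f : A → ℚ) → ∫ (counting []) f ≡ 0ℚ
    ∫-[] f = refl

    ∫-∷ : ∀ {A} (x : A) xs f → ∫ (counting (x ∷ xs)) f ≡ f x + ∫ (counting xs) f
    ∫-∷ x xs f = cong (_+ ∫ (counting xs) f) (*-identityˡ (f x))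

    ∫-++ : ∀ {A} (xs ys : List A) f → ∫ (counting (xs ++ ys)) f ≡ ∫ (counting xs) f + ∫ (counting ys) f
    ∫-++ xs ys f = ∑-++ xs ys _

    ∫-map : ∀ {A B} (h : A → B) xs f → ∫ (counting (map h xs)) f ≡ ∫ (counting xs) (λ x → f (h x))
    ∫-map h xs f = ∑-map h xs _

  module _ {A : Set} {μ : Measure A} where

    ∫-*ʳ : ∀ c f → ∫ μ (λ x → f x * c) ≡ ∫ μ f * c
    ∫-*ʳ c f = trans (∫-cong (λ x → *-comm (f x) c)) (trans (∫-*ˡ c f) (*-comm c _))

    ∫-0 : ∫ μ (λ _ → 0ℚ) ≡ 0ℚ
    ∫-0 = trans (∫-cong (λ _ → sym (*-zeroˡ 0ℚ))) (trans (∫-*ˡ 0ℚ (λ _ → 0ℚ)) (*-zeroˡ (∫ μ (λ _ → 0ℚ))))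

    ∫-neg : ∀ f → ∫ μ (λ x → - f x) ≡ - ∫ μ f
    ∫-neg f = trans (∫-cong (λ x → as-product (f x))) (trans (∫-*ˡ (- 1ℚ) f) (sym (as-product _)))
      where
      as-product : ∀ x → - x ≡ (- 1ℚ) * x
      as-product = solve-∀ ℚ-ring

    ∫-- : ∀ f g → ∫ μ (λ x → f x - g x) ≡ ∫ μ f - ∫ μ g
    ∫-- f g = trans (∫-+ f (λ x → - g x)) (cong (λ ζ → ∫ μ f + ζ) (∫-neg g))

    ∫-const : ∀ c → ∫ μ (λ _ → c) ≡ c * ∫ μ (λ _ → 1ℚ)
    ∫-const c = trans (∫-cong (λ _ → sym (*-identityʳ c))) (∫-*ˡ c (λ _ → 1ℚ))

    ∫-≥0 : ∀ {f} → (∀ x → 0ℚ ≤ f x) → 0ℚ ≤ ∫ μ f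
    ∫-≥0 {f} h = subst (_≤ ∫ μ f) ∫-0 (∫-mono h)

  module _ {A B : Set} {μ : Measure A} {ν : Measure B} where

    ∫∫-mono : ∀ {f g : A → B → ℚ} → (∀ x y → f x y ≤ g x y) → ∫ μ (λ x → ∫ ν (f x)) ≤ ∫ μ (λ x → ∫ ν (g x))
    ∫∫-mono h = ∫-mono (λ x → ∫-mono (h x))

    ∫∫-cong : ∀ {f g : A → B → ℚ} → (∀ x y → f x y ≡ g x y) → ∫ μ (λ x → ∫ ν (f x)) ≡ ∫ μ (λ x → ∫ ν (g x))
    ∫∫-cong h = ∫-cong (λ x → ∫-cong (h x))

    ∫∫-+ : ∀ (f g : A → B → ℚ) → ∫ μ (λ x → ∫ ν (λ y → f x y + g x y)) ≡ ∫ μ (λ x → ∫ ν (f x)) + ∫ μ (λ x → ∫ ν (g x))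
    ∫∫-+ f g = trans (∫-cong (λ x → ∫-+ (f x) (g x))) (∫-+ _ _)

    ∫∫-- : ∀ (f g : A → B → ℚ) → ∫ μ (λ x → ∫ ν (λ y → f x y - g x y)) ≡ ∫ μ (λ x → ∫ ν (f x)) - ∫ μ (λ x → ∫ ν (g x))
    ∫∫-- f g = trans (∫-cong (λ x → ∫-- (f x) (g x))) (∫-- _ _)

    ∫∫-*ˡ : ∀ c (f : A → B → ℚ) → ∫ μ (λ x → ∫ ν (λ y → c * f x y)) ≡ c * ∫ μ (λ x → ∫ ν (f x))
    ∫∫-*ˡ c f = trans (∫-cong (λ x → ∫-*ˡ c (f x))) (∫-*ˡ c _)

    ∫∫-≥0 : ∀ {f : A → B → ℚ} → (∀ x y → 0ℚ ≤ f x y) → 0ℚ ≤ ∫ μ (λ x → ∫ ν (f x))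
    ∫∫-≥0 h = ∫-≥0 (λ x → ∫-≥0 (h x))

    ∫-*-∫ : ∀ f g → ∫ μ f * ∫ ν g ≡ ∫ μ (λ x → ∫ ν (λ y → f x * g y))
    ∫-*-∫ f g = trans (sym (∫-*ʳ (∫ ν g) f)) (∫-cong (λ x → sym (∫-*ˡ (f x) g)))

  ∫-allFin-suc : ∀ n f → ∫ (counting (allFin (suc n))) f ≡ f zero + ∫ (counting (allFin n)) (λ i → f (suc i))
  ∫-allFin-suc n f = trans (∫-∷ zero _ f) (cong (λ ζ → f zero + ζ) (trans (cong (λ xs → ∫ (counting xs) f)
      (sym (map-tabulate (λ i → i) suc))) (∫-map suc (allFin n) f)))

  ∫-δ : ∀ {n} (i : Fin n) f → ∫ (counting (allFin n)) (λ j → 𝟙 (does (i ≟ᶠ j)) * f j) ≡ f i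
  ∫-δ {suc n} zero f = trans (∫-allFin-suc n _) (trans (cong₂ _+_ (*-identityˡ (f zero))
      (trans (∫-cong (λ j → *-zeroˡ (f (suc j)))) ∫-0)) (+-identityʳ (f zero)))
  ∫-δ {suc n} (suc i) f = trans (∫-allFin-suc n _) (trans (cong₂ _+_ (*-zeroˡ (f zero)) (∫-δ i (λ j → f (suc j))))
      (+-identityˡ (f (suc i))))

  -- Partitions and conditional expectations

  -- An equivalence relation whose symmetry and transitivity are packed into one law: equivalent
  -- points have equal rows of `same`. Positive weights make the averages over classes meaningful.
  record Partition {A : Set} (μ : Measure A) : Set where
    field
      same : A → A → Bool
      same-refl : ∀ x → same x x ≡ true
      same-cong : ∀ x y → same x y ≡ true → ∀ z → same x z ≡ same y z

    weight : A → ℚ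
    weight x = ∫ μ (λ y → 𝟙 (same x y))

    field
      weight>0 : ∀ x → 0ℚ < weight x

    same-sym : ∀ x y → same x y ≡ same y x
    same-sym x y with same x y in p | same y x in q
    ... | true | true = refl
    ... | false | false = refl
    ... | true | false = trans (sym (same-refl x)) (trans (same-cong x y p x) q)
    ... | false | true = trans (sym p) (trans (sym (same-cong y x q y)) (same-refl y))

    weight-cong : ∀ x y → same x y ≡ true → weight x ≡ weight y
    weight-cong x y h = ∫-cong (λ z → cong 𝟙 (same-cong x y h z))

    -- The averaging kernel: `K x` is the density with respect to `μ` of the uniform distribution on
    -- the class of `x`. It is symmetric and stochastic, so `E` is a conditional expectation.
    K : A → A → ℚ
    K x y = 𝟙 (same x y) * inv (weight x)

    K≥0 : ∀ x y → 0ℚ ≤ K x y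
    K≥0 x y = 0≤* (𝟙≥0 (same x y)) (inv≥0 (weight>0 x))

    K-sym : ∀ x y → K x y ≡ K y x
    K-sym x y rewrite same-sym y x with same x y in p
    ... | true = cong (λ w → 1ℚ * inv w) (weight-cong x y p)
    ... | false = trans (*-zeroˡ (inv (weight x))) (sym (*-zeroˡ (inv (weight y))))

    ∫K : ∀ x → ∫ μ (K x) ≡ 1ℚ
    ∫K x = trans (∫-*ʳ (inv (weight x)) _) (*-inv (weight>0 x))

    Invariant : (A → ℚ) → Set
    Invariant u = ∀ x y → same x y ≡ true → u x ≡ u y

    Invariant₂ : (A → A → ℚ) → Set
    Invariant₂ u = (∀ y → Invariant (λ x → u x y)) × (∀ x → Invariant (u x))

    K-invariant : ∀ {u} → Invariant u → ∀ x y → K x y * u y ≡ K x y * u x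
    K-invariant {u} inv-u x y with same x y in p
    ... | true = cong (1ℚ * inv (weight x) *_) (sym (inv-u x y p))
    ... | false = trans (zero-mul (inv (weight x)) (u y)) (sym (zero-mul (inv (weight x)) (u x)))
      where
      zero-mul : ∀ a b → 0ℚ * a * b ≡ 0ℚ
      zero-mul = solve-∀ ℚ-ring

    E : (A → ℚ) → A → ℚ
    E ψ x = ∫ μ (λ y → K x y * ψ y)

    E-invariant : ∀ ψ → Invariant (E ψ)
    E-invariant ψ x y h = ∫-cong (λ z → cong₂ (λ b w → 𝟙 b * inv w * ψ z) (same-cong x y h z) (weight-cong x y h))

    E≥0 : ∀ {ψ} → (∀ x → 0ℚ ≤ ψ x) → ∀ x → 0ℚ ≤ E ψ x
    E≥0 h x = ∫-≥0 (λ y → 0≤* (K≥0 x y) (h y))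

    -- An invariant `u` agrees at both ends of the kernel and can be carried from `x` to `y`;
    -- symmetry of `K` and total mass 1 then remove the average.
    E-adjoint : ∀ ψ {u} → Invariant u → ∫ μ (λ x → ψ x * u x) ≡ ∫ μ (λ x → E ψ x * u x)
    E-adjoint ψ {u} inv-u = sym (begin
      ∫ μ (λ x → E ψ x * u x) ≡⟨ ∫-cong (λ x → sym (∫-*ʳ (u x) _)) ⟩
      ∫ μ (λ x → ∫ μ (λ y → K x y * ψ y * u x)) ≡⟨ ∫-swap _ ⟩
      ∫ μ (λ y → ∫ μ (λ x → K x y * ψ y * u x)) ≡⟨ ∫∫-cong (λ y x → transfer y x) ⟩
      ∫ μ (λ y → ∫ μ (λ x → (ψ y * u y) * K y x)) ≡⟨ ∫-cong (λ y → ∫-*ˡ (ψ y * u y) (K y)) ⟩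
      ∫ μ (λ y → (ψ y * u y) * ∫ μ (K y)) ≡⟨ ∫-cong (λ y → trans (cong (ψ y * u y *_) (∫K y)) (*-identityʳ _)) ⟩
      ∫ μ (λ y → ψ y * u y) ∎)
      where
      open ≡-Reasoning
      r₁ : ∀ k p v → k * p * v ≡ p * (k * v)
      r₁ = solve-∀ ℚ-ring
      r₂ : ∀ k p v → p * (k * v) ≡ (p * v) * k
      r₂ = solve-∀ ℚ-ring
      transfer : ∀ y x → K x y * ψ y * u x ≡ (ψ y * u y) * K y x
      transfer y x = trans (r₁ (K x y) (ψ y) (u x))
        (trans (cong (ψ y *_) (trans (cong (_* u x) (K-sym x y)) (K-invariant inv-u y x))) (r₂ (K y x) (ψ y) (u y)))

    E₂ : (A → A → ℚ) → A → A → ℚ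
    E₂ f x y = E (λ x′ → E (f x′) y) x

    E₂-invariant : ∀ f → Invariant₂ (E₂ f)
    E₂-invariant f = (λ y → E-invariant (λ x′ → E (f x′) y)) ,
      λ x y y′ h → ∫-cong (λ x′ → cong (K x x′ *_) (E-invariant (f x′) y y′ h))

    E₂≥0 : ∀ {f} → (∀ x y → 0ℚ ≤ f x y) → ∀ x y → 0ℚ ≤ E₂ f x y
    E₂≥0 h x y = E≥0 (λ x′ → E≥0 (h x′) y) x

    E₂-adjoint : ∀ f {u} → Invariant₂ u →
      ∫ μ (λ x → ∫ μ (λ y → f x y * u x y)) ≡ ∫ μ (λ x → ∫ μ (λ y → E₂ f x y * u x y))
    E₂-adjoint f {u} (inv₁ , inv₂) = begin
      ∫ μ (λ x → ∫ μ (λ y → f x y * u x y)) ≡⟨ ∫-cong (λ x → E-adjoint (f x) (inv₂ x)) ⟩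
      ∫ μ (λ x → ∫ μ (λ y → E (f x) y * u x y)) ≡⟨ ∫-swap _ ⟩
      ∫ μ (λ y → ∫ μ (λ x → E (f x) y * u x y)) ≡⟨ ∫-cong (λ y → E-adjoint (λ x → E (f x) y) (inv₁ y)) ⟩
      ∫ μ (λ y → ∫ μ (λ x → E₂ f x y * u x y)) ≡⟨ ∫-swap _ ⟩
      ∫ μ (λ x → ∫ μ (λ y → E₂ f x y * u x y)) ∎
      where
      open ≡-Reasoning

    energy : (A → A → ℚ) → ℚ
    energy f = ∫ μ (λ x → ∫ μ (λ y → E₂ f x y * E₂ f x y))

    -- Averaging the first variable after the second can only lower the L² norm. The norm of the
    -- one-variable average unfolds into codegrees of pairs `y`, `y′` from a common class, which is
    -- what a bound on four-cycles can control.
    energy≤ : ∀ f → energy f ≤ ∫ μ (λ x → ∫ μ (λ y → ∫ μ (λ y′ → K y y′ * (f x y * f x y′))))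
    energy≤ f = subst (energy f ≤_) norm-φ (≤-by (D - energy f) (rearrange D (energy f)) (subst (0ℚ ≤_) difference
        (∫∫-≥0 (λ x y → 0≤sq (φ x y - g x y)))))
      where
      φ g : A → A → ℚ
      φ x y = E (f x) y
      g = E₂ f
      D : ℚ
      D = ∫ μ (λ x → ∫ μ (λ y → φ x y * φ x y))
      rearrange : ∀ d e → d ≡ e + (d - e)
      rearrange = solve-∀ ℚ-ring
      square : ∀ p q → (p - q) * (p - q) ≡ (p * p + q * q) - (p * q + p * q)
      square = solve-∀ ℚ-ring
      collect : ∀ d e → d + e - (e + e) ≡ d - e
      collect = solve-∀ ℚ-ring
      φg : ∫ μ (λ x → ∫ μ (λ y → φ x y * g x y)) ≡ energy f
      φg = trans (∫-swap _) (trans (∫-cong (λ y → E-adjoint (λ x → φ x y) (proj₁ (E₂-invariant f) y))) (∫-swap _))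
      difference : ∫ μ (λ x → ∫ μ (λ y → (φ x y - g x y) * (φ x y - g x y))) ≡ D - energy f
      difference = begin
        ∫ μ (λ x → ∫ μ (λ y → (φ x y - g x y) * (φ x y - g x y))) ≡⟨ ∫∫-cong (λ x y → square (φ x y) (g x y)) ⟩
        ∫ μ (λ x → ∫ μ (λ y → (φ x y * φ x y + g x y * g x y) - (φ x y * g x y + φ x y * g x y))) ≡⟨ ∫∫-- _ _ ⟩
        ∫ μ (λ x → ∫ μ (λ y → φ x y * φ x y + g x y * g x y)) - ∫ μ (λ x → ∫ μ (λ y → φ x y * g x y + φ x y * g x y))
          ≡⟨ cong₂ _-_ (∫∫-+ _ _) (trans (∫∫-+ _ _) (cong₂ _+_ φg φg)) ⟩
        D + energy f - (energy f + energy f) ≡⟨ collect D (energy f) ⟩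
        D - energy f ∎
        where open ≡-Reasoning
      pull : ∀ a k b → a * (k * b) ≡ k * (a * b)
      pull = solve-∀ ℚ-ring
      norm-φ : D ≡ ∫ μ (λ x → ∫ μ (λ y → ∫ μ (λ y′ → K y y′ * (f x y * f x y′))))
      norm-φ = ∫-cong (λ x → trans (sym (E-adjoint (f x) (E-invariant (f x))))
        (∫-cong (λ y → trans (sym (∫-*ˡ (f x y) _)) (∫-cong (λ y′ → pull (f x y) (K y y′) (f x y′))))))

  module _ {A : Set} {μ : Measure A} (P Q : Partition μ)
    (refines : ∀ x y → Partition.same Q x y ≡ true → Partition.same P x y ≡ true) (f : A → A → ℚ) where

    open Partition

    private
      p q : A → A → ℚ
      p = E₂ P f
      q = E₂ Q f

      p-invariant : Invariant₂ Q p
      p-invariant = (λ y x x′ h → proj₁ (E₂-invariant P f) y x x′ (refines x x′ h)) ,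
                    (λ x y y′ h → proj₂ (E₂-invariant P f) x y y′ (refines y y′ h))

      cross : ∫ μ (λ x → ∫ μ (λ y → q x y * p x y)) ≡ energy P f
      cross = trans (sym (E₂-adjoint Q f p-invariant)) (E₂-adjoint P f (E₂-invariant P f))

    -- The coarse average is constant on fine classes, so its inner product with the fine average
    -- equals that with `f`, which is the coarse energy (`cross`).
    pythagoras : energy Q f ≡ energy P f + ∫ μ (λ x → ∫ μ (λ y → (q x y - p x y) * (q x y - p x y)))
    pythagoras = trans (collect (energy P f) (energy Q f)) (cong (λ ζ → energy P f + ζ) (sym difference))
      where
      square : ∀ p q → (q - p) * (q - p) ≡ (p * p + q * q) - (q * p + q * p)
      square = solve-∀ ℚ-ring
      collect : ∀ e d → d ≡ e + (e + d - (e + e))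
      collect = solve-∀ ℚ-ring
      difference : ∫ μ (λ x → ∫ μ (λ y → (q x y - p x y) * (q x y - p x y))) ≡ energy P f + energy Q f -
          (energy P f + energy P f)
      difference = trans (∫∫-cong (λ x y → square (p x y) (q x y)))
        (trans (∫∫-- _ _) (cong₂ _-_ (∫∫-+ _ _) (trans (∫∫-+ _ _) (cong₂ _+_ cross cross))))

  -- Partitions generated by cuts

  infix 4 _≡ᵇ_

  _≡ᵇ_ : Bool → Bool → Bool
  true ≡ᵇ b = b
  false ≡ᵇ b = not b

  ≡ᵇ-refl : ∀ b → (b ≡ᵇ b) ≡ true
  ≡ᵇ-refl true = refl
  ≡ᵇ-refl false = refl

  ≡ᵇ⇒≡ : ∀ b c → (b ≡ᵇ c) ≡ true → b ≡ c
  ≡ᵇ⇒≡ true true h = refl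
  ≡ᵇ⇒≡ false false h = refl

  ∧-true : ∀ b c → b ∧ c ≡ true → b ≡ true × c ≡ true
  ∧-true true true h = refl , refl

  halfPower : ℕ → ℚ
  halfPower zero = 1ℚ
  halfPower (suc n) = ½ * halfPower n

  halfPower>0 : ∀ n → 0ℚ < halfPower n
  halfPower>0 zero = 0<1
  halfPower>0 (suc n) = 0<* (positive⁻¹ ½) (halfPower>0 n)

  halfPower-antimono : ∀ {m n} → m ℕ.≤ n → halfPower n ≤ halfPower m
  halfPower-antimono {zero} {zero} h = ≤-refl
  halfPower-antimono {zero} {suc n} h = *-mono-≤ {q = 1ℚ} {s = 1ℚ} 0≤½ (<⇒≤ (halfPower>0 n)) (≤-by ½ refl 0≤½)
      (halfPower-antimono {zero} {n} ℕ.z≤n)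
  halfPower-antimono {suc m} {suc n} (ℕ.s≤s h) = *-monoˡ-≤ 0≤½ (halfPower-antimono h)

  bits : ∀ T → List (Vec Bool T)
  bits zero = [] ∷ []
  bits (suc T) = map (true ∷_) (bits T) ++ map (false ∷_) (bits T)

  bit : ∀ {T} → ℕ → Vec Bool T → Bool
  bit j [] = false
  bit zero (b ∷ bs) = b
  bit (suc j) (b ∷ bs) = bit j bs

  uniform : ∀ T → Measure (Vec Bool T)
  uniform T = scale (halfPower T) (<⇒≤ (halfPower>0 T)) (counting (bits T))

  ∫-uniform-suc : ∀ T f → ∫ (uniform (suc T)) f ≡ ½ * (∫ (uniform T) (λ b → f (true ∷ b)) + ∫ (uniform T) (λ b →
      f (false ∷ b)))
  ∫-uniform-suc T f = begin
    ∫ (uniform (suc T)) f ≡⟨ ∫-scale f ⟩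
    ½ * halfPower T * ∫ (counting (bits (suc T))) f
      ≡⟨ cong (½ * halfPower T *_) (trans (∫-++ (map (true ∷_) (bits T)) _ f) (cong₂ _+_ (∫-map (true ∷_) (bits T)
          f) (∫-map (false ∷_) (bits T) f))) ⟩
    ½ * halfPower T * (∫ (counting (bits T)) (λ b → f (true ∷ b)) + ∫ (counting (bits T)) (λ b → f (false ∷ b)))
      ≡⟨ distribute ½ (halfPower T) _ _ ⟩
    ½ * (halfPower T * ∫ (counting (bits T)) (λ b → f (true ∷ b)) + halfPower T * ∫ (counting (bits T)) (λ b →
        f (false ∷ b)))
      ≡⟨ cong (½ *_) (cong₂ _+_ (sym (∫-scale _)) (sym (∫-scale _))) ⟩
    ½ * (∫ (uniform T) (λ b → f (true ∷ b)) + ∫ (uniform T) (λ b → f (false ∷ b))) ∎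
    where
    open ≡-Reasoning
    distribute : ∀ h c x y → h * c * (x + y) ≡ h * (c * x + c * y)
    distribute = solve-∀ ℚ-ring

  ½-double : ∀ x → ½ * (x + x) ≡ x
  ½-double = solve-∀ ℚ-ring

  ∫-uniform-1 : ∀ T → ∫ (uniform T) (λ _ → 1ℚ) ≡ 1ℚ
  ∫-uniform-1 zero = trans (∫-scale _) (trans (*-identityˡ _) (trans (∫-∷ [] [] _) (cong (λ ζ → 1ℚ + ζ)
      (∫-[] {A = Vec Bool 0} _))))
  ∫-uniform-1 (suc T) = trans (∫-uniform-suc T _) (trans (cong (λ z → ½ * (z + z)) (∫-uniform-1 T)) (½-double 1ℚ))

  IgnoresBit : ∀ {T} → ℕ → (Vec Bool T → ℚ) → Set
  IgnoresBit t g = ∀ b b′ → (∀ j → j ≢ t → bit j b ≡ bit j b′) → g b ≡ g b′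

  -- Under the uniform measure bit `t` is a fair coin, independent of everything that `g` depends
  -- on.
  ∫-fix-bit : ∀ T t p {g} → t ℕ.< T → IgnoresBit t g → ∫ (uniform T) (λ b → 𝟙 (p ≡ᵇ bit t b) * g b) ≡
      ½ * ∫ (uniform T) g
  ∫-fix-bit (suc T) zero p {g} _ ign = trans (∫-uniform-suc T _) (cong (½ *_) (both p))
    where
    total : ℚ
    total = ∫ (uniform (suc T)) g
    flip : ∀ b → g (true ∷ b) ≡ g (false ∷ b)
    flip b = ign _ _ λ { zero j≢0 → contradiction refl j≢0 ; (suc j) _ → refl }
    half : ∀ x → ∫ (uniform T) (λ b → g (x ∷ b)) ≡ total
    half true = sym (trans (∫-uniform-suc T g) (trans (cong (λ z → ½ * (∫ (uniform T) (λ b → g (true ∷ b)) + z))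
        (∫-cong (λ b → sym (flip b)))) (½-double _)))
    half false = trans (∫-cong (λ b → sym (flip b))) (half true)
    keep : ∀ x → ∫ (uniform T) (λ b → 1ℚ * g (x ∷ b)) ≡ total
    keep x = trans (∫-cong (λ b → *-identityˡ _)) (half x)
    drop : ∀ x → ∫ (uniform T) (λ b → 0ℚ * g (x ∷ b)) ≡ 0ℚ
    drop x = trans (∫-cong (λ b → *-zeroˡ (g (x ∷ b)))) ∫-0
    both : ∀ p → ∫ (uniform T) (λ b → 𝟙 (p ≡ᵇ true) * g (true ∷ b)) + ∫ (uniform T) (λ b → 𝟙 (p ≡ᵇ false) * g
        (false ∷ b)) ≡ total
    both true = trans (cong₂ _+_ (keep true) (drop false)) (+-identityʳ total)
    both false = trans (cong₂ _+_ (drop true) (keep false)) (+-identityˡ total)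
  ∫-fix-bit (suc T) (suc t) p {g} (ℕ.s≤s t<T) ign = begin
    ∫ (uniform (suc T)) (λ b → 𝟙 (p ≡ᵇ bit (suc t) b) * g b) ≡⟨ ∫-uniform-suc T _ ⟩
    ½ * (∫ (uniform T) (λ b → 𝟙 (p ≡ᵇ bit t b) * g (true ∷ b)) + ∫ (uniform T) (λ b → 𝟙 (p ≡ᵇ bit t b) * g (false ∷ b)))
      ≡⟨ cong (½ *_) (cong₂ _+_ (∫-fix-bit T t p t<T (ign′ true)) (∫-fix-bit T t p t<T (ign′ false))) ⟩
    ½ * (½ * ∫ (uniform T) (λ b → g (true ∷ b)) + ½ * ∫ (uniform T) (λ b → g (false ∷ b)))
      ≡⟨ cong (½ *_) (trans (sym (*-distribˡ-+ ½ (∫ (uniform T) (λ b → g (true ∷ b))) (∫ (uniform T) (λ b →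
          g (false ∷ b))))) (sym (∫-uniform-suc T g))) ⟩
    ½ * ∫ (uniform (suc T)) g ∎
    where
    open ≡-Reasoning
    ign′ : ∀ x → IgnoresBit t (λ b → g (x ∷ b))
    ign′ x b b′ h = ign _ _ λ { zero _ → refl ; (suc j) j≢t → h j (λ e → j≢t (cong suc e)) }

  -- The pattern lists the prescribed bits from the last to the first.
  matches : ∀ {T} → List Bool → Vec Bool T → Bool
  matches [] b = true
  matches (p ∷ ps) b = (p ≡ᵇ bit (length ps) b) ∧ matches ps b

  matches-ignores : ∀ {T} ps t → length ps ℕ.≤ t → IgnoresBit {T} t (λ b → 𝟙 (matches ps b))
  matches-ignores ps t h b b′ same = cong 𝟙 (go ps h)
    where
    go : ∀ ps → length ps ℕ.≤ t → matches ps b ≡ matches ps b′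
    go [] h = refl
    go (p ∷ ps) h = cong₂ (λ x y → (p ≡ᵇ x) ∧ y) (same (length ps) (ℕ.<⇒≢ h)) (go ps (ℕ.<⇒≤ h))

  ∫-matches : ∀ T ps → length ps ℕ.≤ T → ∫ (uniform T) (λ b → 𝟙 (matches ps b)) ≡ halfPower (length ps)
  ∫-matches T [] h = ∫-uniform-1 T
  ∫-matches T (p ∷ ps) h = trans (∫-cong (λ b → 𝟙-∧ (p ≡ᵇ bit (length ps) b) (matches ps b)))
    (trans (∫-fix-bit T (length ps) p h (matches-ignores ps (length ps) ℕ.≤-refl))
      (cong (½ *_) (∫-matches T ps (ℕ.<⇒≤ h))))

  -- Besides the real vertices Fin N there are fake vertices Vec Bool T of total mass τ; the
  -- t-th cut splits them by their t-th bit, so that every class of a partition into at most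
  -- 2^t classes has fake mass τ / 2^t: weights are bounded below.
  module Cuts {N : ℕ} (ν : Measure (Fin N)) (ν-1 : ∫ ν (λ _ → 1ℚ) ≡ 1ℚ) (T : ℕ) (τ : ℚ) (0<τ : 0ℚ < τ) (τ≤1 : τ ≤ 1ℚ) where

    V A : Set
    V = Fin N
    A = V ⊎ Vec Bool T

    fakes : Measure (Vec Bool T)
    fakes = scale τ (<⇒≤ 0<τ) (uniform T)

    μ : Measure A
    μ = ν ⊕ fakes

    ∫-fakes-1 : ∫ fakes (λ _ → 1ℚ) ≡ τ
    ∫-fakes-1 = trans (∫-scale _) (trans (cong (τ *_) (∫-uniform-1 T)) (*-identityʳ τ))

    ∫-μ-1 : ∫ μ (λ _ → 1ℚ) ≡ 1ℚ + τ
    ∫-μ-1 = trans (∫-⊕ _) (cong₂ _+_ ν-1 ∫-fakes-1)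

    ∫-μ-1≤2 : ∫ μ (λ _ → 1ℚ) ≤ 2ℚ
    ∫-μ-1≤2 = subst (_≤ 2ℚ) (sym ∫-μ-1) (+-monoʳ-≤ 1ℚ τ≤1)

    side : ℕ → (V → Bool) → A → Bool
    side t S (inj₁ v) = S v
    side t S (inj₂ b) = bit t b

    -- The position from the end of the list decides which bit a cut uses. Distinct cuts thus use
    -- distinct bits, and a newly added cut does not disturb the bits of the older ones, so longer
    -- lists refine.
    sameSides : List (V → Bool) → A → A → Bool
    sameSides [] x y = true
    sameSides (S ∷ P) x y = (side (length P) S x ≡ᵇ side (length P) S y) ∧ sameSides P x y

    sameSides-refl : ∀ P x → sameSides P x x ≡ true
    sameSides-refl [] x = refl
    sameSides-refl (S ∷ P) x = cong₂ _∧_ (≡ᵇ-refl (side (length P) S x)) (sameSides-refl P x)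

    sameSides-cong : ∀ P x y → sameSides P x y ≡ true → ∀ z → sameSides P x z ≡ sameSides P y z
    sameSides-cong [] x y h z = refl
    sameSides-cong (S ∷ P) x y h z with ∧-true (side (length P) S x ≡ᵇ side (length P) S y) (sameSides P x y) h
    ... | h₁ , h₂ = cong₂ (λ s r → (s ≡ᵇ side (length P) S z) ∧ r) (≡ᵇ⇒≡ (side (length P) S x) (side (length P) S y)
        h₁) (sameSides-cong P x y h₂ z)

    signature : List (V → Bool) → A → List Bool
    signature [] x = []
    signature (S ∷ P) x = side (length P) S x ∷ signature P x

    length-signature : ∀ P x → length (signature P x) ≡ length P
    length-signature [] x = refl
    length-signature (S ∷ P) x = cong suc (length-signature P x)

    sameSides-fake : ∀ P x b → sameSides P x (inj₂ b) ≡ matches (signature P x) b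
    sameSides-fake [] x b = refl
    sameSides-fake (S ∷ P) x b = cong₂ (λ t r → (side (length P) S x ≡ᵇ bit t b) ∧ r) (sym (length-signature P x))
        (sameSides-fake P x b)

    realMass : List (V → Bool) → A → ℚ
    realMass P x = ∫ ν (λ v → 𝟙 (sameSides P x (inj₁ v)))

    fakeMass : List (V → Bool) → ℚ
    fakeMass P = τ * halfPower (length P)

    fakeMass>0 : ∀ P → 0ℚ < fakeMass P
    fakeMass>0 P = 0<* 0<τ (halfPower>0 (length P))

    -- A class meets the fake vertices exactly in those that have `length P` prescribed bits; only
    -- `T` bits exist, hence the restriction on the number of cuts.
    ∫-fake-class : ∀ P → length P ℕ.≤ T → ∀ x → ∫ fakes (λ b → 𝟙 (sameSides P x (inj₂ b))) ≡ fakeMass P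
    ∫-fake-class P h x = trans (∫-scale _) (cong (τ *_) (trans (∫-cong (λ b → cong 𝟙 (sameSides-fake P x b)))
      (trans (∫-matches T (signature P x) (subst (ℕ._≤ T) (sym (length-signature P x)) h)) (cong halfPower
          (length-signature P x)))))

    class-mass : ∀ P → length P ℕ.≤ T → ∀ x → ∫ μ (λ y → 𝟙 (sameSides P x y)) ≡ realMass P x + fakeMass P
    class-mass P h x = trans (∫-⊕ _) (cong (λ ζ → realMass P x + ζ) (∫-fake-class P h x))

    realMass≥0 : ∀ P x → 0ℚ ≤ realMass P x
    realMass≥0 P x = ∫-≥0 (λ v → 𝟙≥0 (sameSides P x (inj₁ v)))

    partition : ∀ P → length P ℕ.≤ T → Partition μ
    partition P h = record
      { same = sameSides P
      ; same-refl = sameSides-refl P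
      ; same-cong = sameSides-cong P
      ; weight>0 = λ x → subst (0ℚ <_) (sym (class-mass P h x)) (subst (0ℚ <_) (+-comm (fakeMass P) _)
          (0<+ (fakeMass>0 P) (realMass≥0 P x)))
      }

    ∫-μ-≥ : ∀ {f} → (∀ x → 0ℚ ≤ f x) → ∫ ν (λ v → f (inj₁ v)) ≤ ∫ μ f
    ∫-μ-≥ {f} f≥0 = ≤-by _ (∫-⊕ f) (∫-≥0 (λ b → f≥0 (inj₂ b)))

    ∫-μ-real : ∀ f → (∀ b → f (inj₂ b) ≡ 0ℚ) → ∫ μ f ≡ ∫ ν (λ v → f (inj₁ v))
    ∫-μ-real f f≡0 = trans (∫-⊕ f) (trans (cong (λ ζ → ∫ ν (λ v → f (inj₁ v)) + ζ) (trans (∫-cong f≡0) ∫-0))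
        (+-identityʳ _))

    lift : (V → V → ℚ) → A → A → ℚ
    lift f (inj₁ u) (inj₁ v) = f u v
    lift f (inj₁ u) (inj₂ b) = 0ℚ
    lift f (inj₂ b) y = 0ℚ

    lift≥0 : ∀ {f} → (∀ u v → 0ℚ ≤ f u v) → ∀ x y → 0ℚ ≤ lift f x y
    lift≥0 h (inj₁ u) (inj₁ v) = h u v
    lift≥0 h (inj₁ u) (inj₂ b) = ≤-refl
    lift≥0 h (inj₂ b) y = ≤-refl

    ∫∫-lift : ∀ f (g : A → A → ℚ) → ∫ μ (λ x → ∫ μ (λ y → lift f x y * g x y)) ≡
        ∫ ν (λ u → ∫ ν (λ v → f u v * g (inj₁ u) (inj₁ v)))
    ∫∫-lift f g = trans (∫-μ-real (λ x → ∫ μ (λ y → lift f x y * g x y)) (λ b → trans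
        (∫-cong (λ y → *-zeroˡ (g (inj₂ b) y))) ∫-0))
      (∫-cong (λ u → ∫-μ-real (λ y → lift f (inj₁ u) y * g (inj₁ u) y) (λ b → *-zeroˡ (g (inj₁ u) (inj₂ b)))))

  -- Regularity by energy increments

  indices : Measure (Fin 5)
  indices = counting (allFin 5)

  -- Five graphs, each of energy at most 2.
  energyCap : ℚ
  energyCap = 2ℚ * ∫ indices (λ _ → 1ℚ)

  gain>0 : ∀ {ℓ} → 0ℚ < ℓ → 0ℚ < 4ℚ * (ℓ * ℓ)
  gain>0 h = 0<* (positive⁻¹ 4ℚ) (0<* h h)

  -- A violated cut raises the energy by `4ℚ * (ℓ * ℓ)`, as `norm≥` shows, so this many violations
  -- in succession would exceed the cap. Each adds two cuts, whence the factor 2 in `tower`.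
  microSteps : ∀ {ℓ} → 0ℚ < ℓ → ℕ
  microSteps h = proj₁ (archimedes energyCap (gain>0 h))

  -- The partitions produced by the J-th round have at most 2 ^ tower J 0 classes; ℓ t is the
  -- accuracy demanded after a partition made of t cuts.
  tower : {ℓ : ℕ → ℚ} → (∀ t → 0ℚ < ℓ t) → ℕ → ℕ → ℕ
  tower ℓ>0 zero t = t
  tower ℓ>0 (suc J) t = tower ℓ>0 J (t ℕ.+ microSteps (ℓ>0 t) ℕ.* 2)

  tower-≥ : ∀ {ℓ : ℕ → ℚ} (ℓ>0 : ∀ t → 0ℚ < ℓ t) J t → t ℕ.≤ tower ℓ>0 J t
  tower-≥ ℓ>0 zero t = ℕ.≤-refl
  tower-≥ ℓ>0 (suc J) t = ℕ.≤-trans (ℕ.m≤m+n t _) (tower-≥ ℓ>0 J _)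

  module Iteration {N : ℕ} (ν : Measure (Fin N)) (ν-1 : ∫ ν (λ _ → 1ℚ) ≡ 1ℚ) (T : ℕ) (τ : ℚ) (0<τ : 0ℚ < τ) (τ≤1 : τ ≤ 1ℚ)
    (p : Fin 5 → Fin N → Fin N → ℚ)
    (bounded : ∀ P h i → Partition.energy (Cuts.partition ν ν-1 T τ 0<τ τ≤1 P h) (Cuts.lift ν ν-1 T τ 0<τ τ≤1 (p i))
        ≤ 2ℚ)
    (p≥0 : ∀ i u v → 0ℚ ≤ p i u v)
    where

    open Cuts ν ν-1 T τ 0<τ τ≤1 public
    open Partition

    Cut : Set
    Cut = V → Bool

    density : ∀ P → length P ℕ.≤ T → Fin 5 → A → A → ℚ
    density P h i = E₂ (partition P h) (lift (p i))

    density≥0 : ∀ P h i x y → 0ℚ ≤ density P h i x y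
    density≥0 P h i = E₂≥0 (partition P h) (lift≥0 (p≥0 i))

    energyᵢ : ∀ P → length P ℕ.≤ T → Fin 5 → ℚ
    energyᵢ P h i = energy (partition P h) (lift (p i))

    totalEnergy : ∀ P → length P ℕ.≤ T → ℚ
    totalEnergy P h = ∫ indices (energyᵢ P h)

    totalEnergy≥0 : ∀ P h → 0ℚ ≤ totalEnergy P h
    totalEnergy≥0 P h = ∫-≥0 (λ i → ∫∫-≥0 (λ x y → 0≤sq (density P h i x y)))

    totalEnergy≤ : ∀ P h → totalEnergy P h ≤ energyCap
    totalEnergy≤ P h = ≤-trans (∫-mono (bounded P h)) (≤-reflexive (∫-const 2ℚ))

    discrepancy : ∀ P → length P ℕ.≤ T → Fin 5 → Cut → Cut → ℚ
    discrepancy P h i S S′ = ∫ ν (λ u → ∫ ν (λ v → 𝟙 (S u) * (𝟙 (S′ v) * (p i u v - density P h i (inj₁ u) (inj₁ v)))))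

    -- Only rectangles of real vertices are tested. The factor 4 is the bound for the squared total
    -- mass of `μ`, against which `norm≥` balances `ℓ`.
    Regular : ℚ → ∀ P → length P ℕ.≤ T → Set
    Regular ℓ P h = ∀ i S S′ → - (4ℚ * ℓ) ≤ discrepancy P h i S S′

    Refines : List Cut → List Cut → Set
    Refines Q P = ∀ x y → sameSides Q x y ≡ true → sameSides P x y ≡ true

    refines-∷ : ∀ S P → Refines (S ∷ P) P
    refines-∷ S P x y h = proj₂ (∧-true (side (length P) S x ≡ᵇ side (length P) S y) (sameSides P x y) h)

    energy-pythagoras : ∀ P Q h k → Refines Q P → ∀ i → energyᵢ Q k i ≡ energyᵢ P h i +
      ∫ μ (λ x → ∫ μ (λ y → (density Q k i x y - density P h i x y) * (density Q k i x y - density P h i x y)))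
    energy-pythagoras P Q h k r i = pythagoras (partition P h) (partition Q k) r (lift (p i))

    module Increment (P : List Cut) (S S′ : Cut) (h : length P ℕ.≤ T) (k : length (S ∷ S′ ∷ P) ℕ.≤ T) (i : Fin 5) {ℓ : ℚ} (0<ℓ : 0ℚ < ℓ)
      (violated : discrepancy P h i S S′ < - (4ℚ * ℓ)) where

      Q : List Cut
      Q = S ∷ S′ ∷ P

      Q-refines : Refines Q P
      Q-refines x y e = refines-∷ S′ P x y (refines-∷ S (S′ ∷ P) x y e)

      q g u diff : A → A → ℚ
      q = density Q k i
      g = density P h i
      diff x y = q x y - g x y

      left right : A → Bool
      left = side (suc (length P)) S
      right = side (length P) S′

      u x y = 𝟙 (left x) * 𝟙 (right y)

      u≥0 : ∀ x y → 0ℚ ≤ u x y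
      u≥0 x y = 0≤* (𝟙≥0 (left x)) (𝟙≥0 (right y))

      u-invariant : Invariant₂ (partition Q k) u
      u-invariant = (λ y x x′ e → cong (λ b → 𝟙 b * 𝟙 (right y)) (≡ᵇ⇒≡ (left x) (left x′)
          (proj₁ (∧-true (left x ≡ᵇ left x′) _ e))))
        , (λ x y y′ e → cong (λ b → 𝟙 (left x) * 𝟙 b) (≡ᵇ⇒≡ (right y) (right y′)
            (proj₁ (∧-true (right y ≡ᵇ right y′) _ (refines-∷ S (S′ ∷ P) y y′ e)))))

      real : (A → A → ℚ) → ℚ
      real f = ∫ ν (λ v → ∫ ν (λ w → f (inj₁ v) (inj₁ w)))

      ∫∫qu : ∫ μ (λ x → ∫ μ (λ y → q x y * u x y)) ≡ real (λ x y → lift (p i) x y * u x y)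
      ∫∫qu = trans (sym (E₂-adjoint (partition Q k) (lift (p i)) u-invariant)) (∫∫-lift (p i) u)

      ∫∫gu : real (λ x y → g x y * u x y) ≤ ∫ μ (λ x → ∫ μ (λ y → g x y * u x y))
      ∫∫gu = ≤-trans (∫-mono (λ v → ∫-μ-≥ (gu≥0 (inj₁ v)))) (∫-μ-≥ (λ x → ∫-≥0 (gu≥0 x)))
        where
        gu≥0 : ∀ x y → 0ℚ ≤ g x y * u x y
        gu≥0 x y = 0≤* (density≥0 P h i x y) (u≥0 x y)

      inner : ℚ
      inner = ∫ μ (λ x → ∫ μ (λ y → diff x y * u x y))

      -- As `u` is invariant under `Q`, the average `q` may be replaced by the lifted graph, which
      -- has no edges at fake vertices. There `g` is nonnegative, so the fake part of the integral
      -- is at most 0: the sign that a violation from below needs.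
      inner≤ : inner ≤ discrepancy P h i S S′
      inner≤ = begin
        inner ≡⟨ ∫∫-cong (λ x y → *-distribʳ-- (q x y) (g x y) (u x y)) ⟩
        ∫ μ (λ x → ∫ μ (λ y → q x y * u x y - g x y * u x y)) ≡⟨ ∫∫-- _ _ ⟩
        ∫ μ (λ x → ∫ μ (λ y → q x y * u x y)) - ∫ μ (λ x → ∫ μ (λ y → g x y * u x y))
          ≤⟨ +-mono-≤ (≤-reflexive ∫∫qu) (neg-antimono-≤ ∫∫gu) ⟩
        real (λ x y → lift (p i) x y * u x y) - real (λ x y → g x y * u x y) ≡⟨ sym (∫∫-- _ _) ⟩
        ∫ ν (λ v → ∫ ν (λ w → p i v w * u (inj₁ v) (inj₁ w) - g (inj₁ v) (inj₁ w) * u (inj₁ v) (inj₁ w)))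
          ≡⟨ ∫∫-cong (λ v w → regroup (p i v w) (g (inj₁ v) (inj₁ w)) (𝟙 (S v)) (𝟙 (S′ w))) ⟩
        discrepancy P h i S S′ ∎
        where
        open ≤-Reasoning
        *-distribʳ-- : ∀ a b c → (a - b) * c ≡ a * c - b * c
        *-distribʳ-- = solve-∀ ℚ-ring
        regroup : ∀ a b s t → a * (s * t) - b * (s * t) ≡ s * (t * (a - b))
        regroup = solve-∀ ℚ-ring

      norm mass² : ℚ
      norm = ∫ μ (λ x → ∫ μ (λ y → diff x y * diff x y))
      mass² = ∫ μ (λ x → ∫ μ (λ y → u x y * u x y))

      mass²≤4 : mass² ≤ 4ℚ
      mass²≤4 = begin
        mass² ≤⟨ ∫∫-mono (λ x y → *-mono-≤ (u≥0 x y) (u≥0 x y) (u≤1 x y) (u≤1 x y)) ⟩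
        ∫ μ (λ x → ∫ μ (λ y → 1ℚ * 1ℚ)) ≡⟨ sym (∫-*-∫ (λ _ → 1ℚ) (λ _ → 1ℚ)) ⟩
        ∫ μ (λ _ → 1ℚ) * ∫ μ (λ _ → 1ℚ) ≤⟨ *-mono-≤ (∫-≥0 (λ _ → 0≤1)) (∫-≥0 (λ _ → 0≤1)) ∫-μ-1≤2 ∫-μ-1≤2 ⟩
        2ℚ * 2ℚ ∎
        where
        open ≤-Reasoning
        u≤1 : ∀ x y → u x y ≤ 1ℚ
        u≤1 x y = *-mono-≤ {q = 1ℚ} {s = 1ℚ} (𝟙≥0 (left x)) (𝟙≥0 (right y)) (𝟙≤1 (left x)) (𝟙≤1 (right y))

      -- Cauchy-Schwarz without square roots. The norm of `diff + ℓ u` is nonnegative, with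
      -- `inner ≤ - 4ℓ` and `mass² ≤ 4`, so `norm` is at least 8ℓ² minus 4ℓ².
      norm≥ : 4ℚ * (ℓ * ℓ) ≤ norm
      norm≥ = ≤-by _ (certificate norm inner mass² ℓ)
        (0≤+ (subst (0ℚ ≤_) expand (∫∫-≥0 (λ x y → 0≤sq (diff x y + ℓ * u x y))))
          (0≤+ (0≤* (0≤+ (<⇒≤ 0<ℓ) (<⇒≤ 0<ℓ)) (gap (≤-trans inner≤ (<⇒≤ violated)))) (0≤* (0≤sq ℓ) (gap mass²≤4))))
        where
        certificate : ∀ H D U ℓ → H ≡ 4ℚ * (ℓ * ℓ) + ((H + ℓ * (D + D) + ℓ * ℓ * U) + ((ℓ + ℓ) * (- (4ℚ * ℓ) - D) +
            ℓ * ℓ * (4ℚ - U)))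
        certificate = solve-∀ ℚ-ring
        square : ∀ d u ℓ → (d + ℓ * u) * (d + ℓ * u) ≡ d * d + ℓ * (d * u + d * u) + ℓ * ℓ * (u * u)
        square = solve-∀ ℚ-ring
        expand : ∫ μ (λ x → ∫ μ (λ y → (diff x y + ℓ * u x y) * (diff x y + ℓ * u x y))) ≡
            norm + ℓ * (inner + inner) + ℓ * ℓ * mass²
        expand = trans (∫∫-cong (λ x y → square (diff x y) (u x y) ℓ)) (trans (∫∫-+ _ _)
          (cong₂ _+_ (trans (∫∫-+ _ _) (cong (λ ζ → norm + ζ) (trans (∫∫-*ˡ ℓ _) (cong (ℓ *_) (∫∫-+ _ _)))))
              (∫∫-*ˡ (ℓ * ℓ) _)))

      -- Refinement costs no graph any energy, by Pythagoras, and the violated graph `i` gains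
      -- `norm`.
      increment : totalEnergy P h + 4ℚ * (ℓ * ℓ) ≤ totalEnergy Q k
      increment = begin
        totalEnergy P h + 4ℚ * (ℓ * ℓ) ≡⟨ cong (λ ζ → totalEnergy P h + ζ) (sym (∫-δ i (λ _ → 4ℚ * (ℓ * ℓ)))) ⟩
        totalEnergy P h + ∫ indices (λ j → 𝟙 (does (i ≟ᶠ j)) * (4ℚ * (ℓ * ℓ))) ≡⟨ sym (∫-+ _ _) ⟩
        ∫ indices (λ j → energyᵢ P h j + 𝟙 (does (i ≟ᶠ j)) * (4ℚ * (ℓ * ℓ))) ≤⟨ ∫-mono each ⟩
        totalEnergy Q k ∎
        where
        open ≤-Reasoning
        each : ∀ j → energyᵢ P h j + 𝟙 (does (i ≟ᶠ j)) * (4ℚ * (ℓ * ℓ)) ≤ energyᵢ Q k j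
        each j with i ≟ᶠ j
        ... | yes refl = subst₂ _≤_ (cong (λ ζ → energyᵢ P h i + ζ) (sym (*-identityˡ _)))
            (sym (energy-pythagoras P Q h k Q-refines i))
                (+-monoʳ-≤ (energyᵢ P h i) norm≥)
        ... | no _ = subst₂ _≤_ (cong (λ ζ → energyᵢ P h j + ζ) (sym (*-zeroˡ (4ℚ * (ℓ * ℓ)))))
            (sym (energy-pythagoras P Q h k Q-refines j))
                (+-monoʳ-≤ (energyᵢ P h j) (∫∫-≥0 (λ x y → 0≤sq (density Q k j x y - density P h j x y))))

    -- Pairs of subsets of `Fin N` can be searched exhaustively; `tabulate` and `lookup` pass
    -- between them and cuts given as functions.
    regular-or-violated : ∀ ℓ P h → (∃ λ i → ∃ λ S → ∃ λ S′ → discrepancy P h i S S′ < - (4ℚ * ℓ)) ⊎ Regular ℓ P h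
    regular-or-violated ℓ P h with any? (λ i → anySubset? {N} (λ S → anySubset? {N} (λ S′ → discrepancy P h i
        (lookup S) (lookup S′) <? - (4ℚ * ℓ))))
    ... | yes (i , S , S′ , v) = inj₁ (i , lookup S , lookup S′ , v)
    ... | no none = inj₂ λ i S S′ → subst (- (4ℚ * ℓ) ≤_)
            (∫∫-cong (λ u v → cong₂ (λ b c → 𝟙 b * (𝟙 c * (p i u v - density P h i (inj₁ u) (inj₁ v))))
                (lookup∘tabulate S u) (lookup∘tabulate S′ v)))
            (≮⇒≥ (λ v → none (i , tabulate S , tabulate S′ , v)))

    drop-2 : ∀ {l m} → l ℕ.+ suc m ℕ.* 2 ℕ.≤ T → suc (suc l) ℕ.+ m ℕ.* 2 ℕ.≤ T
    drop-2 {l} {m} h = subst (ℕ._≤ T) (trans (ℕ.+-suc l (suc (m ℕ.* 2))) (cong suc (ℕ.+-suc l (m ℕ.* 2)))) h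

    -- `m` is the number of increments still granted. The invariant says that `m` of them would lift
    -- the energy above the cap, so at `m = 0` the energy bound is contradicted.
    regularize : ∀ {ℓ} → 0ℚ < ℓ → ∀ m P (h : length P ℕ.≤ T) → length P ℕ.+ m ℕ.* 2 ℕ.≤ T →
      energyCap < totalEnergy P h + ♯ m * (4ℚ * (ℓ * ℓ)) →
      Σ (List Cut) λ Q → Σ (length Q ℕ.≤ T) λ k → length Q ℕ.≤ length P ℕ.+ m ℕ.* 2 × Refines Q P × Regular ℓ Q k
    regularize {ℓ} 0<ℓ zero P h _ cap = contradiction (totalEnergy≤ P h) (λ e → <-irrefl refl (<-≤-trans cap
        (subst (_≤ energyCap) zero-steps e)))
      where
      zero-steps : totalEnergy P h ≡ totalEnergy P h + ♯ 0 * (4ℚ * (ℓ * ℓ))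
      zero-steps = sym (trans (cong (λ ζ → totalEnergy P h + ζ) (*-zeroˡ (4ℚ * (ℓ * ℓ)))) (+-identityʳ _))
    regularize {ℓ} 0<ℓ (suc m) P h room cap with regular-or-violated ℓ P h
    ... | inj₂ reg = P , h , ℕ.m≤m+n _ _ , (λ x y e → e) , reg
    ... | inj₁ (i , S , S′ , v) = continue (regularize 0<ℓ m Q k (drop-2 {m = m} room) cap′)
      where
      Q : List Cut
      Q = S ∷ S′ ∷ P
      k : length Q ℕ.≤ T
      k = ℕ.≤-trans (ℕ.m≤m+n _ _) (drop-2 {m = m} room)
      open Increment P S S′ h k i 0<ℓ v using (increment; Q-refines)
      γ : ℚ
      γ = 4ℚ * (ℓ * ℓ)
      one-more : totalEnergy P h + ♯ (suc m) * γ ≡ (totalEnergy P h + γ) + ♯ m * γ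
      one-more = trans (cong (λ z → totalEnergy P h + z * γ) (♯-suc m)) (rearrange (totalEnergy P h) (♯ m) γ)
        where
        rearrange : ∀ e m g → e + (1ℚ + m) * g ≡ (e + g) + m * g
        rearrange = solve-∀ ℚ-ring
      cap′ : energyCap < totalEnergy Q k + ♯ m * γ
      cap′ = <-≤-trans (subst (energyCap <_) one-more cap) (+-monoˡ-≤ (♯ m * γ) increment)
      continue : _ → _
      continue (R , kR , len , r , reg) = R , kR ,
        subst (length R ℕ.≤_) (sym (trans (ℕ.+-suc (length P) (suc (m ℕ.* 2))) (cong suc (ℕ.+-suc (length P)
            (m ℕ.* 2))))) len ,
        (λ x y e → Q-refines x y (r x y e)) , reg

    -- `t` is the budget of cuts at the start of a round rather than the actual length of `coarse`;
    -- the accuracy `ℓ t` then depends only on numbers fixed in advance.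
    record Levels (ℓ : ℕ → ℚ) (ε : ℚ) : Set where
      field
        coarse fine : List Cut
        t : ℕ
        t≤T : t ℕ.≤ T
        coarse≤t : length coarse ℕ.≤ t
        fine≤T : length fine ℕ.≤ T
        refines : Refines fine coarse
        regular : Regular (ℓ t) fine fine≤T
      coarse≤T : length coarse ℕ.≤ T
      coarse≤T = ℕ.≤-trans coarse≤t t≤T
      field
        close : totalEnergy fine fine≤T ≤ totalEnergy coarse coarse≤T + ε

    -- If regularising raises the energy by more than `ε`, the result becomes the next coarse
    -- partition. The last hypothesis says that `J` such rises would exceed the cap, so some round
    -- must succeed.
    levels : ∀ {ℓ} (ℓ>0 : ∀ t → 0ℚ < ℓ t) ε J t P (h : length P ℕ.≤ T) → length P ℕ.≤ t → tower ℓ>0 J t ℕ.≤ T →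
      energyCap < totalEnergy P h + ♯ J * ε → Levels ℓ ε
    levels ℓ>0 ε zero t P h _ _ cap = contradiction (totalEnergy≤ P h) (λ e → <-irrefl refl (<-≤-trans cap
        (subst (_≤ energyCap) zero-steps e)))
      where
      zero-steps : totalEnergy P h ≡ totalEnergy P h + ♯ 0 * ε
      zero-steps = sym (trans (cong (λ ζ → totalEnergy P h + ζ) (*-zeroˡ ε)) (+-identityʳ _))
    levels {ℓ} ℓ>0 ε (suc J) t P h P≤t room cap = choose (regularize (ℓ>0 t) m P h room-now cap-now)
      where
      m : ℕ
      m = microSteps (ℓ>0 t)
      t′≤T : t ℕ.+ m ℕ.* 2 ℕ.≤ T
      t′≤T = ℕ.≤-trans (tower-≥ ℓ>0 J _) room
      room-now : length P ℕ.+ m ℕ.* 2 ℕ.≤ T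
      room-now = ℕ.≤-trans (ℕ.+-monoˡ-≤ (m ℕ.* 2) P≤t) t′≤T
      cap-now : energyCap < totalEnergy P h + ♯ m * (4ℚ * (ℓ t * ℓ t))
      cap-now = <-≤-trans (proj₂ (archimedes energyCap (gain>0 (ℓ>0 t))))
        (subst (_≤ totalEnergy P h + ♯ m * (4ℚ * (ℓ t * ℓ t))) (+-identityˡ _) (+-monoˡ-≤ (♯ m * (4ℚ * (ℓ t * ℓ t)))
            (totalEnergy≥0 P h)))
      choose : _ → Levels ℓ ε
      choose (Q , k , len , r , reg) with totalEnergy Q k ≤? totalEnergy P h + ε
      ... | yes c = record { coarse = P ; fine = Q ; t = t ; t≤T = ℕ.≤-trans (ℕ.m≤m+n t _) t′≤T ; coarse≤t =
          P≤t ; fine≤T = k ; refines = r ; regular = reg ; close = c }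
      ... | no c = levels ℓ>0 ε J (t ℕ.+ m ℕ.* 2) Q k (ℕ.≤-trans len (ℕ.+-monoˡ-≤ (m ℕ.* 2) P≤t)) room
              (<-≤-trans (subst (energyCap <_) one-more cap) (+-monoˡ-≤ (♯ J * ε) (<⇒≤ (≰⇒> c))))
        where
        rearrange : ∀ e m g → e + (1ℚ + m) * g ≡ (e + g) + m * g
        rearrange = solve-∀ ℚ-ring
        one-more : totalEnergy P h + ♯ (suc J) * ε ≡ (totalEnergy P h + ε) + ♯ J * ε
        one-more = trans (cong (λ z → totalEnergy P h + z * ε) (♯-suc J)) (rearrange (totalEnergy P h) (♯ J) ε)

  -- Counting in the cut distance

  module CutDistance {V : Set} (ν : Measure V) (ν-1 : ∫ ν (λ _ → 1ℚ) ≡ 1ℚ) where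

    ∫-constant : ∀ c → ∫ ν (λ _ → c) ≡ c
    ∫-constant c = trans (∫-const c) (trans (cong (c *_) ν-1) (*-identityʳ c))

    ∫≤ : ∀ {f c} → (∀ x → f x ≤ c) → ∫ ν f ≤ c
    ∫≤ {f} {c} h = subst (∫ ν f ≤_) (∫-constant c) (∫-mono h)

    ∫≥ : ∀ {f c} → (∀ x → c ≤ f x) → c ≤ ∫ ν f
    ∫≥ {f} {c} h = subst (_≤ ∫ ν f) (∫-constant c) (∫-mono h)

    pairing : (V → ℚ) → (V → ℚ) → (V → V → ℚ) → ℚ
    pairing u w F = ∫ ν (λ x → ∫ ν (λ y → u x * (w y * F x y)))

    CutAtLeast : (V → V → ℚ) → ℚ → Set
    CutAtLeast F c = ∀ (S T : V → Bool) → - c ≤ pairing (λ x → 𝟙 (S x)) (λ y → 𝟙 (T y)) F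

    pairing-left : ∀ u w F → pairing u w F ≡ ∫ ν (λ x → u x * ∫ ν (λ y → w y * F x y))
    pairing-left u w F = ∫-cong (λ x → ∫-*ˡ (u x) _)

    pairing-right : ∀ u w F → pairing u w F ≡ ∫ ν (λ y → w y * ∫ ν (λ x → u x * F x y))
    pairing-right u w F = trans (∫-swap _) (∫-cong (λ y → trans (∫-cong (λ x → left-comm (u x) (w y) (F x y)))
        (∫-*ˡ (w y) _)))

    -- The minimum of a linear form over 0 ≤ u ≤ a is attained at a times an indicator.
    indicators-suffice : ∀ (G : V → ℚ) {c a} {u : V → ℚ} → (∀ (S : V → Bool) → - c ≤ ∫ ν (λ x → 𝟙 (S x) * G x)) →
        0ℚ ≤ a → (∀ x → 0ℚ ≤ u x) → (∀ x → u x ≤ a) →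
      - (a * c) ≤ ∫ ν (λ x → u x * G x)
    indicators-suffice G {c} {a} {u} h a≥0 u≥0 u≤a = begin
      - (a * c) ≡⟨ neg-distribʳ-* a c ⟩
      a * - c ≤⟨ *-monoˡ-≤ a≥0 (h (λ x → G x ≤ᵗ 0ℚ)) ⟩
      a * ∫ ν (λ x → 𝟙 (G x ≤ᵗ 0ℚ) * G x) ≡⟨ sym (∫-*ˡ a _) ⟩
      ∫ ν (λ x → a * (𝟙 (G x ≤ᵗ 0ℚ) * G x)) ≤⟨ ∫-mono pointwise ⟩
      ∫ ν (λ x → u x * G x) ∎
      where
      open ≤-Reasoning
      negative-case : ∀ a u g → u * g ≡ a * (1ℚ * g) + (a - u) * (0ℚ - g)
      negative-case = solve-∀ ℚ-ring
      positive-case : ∀ a u g → u * g ≡ a * (0ℚ * g) + u * g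
      positive-case = solve-∀ ℚ-ring
      pointwise : ∀ x → a * (𝟙 (G x ≤ᵗ 0ℚ) * G x) ≤ u x * G x
      pointwise x with G x ≤ᵗ 0ℚ | comparison (G x) 0ℚ
      ... | _ | below g≤0 = ≤-by _ (negative-case a (u x) (G x)) (0≤* (gap (u≤a x)) (gap g≤0))
      ... | _ | above g>0 = ≤-by _ (positive-case a (u x) (G x)) (0≤* (u≥0 x) (<⇒≤ g>0))

    bounded-tests : ∀ {F c} → CutAtLeast F c → ∀ {a b} {u w : V → ℚ} → 0ℚ ≤ a → 0ℚ ≤ b → (∀ x → 0ℚ ≤ u x) →
        (∀ x → u x ≤ a) → (∀ y → 0ℚ ≤ w y) → (∀ y → w y ≤ b) →
      - (b * (a * c)) ≤ pairing u w F
    bounded-tests {F} {c} h {a} {b} {u} {w} a≥0 b≥0 u≥0 u≤a w≥0 w≤b = subst (- (b * (a * c)) ≤_)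
        (sym (pairing-right u w F))
      (indicators-suffice (λ y → ∫ ν (λ x → u x * F x y)) (λ T → subst (- (a * c) ≤_)
          (trans (sym (pairing-left u (λ y → 𝟙 (T y)) F)) (pairing-right u (λ y → 𝟙 (T y)) F))
        (indicators-suffice (λ x → ∫ ν (λ y → 𝟙 (T y) * F x y)) (λ S → subst (- c ≤_) (pairing-left (λ x → 𝟙 (S x))
            (λ y → 𝟙 (T y)) F) (h S T)) a≥0 u≥0 u≤a)) b≥0 w≥0 w≤b)

    infixr 7 _∘ᵏ_

    _∘ᵏ_ : (V → V → ℚ) → (V → V → ℚ) → V → V → ℚ
    (f ∘ᵏ g) x z = ∫ ν (λ y → f x y * g y z)

    ∘ᵏ-≥0 : ∀ {f g} → (∀ x y → 0ℚ ≤ f x y) → (∀ x y → 0ℚ ≤ g x y) → ∀ x z → 0ℚ ≤ (f ∘ᵏ g) x z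
    ∘ᵏ-≥0 hf hg x z = ∫-≥0 (λ y → 0≤* (hf x y) (hg y z))

    ∘ᵏ-≤1 : ∀ {f g} → (∀ x y → 0ℚ ≤ f x y) → (∀ x y → 0ℚ ≤ g x y) → (∀ x y → f x y ≤ 1ℚ) → (∀ x y → g x y ≤ 1ℚ) →
        ∀ x z → (f ∘ᵏ g) x z ≤ 1ℚ
    ∘ᵏ-≤1 f≥0 g≥0 f≤1 g≤1 x z = ∫≤ (λ y → *-mono-≤ {q = 1ℚ} {s = 1ℚ} (f≥0 x y) (g≥0 y z) (f≤1 x y) (g≤1 y z))

    pairing-∘ᵏ : ∀ u w f g → pairing u w (f ∘ᵏ g) ≡ ∫ ν (λ y → ∫ ν (λ x → u x * f x y) * ∫ ν (λ z → w z * g y z))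
    pairing-∘ᵏ u w f g = sym (begin
      ∫ ν (λ y → ∫ ν (λ x → u x * f x y) * ∫ ν (λ z → w z * g y z)) ≡⟨ ∫-cong (λ y → ∫-*-∫ _ _) ⟩
      ∫ ν (λ y → ∫ ν (λ x → ∫ ν (λ z → (u x * f x y) * (w z * g y z)))) ≡⟨ ∫-swap _ ⟩
      ∫ ν (λ x → ∫ ν (λ y → ∫ ν (λ z → (u x * f x y) * (w z * g y z)))) ≡⟨ ∫-cong (λ x → ∫-swap _) ⟩
      ∫ ν (λ x → ∫ ν (λ z → ∫ ν (λ y → (u x * f x y) * (w z * g y z)))) ≡⟨ ∫∫-cong (λ x z → trans
          (∫-cong (λ y → regroup (u x) (f x y) (w z) (g y z)))
            (trans (∫-*ˡ (u x) _) (cong (u x *_) (∫-*ˡ (w z) _)))) ⟩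
      pairing u w (f ∘ᵏ g) ∎)
      where
      open ≡-Reasoning
      regroup : ∀ a b c d → (a * b) * (c * d) ≡ a * (c * (b * d))
      regroup = solve-∀ ℚ-ring

    pairing-- : ∀ u w F G → pairing u w (λ x y → F x y - G x y) ≡ pairing u w F - pairing u w G
    pairing-- u w F G = trans (∫∫-cong (λ x y → distribute (u x) (w y) (F x y) (G x y))) (∫∫-- _ _)
      where
      distribute : ∀ u w f g → u * (w * (f - g)) ≡ u * (w * f) - u * (w * g)
      distribute = solve-∀ ℚ-ring

    -- A product of degrees falls short by no more than its factors do: the model degrees are at
    -- most 1, so a shortfall is never magnified, and a surplus, which may be huge, can be discarded
    -- because the other factor is nonnegative.
    product-drop : ∀ {d d′ b b′} → 0ℚ ≤ d → 0ℚ ≤ d′ → 0ℚ ≤ b → b ≤ 1ℚ → b′ ≤ 1ℚ →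
      𝟙 (d ≤ᵗ b) * (d - b) + 𝟙 (d′ ≤ᵗ b′) * (d′ - b′) ≤ d * d′ - b * b′
    product-drop {d} {d′} {b} {b′} d≥0 d′≥0 b≥0 b≤1 b′≤1 with d ≤ᵗ b | comparison d b | d′ ≤ᵗ b′ | comparison d′ b′
    ... | _ | below p | _ | below p′ = ≤-by _ (identity d d′ b b′) (0≤+ (0≤+ (0≤* (gap p) (gap b′≤1)) (0≤* (gap p′)
        (gap b≤1))) (0≤* (gap p) (gap p′)))
      where
      identity : ∀ d d′ b b′ → d * d′ - b * b′ ≡ 1ℚ * (d - b) + 1ℚ * (d′ - b′) + ((b - d) * (1ℚ - b′) + (b′ - d′) *
          (1ℚ - b) + (b - d) * (b′ - d′))
      identity = solve-∀ ℚ-ring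
    ... | _ | below p | _ | above p′ = ≤-by _ (identity d d′ b b′) (0≤+ (0≤* d≥0 (gap (<⇒≤ p′)))
        (0≤* (gap p) (gap b′≤1)))
      where
      identity : ∀ d d′ b b′ → d * d′ - b * b′ ≡ 1ℚ * (d - b) + 0ℚ * (d′ - b′) + (d * (d′ - b′) + (b - d) * (1ℚ - b′))
      identity = solve-∀ ℚ-ring
    ... | _ | above p | _ | below p′ = ≤-by _ (identity d d′ b b′) (0≤+ (0≤* d′≥0 (gap (<⇒≤ p))) (0≤* (gap p′)
        (gap b≤1)))
      where
      identity : ∀ d d′ b b′ → d * d′ - b * b′ ≡ 0ℚ * (d - b) + 1ℚ * (d′ - b′) + (d′ * (d - b) + (b′ - d′) * (1ℚ - b))
      identity = solve-∀ ℚ-ring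
    ... | _ | above p | _ | above p′ = ≤-by _ (identity d d′ b b′) (0≤+ (0≤* d′≥0 (gap (<⇒≤ p)))
        (0≤* b≥0 (gap (<⇒≤ p′))))
      where
      identity : ∀ d d′ b b′ → d * d′ - b * b′ ≡ 0ℚ * (d - b) + 0ℚ * (d′ - b′) + (d′ * (d - b) + b * (d′ - b′))
      identity = solve-∀ ℚ-ring

    -- `p` is the weighted graph, possibly unbounded, and `q` a bounded substitute which `p` does
    -- not undercut by more than `c` on any rectangle.
    record Model (p q : V → V → ℚ) (c : ℚ) : Set where
      field
        p≥0 : ∀ x y → 0ℚ ≤ p x y
        q≥0 : ∀ x y → 0ℚ ≤ q x y
        q≤1 : ∀ x y → q x y ≤ 1ℚ
        cut : CutAtLeast (λ x y → p x y - q x y) c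

    open Model

    -- Degrees into a set S are, up to a small total loss, at least those of the model; unlike an
    -- upper bound this survives multiplication, although p is unbounded.
    compose : ∀ {p p′ q q′ c c′} → Model p q c → Model p′ q′ c′ → Model (p ∘ᵏ p′) (q ∘ᵏ q′) (c + c′)
    compose {p} {p′} {q} {q′} {c} {c′} M M′ = record
      { p≥0 = ∘ᵏ-≥0 (p≥0 M) (p≥0 M′)
      ; q≥0 = ∘ᵏ-≥0 (q≥0 M) (q≥0 M′)
      ; q≤1 = ∘ᵏ-≤1 (q≥0 M) (q≥0 M′) (q≤1 M) (q≤1 M′)
      ; cut = cut-∘ᵏ
      }
      where
      cut-∘ᵏ : CutAtLeast (λ x z → (p ∘ᵏ p′) x z - (q ∘ᵏ q′) x z) (c + c′)
      cut-∘ᵏ S T = begin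
        - (c + c′) ≡⟨ neg-distrib-+ c c′ ⟩
        - c + - c′ ≤⟨ +-mono-≤ (subst (- c ≤_) left (cut M S Z)) (subst (- c′ ≤_) right (cut M′ Z′ T)) ⟩
        ∫ ν (λ y → 𝟙 (Z y) * (d y - b y)) + ∫ ν (λ y → 𝟙 (Z′ y) * (d′ y - b′ y)) ≡⟨ sym (∫-+ _ _) ⟩
        ∫ ν (λ y → 𝟙 (Z y) * (d y - b y) + 𝟙 (Z′ y) * (d′ y - b′ y)) ≤⟨ ∫-mono (λ y → product-drop {d y} {d′ y}
            {b y} {b′ y} (d≥0 y) (d′≥0 y) (b≥0 y) (b≤1 y) (b′≤1 y)) ⟩
        ∫ ν (λ y → d y * d′ y - b y * b′ y) ≡⟨ ∫-- _ _ ⟩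
        ∫ ν (λ y → d y * d′ y) - ∫ ν (λ y → b y * b′ y) ≡⟨ sym (cong₂ _-_ (pairing-∘ᵏ s t p p′) (pairing-∘ᵏ s t q q′)) ⟩
        pairing s t (p ∘ᵏ p′) - pairing s t (q ∘ᵏ q′) ≡⟨ sym (pairing-- s t _ _) ⟩
        pairing s t (λ x z → (p ∘ᵏ p′) x z - (q ∘ᵏ q′) x z) ∎
        where
        open ≤-Reasoning
        s t d d′ b b′ : V → ℚ
        s x = 𝟙 (S x)
        t z = 𝟙 (T z)
        d y = ∫ ν (λ x → s x * p x y)
        d′ y = ∫ ν (λ z → t z * p′ y z)
        b y = ∫ ν (λ x → s x * q x y)
        b′ y = ∫ ν (λ z → t z * q′ y z)
        -- The middle vertices whose degree falls short of the model; testing the rectangle of `S`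
        -- and `Z` measures the entire shortfall at once.
        Z Z′ : V → Bool
        Z y = d y ≤ᵗ b y
        Z′ y = d′ y ≤ᵗ b′ y
        d≥0 : ∀ y → 0ℚ ≤ d y
        d≥0 y = ∫-≥0 (λ x → 0≤* (𝟙≥0 (S x)) (p≥0 M x y))
        d′≥0 : ∀ y → 0ℚ ≤ d′ y
        d′≥0 y = ∫-≥0 (λ z → 0≤* (𝟙≥0 (T z)) (p≥0 M′ y z))
        b≥0 : ∀ y → 0ℚ ≤ b y
        b≥0 y = ∫-≥0 (λ x → 0≤* (𝟙≥0 (S x)) (q≥0 M x y))
        b≤1 : ∀ y → b y ≤ 1ℚ
        b≤1 y = ∫≤ (λ x → *-mono-≤ {q = 1ℚ} {s = 1ℚ} (𝟙≥0 (S x)) (q≥0 M x y) (𝟙≤1 (S x)) (q≤1 M x y))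
        b′≤1 : ∀ y → b′ y ≤ 1ℚ
        b′≤1 y = ∫≤ (λ z → *-mono-≤ {q = 1ℚ} {s = 1ℚ} (𝟙≥0 (T z)) (q≥0 M′ y z) (𝟙≤1 (T z)) (q≤1 M′ y z))
        distribute : ∀ a b c → a * (b - c) ≡ a * b - a * c
        distribute = solve-∀ ℚ-ring
        left : pairing s (λ y → 𝟙 (Z y)) (λ x y → p x y - q x y) ≡ ∫ ν (λ y → 𝟙 (Z y) * (d y - b y))
        left = trans (pairing-right s (λ y → 𝟙 (Z y)) (λ x y → p x y - q x y)) (∫-cong (λ y → cong (𝟙 (Z y) *_)
            (trans (∫-cong (λ x → distribute (s x) (p x y) (q x y))) (∫-- _ _))))
        right : pairing (λ y → 𝟙 (Z′ y)) t (λ x y → p′ x y - q′ x y) ≡ ∫ ν (λ y → 𝟙 (Z′ y) * (d′ y - b′ y))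
        right = trans (pairing-left (λ y → 𝟙 (Z′ y)) t (λ x y → p′ x y - q′ x y)) (∫-cong (λ y → cong (𝟙 (Z′ y) *_)
            (trans (∫-cong (λ z → distribute (t z) (p′ y z) (q′ y z))) (∫-- _ _))))

    -- Beyond `K` the loss is less than `r`, and there `r` is at most `r * r` divided by `K`.
    truncation-loss : ∀ {r K} → 0ℚ ≤ r → 0ℚ < K → r - inv K * (r * r) ≤ r ⊓ K
    truncation-loss {r} {K} r≥0 0<K with ≤-total r K
    ... | inj₁ r≤K = subst (r - inv K * (r * r) ≤_) (sym (p≤q⇒p⊓q≡p r≤K)) (≤-by _ (identity r (inv K))
        (0≤* (inv≥0 0<K) (0≤sq r)))
      where
      identity : ∀ r k → r ≡ r - k * (r * r) + k * (r * r)
      identity = solve-∀ ℚ-ring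
    ... | inj₂ K≤r = subst (r - inv K * (r * r) ≤_) (sym (p≥q⇒p⊓q≡q K≤r)) (≤-by _ (identity r K (inv K) (*-inv 0<K))
        (0≤+ (<⇒≤ 0<K) (0≤* (inv≥0 0<K) (0≤* r≥0 (gap K≤r)))))
      where
      collect : ∀ r K k → r - k * (r * r) + (K + k * (r * (r - K))) ≡ K + r * (1ℚ - K * k)
      collect = solve-∀ ℚ-ring
      identity : ∀ r K k → K * k ≡ 1ℚ → K ≡ r - k * (r * r) + (K + k * (r * (r - K)))
      identity r K k e = sym (trans (collect r K k) (trans (cong (λ z → K + r * (1ℚ - z)) e) (vanish K r)))
        where
        vanish : ∀ K r → K + r * (1ℚ - 1ℚ) ≡ K
        vanish = solve-∀ ℚ-ring

    -- The truncation loss on a rectangle is at most the loss on the whole square, which the L²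
    -- bound makes smaller than `C` divided by `K`, or equal to it.
    truncate-model : ∀ {p q c C K} → Model p q c → ∫ ν (λ x → ∫ ν (λ y → p x y * p x y)) ≤ C → 0ℚ < K →
      Model (λ x y → p x y ⊓ K) q (c + inv K * C)
    truncate-model {p} {q} {c} {C} {K} M L² 0<K = record
      { p≥0 = λ x y → ⊓-glb (p≥0 M x y) (<⇒≤ 0<K)
      ; q≥0 = q≥0 M
      ; q≤1 = q≤1 M
      ; cut = λ S T → begin
          - (c + inv K * C) ≡⟨ neg-distrib-+ c (inv K * C) ⟩
          - c + - (inv K * C) ≤⟨ +-mono-≤ (cut M S T) (neg-antimono-≤ (*-monoˡ-≤ (inv≥0 0<K) L²)) ⟩
          pairing (λ x → 𝟙 (S x)) (λ y → 𝟙 (T y)) (λ x y → p x y - q x y) - inv K * ∫ ν (λ x →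
              ∫ ν (λ y → p x y * p x y))
            ≡⟨ cong (λ z → pairing (λ x → 𝟙 (S x)) (λ y → 𝟙 (T y)) (λ x y → p x y - q x y) - z)
                (sym (∫∫-*ˡ (inv K) _)) ⟩
          pairing (λ x → 𝟙 (S x)) (λ y → 𝟙 (T y)) (λ x y → p x y - q x y) - ∫ ν (λ x →
              ∫ ν (λ y → inv K * (p x y * p x y)))
            ≡⟨ sym (∫∫-- _ _) ⟩
          ∫ ν (λ x → ∫ ν (λ y → 𝟙 (S x) * (𝟙 (T y) * (p x y - q x y)) - inv K * (p x y * p x y)))
            ≤⟨ ∫∫-mono (λ x y → pointwise (S x) (T y) (p≥0 M x y)) ⟩
          pairing (λ x → 𝟙 (S x)) (λ y → 𝟙 (T y)) (λ x y → p x y ⊓ K - q x y) ∎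
      }
      where
      open ≤-Reasoning
      pointwise : ∀ s t {a b} → 0ℚ ≤ a → 𝟙 s * (𝟙 t * (a - b)) - inv K * (a * a) ≤ 𝟙 s * (𝟙 t * (a ⊓ K - b))
      pointwise s t {a} {b} a≥0 = ≤-by _ (identity (𝟙 s * 𝟙 t) (𝟙 s) (𝟙 t) a b (a ⊓ K) (inv K * (a * a)) refl)
        (0≤+ (0≤* (0≤* (𝟙≥0 s) (𝟙≥0 t)) (gap (truncation-loss a≥0 0<K)))
          (0≤* (gap (*-mono-≤ {q = 1ℚ} {s = 1ℚ} (𝟙≥0 s) (𝟙≥0 t) (𝟙≤1 s) (𝟙≤1 t))) (0≤* (inv≥0 0<K) (0≤sq a))))
        where
        expand : ∀ s t a b m l → s * (t * (m - b)) ≡ s * (t * (a - b)) - l + ((s * t) * (m - (a - l)) + (1ℚ - s * t)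
            * l)
        expand = solve-∀ ℚ-ring
        identity : ∀ st s t a b m l → st ≡ s * t → s * (t * (m - b)) ≡ s * (t * (a - b)) - l + (st * (m - (a - l)) +
            (1ℚ - st) * l)
        identity _ s t a b m l refl = expand s t a b m l

    -- For fixed `x` the other two factors form a pair of test functions for `B`, so a cut estimate
    -- for `B` applies fibre by fibre; `triangles-rotate` brings each factor into that position.
    triangles : (A B D : V → V → ℚ) → ℚ
    triangles A B D = ∫ ν (λ x → pairing (A x) (λ w → D w x) B)

    triangles-rotate : ∀ A B D → triangles A B D ≡ triangles B D A
    triangles-rotate A B D = trans (∫-swap _) (∫-cong (λ z → trans (∫-swap _) (∫∫-cong (λ w x → regroup (A x z)
        (D w x) (B z w)))))
      where
      regroup : ∀ a d b → a * (d * b) ≡ b * (a * d)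
      regroup = solve-∀ ℚ-ring

    triangles-mono : ∀ {A B D A′ B′ : V → V → ℚ} → (∀ x y → 0ℚ ≤ A x y) → (∀ x y → 0ℚ ≤ B x y) → (∀ x y → 0ℚ ≤ D x y) →
      (∀ x y → A x y ≤ A′ x y) → (∀ x y → B x y ≤ B′ x y) → triangles A B D ≤ triangles A′ B′ D
    triangles-mono A≥0 B≥0 D≥0 hA hB = ∫-mono (λ x → ∫∫-mono (λ z w →
      *-mono-≤ (A≥0 x z) (0≤* (D≥0 w x) (B≥0 z w)) (hA x z) (*-monoˡ-≤ (D≥0 w x) (hB z w))))

    triangles-replace : ∀ {A B B′ D : V → V → ℚ} {c a d} → CutAtLeast (λ x y → B x y - B′ x y) c →
      0ℚ ≤ a → 0ℚ ≤ d → (∀ x y → 0ℚ ≤ A x y) → (∀ x y → A x y ≤ a) → (∀ x y → 0ℚ ≤ D x y) → (∀ x y → D x y ≤ d) →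
      triangles A B′ D - d * (a * c) ≤ triangles A B D
    triangles-replace {A} {B} {B′} {D} {c} {a} {d} h a≥0 d≥0 A≥0 A≤a D≥0 D≤d = subst (triangles A B′ D - d * (a * c)
        ≤_) (cancel (triangles A B′ D) (triangles A B D))
      (+-monoʳ-≤ (triangles A B′ D) (subst (- (d * (a * c)) ≤_) difference
        (∫≥ (λ x → bounded-tests {F = λ z w → B z w - B′ z w} h a≥0 d≥0 (A≥0 x) (A≤a x) (λ w → D≥0 w x) (λ w →
            D≤d w x)))))
      where
      difference : ∫ ν (λ x → pairing (A x) (λ w → D w x) (λ z w → B z w - B′ z w)) ≡ triangles A B D - triangles A B′ D
      difference = trans (∫-cong (λ x → pairing-- (A x) (λ w → D w x) B B′)) (∫-- _ _)
      cancel : ∀ s t → s + (t - s) ≡ t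
      cancel = solve-∀ ℚ-ring

    -- At each exchange the two remaining factors must be bounded. First `σ` becomes the truncated
    -- `ρ`, tested by functions bounded by 1; then `σ′` becomes the truncated `ρ′`, tested with
    -- bounds `K` and 1; only then `q` becomes `p`, tested with bounds `K` and `K′`. The second
    -- error contains `K`, so `K′` has to be chosen after `K`.
    triangle-counting : ∀ {ρ σ ρ′ σ′ p q c c′ c₅ C K K′} → Model ρ σ c → Model ρ′ σ′ c′ → Model p q c₅ →
      ∫ ν (λ x → ∫ ν (λ y → ρ x y * ρ x y)) ≤ C → ∫ ν (λ x → ∫ ν (λ y → ρ′ x y * ρ′ x y)) ≤ C → 0ℚ < K → 0ℚ < K′ →
      triangles σ σ′ q - (1ℚ * (1ℚ * (c + inv K * C)) + 1ℚ * (K * (c′ + inv K′ * C)) + K * (K′ * c₅)) ≤ triangles ρ ρ′ p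
    triangle-counting {ρ} {σ} {ρ′} {σ′} {p} {q} {c} {c′} {c₅} {C} {K} {K′} M M′ M₅ L² L²′ 0<K 0<K′ = begin
      triangles σ σ′ q - (e₁ + e₂ + e₃) ≡⟨ peel (triangles σ σ′ q) e₁ e₂ e₃ ⟩
      triangles σ σ′ q - e₁ - e₂ - e₃ ≤⟨ +-monoˡ-≤ (- e₃) (+-monoˡ-≤ (- e₂) step₁) ⟩
      triangles H σ′ q - e₂ - e₃ ≤⟨ +-monoˡ-≤ (- e₃) step₂ ⟩
      triangles H H′ q - e₃ ≤⟨ step₃ ⟩
      triangles H H′ p ≤⟨ triangles-mono (p≥0 tM) (p≥0 tM′) (p≥0 M₅) (λ x y → p⊓q≤p (ρ x y) K) (λ x y →
          p⊓q≤p (ρ′ x y) K′) ⟩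
      triangles ρ ρ′ p ∎
      where
      open ≤-Reasoning
      e₁ e₂ e₃ : ℚ
      e₁ = 1ℚ * (1ℚ * (c + inv K * C))
      e₂ = 1ℚ * (K * (c′ + inv K′ * C))
      e₃ = K * (K′ * c₅)
      peel : ∀ t x y z → t - (x + y + z) ≡ t - x - y - z
      peel = solve-∀ ℚ-ring
      H H′ : V → V → ℚ
      H x y = ρ x y ⊓ K
      H′ x y = ρ′ x y ⊓ K′
      tM : Model H σ (c + inv K * C)
      tM = truncate-model M L² 0<K
      tM′ : Model H′ σ′ (c′ + inv K′ * C)
      tM′ = truncate-model M′ L²′ 0<K′
      H≤ : ∀ x y → H x y ≤ K
      H≤ x y = p⊓q≤q (ρ x y) K
      H′≤ : ∀ x y → H′ x y ≤ K′
      H′≤ x y = p⊓q≤q (ρ′ x y) K′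
      step₁ : triangles σ σ′ q - e₁ ≤ triangles H σ′ q
      step₁ = subst₂ _≤_ (cong (_- e₁) (triangles-rotate q σ σ′)) (triangles-rotate q H σ′)
        (triangles-replace (cut tM) 0≤1 0≤1 (q≥0 M₅) (q≤1 M₅) (q≥0 M′) (q≤1 M′))
      step₂ : triangles H σ′ q - e₂ ≤ triangles H H′ q
      step₂ = triangles-replace (cut tM′) (<⇒≤ 0<K) 0≤1 (p≥0 tM) H≤ (q≥0 M₅) (q≤1 M₅)
      step₃ : triangles H H′ q - e₃ ≤ triangles H H′ p
      step₃ = subst₂ _≤_ (cong (_- e₃) (sym (triangles-rotate H H′ q))) (sym (triangles-rotate H H′ p))
        (triangles-replace (cut M₅) (<⇒≤ 0<K′) (<⇒≤ 0<K) (p≥0 tM′) H′≤ (p≥0 tM) H≤)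

  -- Five-cycles in nearly complete cells

  -- Five edges, each missing in at most a tenth of its cell, still leave half of the cycles.
  10ℚ : ℚ
  10ℚ = 2ℚ * (4ℚ + 1ℚ)

  module NearlyComplete {V : Set} (ν : Measure V) (ν-1 : ∫ ν (λ _ → 1ℚ) ≡ 1ℚ) where

    open CutDistance ν ν-1

    InUnit : (V → ℚ) → Set
    InUnit s = ∀ x → (0ℚ ≤ s x) × (s x ≤ 1ℚ)

    ∫-affine : ∀ (s : V → ℚ) c (f : V → ℚ) → ∫ ν (λ x → s x * (c - f x)) ≡ ∫ ν s * c - ∫ ν (λ x → s x * f x)
    ∫-affine s c f = trans (∫-cong (λ x → distribute (s x) c (f x))) (trans (∫-- _ _)
        (cong (_- ∫ ν (λ x → s x * f x)) (∫-*ʳ c s)))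
      where
      distribute : ∀ s c f → s * (c - f) ≡ s * c - s * f
      distribute = solve-∀ ℚ-ring

    module _ {s₁ s₂ s₃ s₄ s₅ : V → ℚ} (u₁ : InUnit s₁) (u₂ : InUnit s₂) (u₃ : InUnit s₃) (u₄ : InUnit s₄) (u₅ : InUnit s₅)
      {b₁ b₂ b₃ b₄ b₅ : V → V → ℚ} (c₁ : ∀ x → InUnit (b₁ x)) (c₂ : ∀ x → InUnit (b₂ x)) (c₃ : ∀ x → InUnit (b₃ x))
          (c₄ : ∀ x → InUnit (b₄ x)) (c₅ : ∀ x → InUnit (b₅ x))
      where

      private
        co : (V → V → ℚ) → V → V → ℚ
        co b x y = 1ℚ - b x y

        r₁ r₂ r₃ r₄ r₅ : ℚ
        r₁ = ∫ ν s₁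
        r₂ = ∫ ν s₂
        r₃ = ∫ ν s₃
        r₄ = ∫ ν s₄
        r₅ = ∫ ν s₅

        total≥0 : ∀ {s} → InUnit s → 0ℚ ≤ ∫ ν s
        total≥0 u = ∫-≥0 (λ x → proj₁ (u x))

        product-≥ : ∀ {p q} → p ≤ 1ℚ → q ≤ 1ℚ → 1ℚ - ((1ℚ - p) + (1ℚ - q)) ≤ p * q
        product-≥ {p} {q} hp hq = ≤-by _ (identity p q) (0≤* (gap hp) (gap hq))
          where
          identity : ∀ p q → p * q ≡ 1ℚ - ((1ℚ - p) + (1ℚ - q)) + (1ℚ - p) * (1ℚ - q)
          identity = solve-∀ ℚ-ring

        module Path {s : V → ℚ} (u : InUnit s) {b b′ : V → V → ℚ} (c : ∀ x → InUnit (b x)) (c′ : ∀ x → InUnit (b′ x)) where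
          inside : V → V → ℚ
          inside x z = ∫ ν (λ y → s y * (b x y * b′ y z))

          out in′ : V → ℚ
          out x = ∫ ν (λ y → s y * co b x y)
          in′ z = ∫ ν (λ y → s y * co b′ y z)

          bb≥0 : ∀ x y z → 0ℚ ≤ b x y * b′ y z
          bb≥0 x y z = 0≤* (proj₁ (c x y)) (proj₁ (c′ y z))

          bb≤1 : ∀ x y z → b x y * b′ y z ≤ 1ℚ
          bb≤1 x y z = *-mono-≤ {q = 1ℚ} {s = 1ℚ} (proj₁ (c x y)) (proj₁ (c′ y z)) (proj₂ (c x y)) (proj₂ (c′ y z))

          inside≥0 : ∀ x z → 0ℚ ≤ inside x z
          inside≥0 x z = ∫-≥0 (λ y → 0≤* (proj₁ (u y)) (bb≥0 x y z))

          inside≤ : ∀ x z → inside x z ≤ ∫ ν s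
          inside≤ x z = ∫-mono (λ y → subst (s y * (b x y * b′ y z) ≤_) (*-identityʳ (s y)) (*-monoˡ-≤ (proj₁ (u y))
              (bb≤1 x y z)))

          inside≤∘ᵏ : ∀ x z → inside x z ≤ (b ∘ᵏ b′) x z
          inside≤∘ᵏ x z = ∫-mono (λ y → subst (s y * (b x y * b′ y z) ≤_) (*-identityˡ (b x y * b′ y z))
              (*-monoʳ-≤ (bb≥0 x y z) (proj₂ (u y))))

          inside≥ : ∀ x z → ∫ ν s - (out x + in′ z) ≤ inside x z
          inside≥ x z = subst (_≤ inside x z) (trans (∫-affine s 1ℚ (λ y → co b x y + co b′ y z))
              (cong₂ _-_ (*-identityʳ (∫ ν s)) (trans (∫-cong (λ y → *-distribˡ-+ (s y) (co b x y) (co b′ y z)))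
                  (∫-+ _ _))))
            (∫-mono (λ y → *-monoˡ-≤ (proj₁ (u y)) (product-≥ (proj₂ (c x y)) (proj₂ (c′ y z)))))

          out≥0 : ∀ x → 0ℚ ≤ out x
          out≥0 x = ∫-≥0 (λ y → 0≤* (proj₁ (u y)) (gap (proj₂ (c x y))))

          in≥0 : ∀ z → 0ℚ ≤ in′ z
          in≥0 z = ∫-≥0 (λ y → 0≤* (proj₁ (u y)) (gap (proj₂ (c′ y z))))

        open Path u₂ c₁ c₂ using () renaming (inside to a; out to n₁; in′ to n₂; inside≥0 to a≥0; inside≤ to a≤; inside≤∘ᵏ to a≤∘; inside≥ to a≥)
        open Path u₄ c₃ c₄ using () renaming (inside to a′; out to n₃; in′ to n₄; inside≥0 to a′≥0; inside≤ to a′≤; inside≤∘ᵏ to a′≤∘; inside≥ to a′≥; out≥0 to n₃≥0; in≥0 to n₄≥0)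

        -- A union bound over the five edges, linear in their defects. The terms are grouped by the
        -- variable `x`, `z` or `w` that they involve, so that `∫-affine` can integrate out `w`, `z`
        -- and `x` in turn.
        g : V → V → V → ℚ
        g x z w = r₂ * r₄ - r₄ * n₁ x - (r₄ * n₂ z + r₂ * n₃ z) - (r₂ * n₄ w + r₂ * r₄ * co b₅ w x)

        weighted-drop : ∀ {s t u} → 0ℚ ≤ s → s ≤ 1ℚ → 0ℚ ≤ u → t ≤ u → s * t ≤ u
        weighted-drop {s} {t} {u} s≥0 s≤1 u≥0 t≤u = ≤-trans (*-monoˡ-≤ s≥0 t≤u) (subst (s * u ≤_) (*-identityˡ u)
            (*-monoʳ-≤ u≥0 s≤1))

        product-bound : ∀ {a a′ d r r′ n m} → 0ℚ ≤ a → 0ℚ ≤ a′ → a ≤ r → a′ ≤ r′ → r - n ≤ a → r′ - m ≤ a′ → 0ℚ ≤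
            m → d ≤ 1ℚ →
          r * r′ - r′ * n - r * m - r * r′ * (1ℚ - d) ≤ a * (d * a′)
        product-bound {a} {a′} {d} {r} {r′} {n} {m} h₁ h₂ h₃ h₄ h₅ h₆ h₇ h₈ = ≤-by _ (identity a a′ d r r′ n m)
          (0≤+ (0≤+ (0≤+ (0≤* (gap h₅) (≤-trans h₂ h₄)) (0≤* h₁ (gap h₆))) (0≤* (gap h₃) h₇))
              (0≤* (gap (*-mono-≤ h₁ h₂ h₃ h₄)) (gap h₈)))
          where
          identity : ∀ a a′ d r r′ n m → a * (d * a′) ≡ r * r′ - r′ * n - r * m - r * r′ * (1ℚ - d)
            + ((a - (r - n)) * r′ + a * (a′ - (r′ - m)) + (r - a) * m + (r * r′ - a * a′) * (1ℚ - d))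
          identity = solve-∀ ℚ-ring

        pointwise : ∀ x z w → s₁ x * (s₃ z * (s₅ w * g x z w)) ≤ (b₁ ∘ᵏ b₂) x z * (b₅ w x * (b₃ ∘ᵏ b₄) z w)
        pointwise x z w = weighted-drop (proj₁ (u₁ x)) (proj₂ (u₁ x)) big≥0 (weighted-drop (proj₁ (u₃ z))
            (proj₂ (u₃ z)) big≥0
            (weighted-drop (proj₁ (u₅ w)) (proj₂ (u₅ w)) big≥0 (≤-trans (subst (_≤ a x z * (b₅ w x * a′ z w))
                (collect r₂ r₄ (n₁ x) (n₂ z) (n₃ z) (n₄ w) (co b₅ w x))
              (product-bound (a≥0 x z) (a′≥0 z w) (a≤ x z) (a′≤ z w) (a≥ x z) (a′≥ z w) (0≤+ (n₃≥0 z) (n₄≥0 w))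
                  (proj₂ (c₅ w x)))) small≤big)))
          where
          small≤big : a x z * (b₅ w x * a′ z w) ≤ (b₁ ∘ᵏ b₂) x z * (b₅ w x * (b₃ ∘ᵏ b₄) z w)
          small≤big = *-mono-≤ (a≥0 x z) (0≤* (proj₁ (c₅ w x)) (a′≥0 z w)) (a≤∘ x z) (*-monoˡ-≤ (proj₁ (c₅ w x))
              (a′≤∘ z w))
          big≥0 : 0ℚ ≤ (b₁ ∘ᵏ b₂) x z * (b₅ w x * (b₃ ∘ᵏ b₄) z w)
          big≥0 = ≤-trans (0≤* (a≥0 x z) (0≤* (proj₁ (c₅ w x)) (a′≥0 z w))) small≤big
          collect : ∀ r r′ n₁ n₂ n₃ n₄ e → r * r′ - r′ * (n₁ + n₂) - r * (n₃ + n₄) - r * r′ * e ≡ r * r′ - r′ * n₁ -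
              (r′ * n₂ + r * n₃) - (r * n₄ + r * r′ * e)
          collect = solve-∀ ℚ-ring

        N₁ N₂ N₃ N₄ N₅ : ℚ
        N₁ = pairing s₁ s₂ (co b₁)
        N₂ = pairing s₂ s₃ (co b₂)
        N₃ = pairing s₃ s₄ (co b₃)
        N₄ = pairing s₄ s₅ (co b₄)
        N₅ = pairing s₅ s₁ (co b₅)

        ∫-2 : ∀ (s f h : V → ℚ) c d → ∫ ν (λ x → s x * (c * f x + d * h x)) ≡ c * ∫ ν (λ x → s x * f x) + d * ∫ ν
            (λ x → s x * h x)
        ∫-2 s f h c d = trans (∫-cong (λ x → distribute (s x) c (f x) d (h x))) (trans (∫-+ _ _)
            (cong₂ _+_ (∫-*ˡ c _) (∫-*ˡ d _)))
          where
          distribute : ∀ s c f d h → s * (c * f + d * h) ≡ c * (s * f) + d * (s * h)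
          distribute = solve-∀ ℚ-ring

        k : V → ℚ
        k x = ∫ ν (λ w → s₅ w * co b₅ w x)

        over-w : ∀ x z → ∫ ν (λ w → s₅ w * g x z w) ≡ (r₅ * (r₂ * r₄ - r₄ * n₁ x) - (r₂ * N₄ + r₂ * r₄ * k x)) - r₅
            * (r₄ * n₂ z + r₂ * n₃ z)
        over-w x z = trans (∫-affine s₅ _ _)
            (trans (cong (λ e → r₅ * (r₂ * r₄ - r₄ * n₁ x - (r₄ * n₂ z + r₂ * n₃ z)) - e)
            (trans (∫-2 s₅ n₄ (λ w → co b₅ w x) r₂ (r₂ * r₄)) (cong (λ e → r₂ * e + r₂ * r₄ * k x)
                (sym (pairing-right s₄ s₅ (co b₄))))))
            (rearrange r₅ (r₂ * r₄ - r₄ * n₁ x) (r₄ * n₂ z + r₂ * n₃ z) (r₂ * N₄ + r₂ * r₄ * k x)))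
          where
          rearrange : ∀ r c d e → r * (c - d) - e ≡ (r * c - e) - r * d
          rearrange = solve-∀ ℚ-ring

        over-z : ∀ x → ∫ ν (λ z → s₃ z * ∫ ν (λ w → s₅ w * g x z w)) ≡
          (r₃ * (r₅ * (r₂ * r₄) - r₂ * N₄) - r₅ * (r₄ * N₂ + r₂ * N₃)) - (r₃ * r₅ * r₄ * n₁ x + r₃ * r₂ * r₄ * k x)
        over-z x = trans (∫-cong (λ z → cong (s₃ z *_) (over-w x z))) (trans (∫-affine s₃ _ _)
            (trans (cong (λ e → r₃ * (r₅ * (r₂ * r₄ - r₄ * n₁ x) - (r₂ * N₄ + r₂ * r₄ * k x)) - e)
              (trans (∫-cong (λ z → pull (s₃ z) r₅ r₄ (n₂ z) r₂ (n₃ z))) (trans (∫-2 s₃ n₂ n₃ (r₅ * r₄) (r₅ * r₂))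
                (cong₂ (λ e e′ → r₅ * r₄ * e + r₅ * r₂ * e′) (sym (pairing-right s₂ s₃ (co b₂)))
                    (sym (pairing-left s₃ s₄ (co b₃)))))))
              (rearrange r₂ r₃ r₄ r₅ (n₁ x) (k x) N₂ N₃ N₄)))
          where
          pull : ∀ s r r₄ n r₂ m → s * (r * (r₄ * n + r₂ * m)) ≡ s * (r * r₄ * n + r * r₂ * m)
          pull = solve-∀ ℚ-ring
          rearrange : ∀ r₂ r₃ r₄ r₅ n k N₂ N₃ N₄ → r₃ * (r₅ * (r₂ * r₄ - r₄ * n) - (r₂ * N₄ + r₂ * r₄ * k)) -
              (r₅ * r₄ * N₂ + r₅ * r₂ * N₃)
            ≡ (r₃ * (r₅ * (r₂ * r₄) - r₂ * N₄) - r₅ * (r₄ * N₂ + r₂ * N₃)) - (r₃ * r₅ * r₄ * n + r₃ * r₂ * r₄ * k)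
          rearrange = solve-∀ ℚ-ring

        over-x : ∫ ν (λ x → s₁ x * ∫ ν (λ z → s₃ z * ∫ ν (λ w → s₅ w * g x z w))) ≡
          r₁ * (r₃ * (r₅ * (r₂ * r₄) - r₂ * N₄) - r₅ * (r₄ * N₂ + r₂ * N₃)) - (r₃ * r₅ * r₄ * N₁ + r₃ * r₂ * r₄ * N₅)
        over-x = trans (∫-cong (λ x → cong (s₁ x *_) (over-z x))) (trans (∫-affine s₁ _ _)
            (cong (λ e → r₁ * (r₃ * (r₅ * (r₂ * r₄) - r₂ * N₄) - r₅ * (r₄ * N₂ + r₂ * N₃)) - e)
              (trans (∫-2 s₁ n₁ k (r₃ * r₅ * r₄) (r₃ * r₂ * r₄))
                (cong₂ (λ e e′ → r₃ * r₅ * r₄ * e + r₃ * r₂ * r₄ * e′) (sym (pairing-left s₁ s₂ (co b₁)))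
                    (sym (pairing-right s₅ s₁ (co b₅)))))))

      -- Integrating `g` gives the product of the five masses minus one term per edge, and each
      -- hypothesis bounds such a term by a tenth of that product.
      five-cycles : 10ℚ * N₁ ≤ r₁ * r₂ → 10ℚ * N₂ ≤ r₂ * r₃ → 10ℚ * N₃ ≤ r₃ * r₄ → 10ℚ * N₄ ≤ r₄ * r₅ → 10ℚ * N₅ ≤
          r₅ * r₁ →
        ½ * (r₁ * r₂ * r₃ * r₄ * r₅) ≤ triangles (b₁ ∘ᵏ b₂) (b₃ ∘ᵏ b₄) b₅
      five-cycles h₁ h₂ h₃ h₄ h₅ = begin
        ½ * (r₁ * r₂ * r₃ * r₄ * r₅) ≤⟨ ≤-by _ (identity r₁ r₂ r₃ r₄ r₅ N₁ N₂ N₃ N₄ N₅)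
            (0≤* {p = + 1 / 10} (nonNegative⁻¹ (+ 1 / 10))
                (0≤+ (0≤+ (0≤+ (0≤+ (term u₃ u₄ u₅ h₁) (term u₁ u₄ u₅ h₂)) (term u₁ u₂ u₅ h₃)) (term u₁ u₂ u₃ h₄))
                (term u₂ u₃ u₄ h₅))) ⟩
        r₁ * (r₃ * (r₅ * (r₂ * r₄) - r₂ * N₄) - r₅ * (r₄ * N₂ + r₂ * N₃)) - (r₃ * r₅ * r₄ * N₁ + r₃ * r₂ * r₄ * N₅)
            ≡⟨ sym over-x ⟩
        ∫ ν (λ x → s₁ x * ∫ ν (λ z → s₃ z * ∫ ν (λ w → s₅ w * g x z w)))
          ≡⟨ ∫-cong (λ x → trans (sym (∫-*ˡ (s₁ x) _)) (∫-cong (λ z → trans (cong (s₁ x *_) (sym (∫-*ˡ (s₃ z) _)))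
              (sym (∫-*ˡ (s₁ x) _))))) ⟩
        ∫ ν (λ x → ∫ ν (λ z → ∫ ν (λ w → s₁ x * (s₃ z * (s₅ w * g x z w))))) ≤⟨ ∫-mono (λ x → ∫∫-mono (pointwise x)) ⟩
        triangles (b₁ ∘ᵏ b₂) (b₃ ∘ᵏ b₄) b₅ ∎
        where
        open ≤-Reasoning
        term : ∀ {s t u N r} → InUnit s → InUnit t → InUnit u → N ≤ r → 0ℚ ≤ ∫ ν s * ∫ ν t * ∫ ν u * (r - N)
        term p q r h = 0≤* (0≤* (0≤* (total≥0 p) (total≥0 q)) (total≥0 r)) (gap h)
        identity : ∀ r₁ r₂ r₃ r₄ r₅ N₁ N₂ N₃ N₄ N₅ →
          r₁ * (r₃ * (r₅ * (r₂ * r₄) - r₂ * N₄) - r₅ * (r₄ * N₂ + r₂ * N₃)) - (r₃ * r₅ * r₄ * N₁ + r₃ * r₂ * r₄ * N₅) ≡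
          ½ * (r₁ * r₂ * r₃ * r₄ * r₅) + (+ 1 / 10) * (r₃ * r₄ * r₅ * (r₁ * r₂ - 10ℚ * N₁) + r₁ * r₄ * r₅ *
              (r₂ * r₃ - 10ℚ * N₂)
            + r₁ * r₂ * r₅ * (r₃ * r₄ - 10ℚ * N₃) + r₁ * r₂ * r₃ * (r₄ * r₅ - 10ℚ * N₄) + r₂ * r₃ * r₄ *
                (r₅ * r₁ - 10ℚ * N₅))
        identity = solve-∀ ℚ-ring

  -- Bad edges

  -- 40 is the 10 of `many` times 4, for two classes whose weights are at most twice their real
  -- masses. A further 4 comes from the deviation `½ * κ` squared.
  40ℚ 160ℚ : ℚ
  40ℚ = 4ℚ * 10ℚ
  160ℚ = 4ℚ * 40ℚ

  -- In units of κ², 9 collects two terms for small classes and one for deviation. In units of κ, 15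
  -- collects the energy term 2, the excess term 9 and the low cells 4.
  9ℚ 15ℚ : ℚ
  9ℚ = 4ℚ + 4ℚ + 1ℚ
  15ℚ = 2ℚ + 9ℚ + 4ℚ

  pow₅ : ℚ → ℚ
  pow₅ a = a * a * a * a * a

  module Clean {N : ℕ} (ν : Measure (Fin N)) (ν-1 : ∫ ν (λ _ → 1ℚ) ≡ 1ℚ) (T : ℕ) (κ : ℚ) (0<κ : 0ℚ < κ) (κ≤1 : κ ≤ 1ℚ)
    (0<τ : 0ℚ < κ * κ) (τ≤1 : κ * κ ≤ 1ℚ)
    (p : Fin 5 → Fin N → Fin N → ℚ)
    (bounded : ∀ P h i → Partition.energy (Cuts.partition ν ν-1 T (κ * κ) 0<τ τ≤1 P h) (Cuts.lift ν ν-1 T (κ * κ)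
        0<τ τ≤1 (p i)) ≤ 2ℚ)
    (p≥0 : ∀ i u v → 0ℚ ≤ p i u v)
    where

    open Iteration ν ν-1 T (κ * κ) 0<τ τ≤1 p bounded p≥0 public
    open Partition using (E; E₂; weight; weight>0; K; K≥0; E₂-adjoint; E-adjoint; E₂≥0; E₂-invariant; Invariant₂)
    open CutDistance ν ν-1
    open NearlyComplete ν ν-1

    module OfLevels {ℓ : ℕ → ℚ} {ε : ℚ} (L : Levels ℓ ε) (160ε : 160ℚ * ε ≡ κ * κ * (κ * κ)) where

      open Levels L

      P Q : List Cut
      P = coarse
      Q = fine

      Π : Partition μ
      Π = partition P coarse≤T

      f g : Fin 5 → A → A → ℚ
      f = density P coarse≤T
      g = density Q fine≤T

      f≥0 : ∀ i x y → 0ℚ ≤ f i x y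
      f≥0 = density≥0 P coarse≤T

      norm : Fin 5 → ℚ
      norm i = ∫ μ (λ x → ∫ μ (λ y → (g i x y - f i x y) * (g i x y - f i x y)))

      norm≥0 : ∀ i → 0ℚ ≤ norm i
      norm≥0 i = ∫∫-≥0 (λ x y → 0≤sq (g i x y - f i x y))

      -- By Pythagoras the five norms add up to the gain in total energy from coarse to fine, and
      -- none of them is negative.
      norm≤ε : ∀ i → norm i ≤ ε
      norm≤ε i = begin
        norm i ≡⟨ sym (∫-δ i norm) ⟩
        ∫ indices (λ j → 𝟙 (does (i ≟ᶠ j)) * norm j) ≤⟨ ∫-mono drop ⟩
        ∫ indices norm ≤⟨ cancel {totalEnergy P coarse≤T} (subst (_≤ totalEnergy P coarse≤T + ε)
            (trans (∫-cong (λ j → energy-pythagoras P Q coarse≤T fine≤T refines j)) (∫-+ _ _)) close) ⟩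
        ε ∎
        where
        open ≤-Reasoning
        drop : ∀ j → 𝟙 (does (i ≟ᶠ j)) * norm j ≤ norm j
        drop j = subst (𝟙 (does (i ≟ᶠ j)) * norm j ≤_) (*-identityˡ (norm j)) (*-monoʳ-≤ (norm≥0 j)
            (𝟙≤1 (does (i ≟ᶠ j))))
        cancel : ∀ {a b c} → a + b ≤ a + c → b ≤ c
        cancel {a} {b} {c} h = subst₂ _≤_ (identity a b) (identity a c) (+-monoʳ-≤ (- a) h)
          where
          identity : ∀ a b → - a + (a + b) ≡ b
          identity = solve-∀ ℚ-ring

      small : A → Bool
      small x = realMass P x ≤ᵗ fakeMass P

      low : Fin 5 → A → A → Bool
      low i x y = f i x y ≤ᵗ κ

      deviant : Fin 5 → V → V → Bool
      deviant i u v = g i (inj₁ u) (inj₁ v) ≤ᵗ ½ * κ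

      dev : Fin 5 → V → V → ℚ
      dev i u v = 𝟙 (not (low i (inj₁ u) (inj₁ v))) * 𝟙 (deviant i u v)

      dev≥0 : ∀ i u v → 0ℚ ≤ dev i u v
      dev≥0 i u v = 0≤* (𝟙≥0 (not (low i (inj₁ u) (inj₁ v)))) (𝟙≥0 (deviant i u v))

      inClass : A → V → ℚ
      inClass x u = 𝟙 (sameSides P x (inj₁ u))

      devMass : Fin 5 → A → A → ℚ
      devMass i x y = pairing (inClass x) (inClass y) (dev i)

      -- At least a tenth of the cell deviates, which is more than `five-cycles` can tolerate.
      many : Fin 5 → A → A → Bool
      many i x y = realMass P x * realMass P y ≤ᵗ 10ℚ * devMass i x y

      -- A union of cells of the coarse partition. This invariance allows `bad-few` to replace the
      -- graph by its coarse density.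
      bad : Fin 5 → A → A → Bool
      bad i x y = small x ∨ small y ∨ low i x y ∨ many i x y

      low-cong : ∀ i {x x′ y y′} → sameSides P x x′ ≡ true → sameSides P y y′ ≡ true → low i x y ≡ low i x′ y′
      low-cong i {x} {x′} {y} {y′} h k = cong (_≤ᵗ κ) (trans (proj₁ (E₂-invariant Π (lift (p i))) y x x′ h)
          (proj₂ (E₂-invariant Π (lift (p i))) x′ y y′ k))

      bad-invariant : ∀ i → Invariant₂ Π (λ x y → 𝟙 (bad i x y))
      bad-invariant i = (λ y x x′ h → cong 𝟙 (bad-cong h (sameSides-refl P y))) , (λ x y y′ h →
          cong 𝟙 (bad-cong (sameSides-refl P x) h))
        where
        mass-cong : ∀ {x x′} → sameSides P x x′ ≡ true → realMass P x ≡ realMass P x′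
        mass-cong {x} {x′} h = ∫-cong (λ v → cong 𝟙 (sameSides-cong P x x′ h (inj₁ v)))
        dev-cong : ∀ {x x′ y y′} → sameSides P x x′ ≡ true → sameSides P y y′ ≡ true → devMass i x y ≡ devMass i x′ y′
        dev-cong {x} {x′} {y} {y′} h k = ∫∫-cong (λ u v → cong₂ (λ b c → 𝟙 b * (𝟙 c * dev i u v)) (sameSides-cong P
            x x′ h (inj₁ u)) (sameSides-cong P y y′ k (inj₁ v)))
        bad-cong : ∀ {x x′ y y′} → sameSides P x x′ ≡ true → sameSides P y y′ ≡ true → bad i x y ≡ bad i x′ y′
        bad-cong h k = cong₂ _∨_ (cong (_≤ᵗ fakeMass P) (mass-cong h)) (cong₂ _∨_ (cong (_≤ᵗ fakeMass P) (mass-cong k))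
          (cong₂ _∨_ (low-cong i h k) (cong₂ _≤ᵗ_ (cong₂ _*_ (mass-cong h) (mass-cong k)) (cong (10ℚ *_)
              (dev-cong h k)))))

      iw : A → ℚ
      iw x = inv (weight Π x)

      iw≥0 : ∀ x → 0ℚ ≤ iw x
      iw≥0 x = inv≥0 (weight>0 Π x)

      w-iw : ∀ x → (realMass P x + fakeMass P) * iw x ≡ 1ℚ
      w-iw x = trans (cong (_* iw x) (sym (class-mass P coarse≤T x))) (*-inv (weight>0 Π x))

      fake : A → ℚ
      fake (inj₁ v) = 0ℚ
      fake (inj₂ b) = 1ℚ

      fake-share : ∀ x → E Π fake x ≡ fakeMass P * iw x
      fake-share x = trans (∫-⊕ (λ y → K Π x y * fake y))
          (trans (cong₂ _+_ (trans (∫-cong (λ v → *-zeroʳ (K Π x (inj₁ v)))) ∫-0)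
        (trans (∫-cong (λ b → *-identityʳ (K Π x (inj₂ b)))) (trans (∫-*ʳ (iw x) _) (cong (_* iw x) (∫-fake-class P
            coarse≤T x))))) (+-identityˡ _))

      -- At least half of the weight of a small class is fake, so the average of `fake` is at least
      -- one half there, while all fake mass together is `κ * κ`.
      ∫-small : ∫ μ (λ x → 𝟙 (small x)) ≤ 2ℚ * (κ * κ)
      ∫-small = begin
        ∫ μ (λ x → 𝟙 (small x)) ≤⟨ ∫-mono pointwise ⟩
        ∫ μ (λ x → 2ℚ * E Π fake x) ≡⟨ ∫-*ˡ 2ℚ (E Π fake) ⟩
        2ℚ * ∫ μ (E Π fake) ≡⟨ cong (2ℚ *_) total ⟩
        2ℚ * (κ * κ) ∎
        where
        open ≤-Reasoning
        total : ∫ μ (E Π fake) ≡ κ * κ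
        total = trans (trans (∫-cong (λ x → sym (*-identityʳ (E Π fake x))))
            (trans (sym (E-adjoint Π fake {λ _ → 1ℚ} (λ _ _ _ → refl))) (∫-cong (λ x → *-identityʳ (fake x)))))
          (trans (∫-⊕ fake) (trans (cong₂ _+_ ∫-0 ∫-fakes-1) (+-identityˡ (κ * κ))))
        certificate : ∀ r φ w → 2ℚ * (φ * w) ≡ (r + φ) * w + (φ - r) * w
        certificate = solve-∀ ℚ-ring
        pointwise : ∀ x → 𝟙 (small x) ≤ 2ℚ * E Π fake x
        pointwise x with realMass P x ≤ᵗ fakeMass P | comparison (realMass P x) (fakeMass P)
        ... | _ | below h = subst₂ _≤_ (w-iw x) (cong (2ℚ *_) (sym (fake-share x)))
            (≤-by _ (certificate (realMass P x) (fakeMass P) (iw x)) (0≤* (gap h) (iw≥0 x)))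
        ... | _ | above h = 0≤* 0≤2 (subst (0ℚ ≤_) (sym (fake-share x)) (0≤* (<⇒≤ (fakeMass>0 P)) (iw≥0 x)))

      liftedDev : Fin 5 → A → A → ℚ
      liftedDev i = lift (dev i)

      share : ∀ i x y → iw x * iw y * devMass i x y ≤ E₂ Π (liftedDev i) x y
      share i x y = begin
        iw x * iw y * devMass i x y ≡⟨ cong (iw x * iw y *_) (pairing-left (inClass x) (inClass y) (dev i)) ⟩
        iw x * iw y * ∫ ν (λ u → inClass x u * ∫ ν (λ v → inClass y v * dev i u v)) ≡⟨ sym (∫-*ˡ (iw x * iw y) _) ⟩
        ∫ ν (λ u → iw x * iw y * (inClass x u * ∫ ν (λ v → inClass y v * dev i u v)))
          ≡⟨ ∫-cong (λ u → trans (regroup (iw x) (iw y) (inClass x u) _) (cong (inClass x u * iw x *_)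
              (trans (sym (∫-*ˡ (iw y) _)) (∫-cong (λ v → regroup′ (iw y) (inClass y v) (dev i u v)))))) ⟩
        ∫ ν (λ u → K Π x (inj₁ u) * ∫ ν (λ v → K Π y (inj₁ v) * dev i u v))
          ≤⟨ ∫-mono (λ u → *-monoˡ-≤ (K≥0 Π x (inj₁ u)) (∫-μ-≥ (λ y′ → nonneg (inj₁ u) y′))) ⟩
        ∫ ν (λ u → K Π x (inj₁ u) * ∫ μ (λ y′ → K Π y y′ * liftedDev i (inj₁ u) y′))
          ≤⟨ ∫-μ-≥ (λ x′ → 0≤* (K≥0 Π x x′) (∫-≥0 (nonneg x′))) ⟩
        E₂ Π (liftedDev i) x y ∎
        where
        open ≤-Reasoning
        nonneg : ∀ x′ y′ → 0ℚ ≤ K Π y y′ * liftedDev i x′ y′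
        nonneg x′ y′ = 0≤* (K≥0 Π y y′) (lift≥0 (dev≥0 i) x′ y′)
        regroup : ∀ a b c d → a * b * (c * d) ≡ c * a * (b * d)
        regroup = solve-∀ ℚ-ring
        regroup′ : ∀ a b c → a * (b * c) ≡ b * a * c
        regroup′ = solve-∀ ℚ-ring

      40E₂≥0 : ∀ i x y → 0ℚ ≤ 40ℚ * E₂ Π (liftedDev i) x y
      40E₂≥0 i x y = 0≤* (nonNegative⁻¹ 40ℚ) (E₂≥0 Π (lift≥0 (dev≥0 i)) x y)

      -- If neither class is small, each weight is at most twice the real mass, so the deviant pairs
      -- make up at least a fortieth of the weighted cell.
      many-share : ∀ i x y → fakeMass P < realMass P x → fakeMass P < realMass P y → realMass P x * realMass P y ≤
          10ℚ * devMass i x y →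
        1ℚ ≤ 40ℚ * E₂ Π (liftedDev i) x y
      many-share i x y hx hy h = begin
        1ℚ ≡⟨ sym (cong₂ _*_ (w-iw x) (w-iw y)) ⟩
        ((r + φ) * a) * ((r′ + φ) * b) ≤⟨ *-mono-≤ (0≤* (0≤+ r≥0 φ≥0) a≥0) (0≤* (0≤+ r′≥0 φ≥0) b≥0) (*-monoʳ-≤ a≥0
            (+-monoʳ-≤ r (<⇒≤ hx))) (*-monoʳ-≤ b≥0 (+-monoʳ-≤ r′ (<⇒≤ hy))) ⟩
        ((r + r) * a) * ((r′ + r′) * b) ≡⟨ regroup r r′ a b ⟩
        4ℚ * (a * b) * (r * r′) ≤⟨ *-monoˡ-≤ (0≤* (nonNegative⁻¹ 4ℚ) (0≤* a≥0 b≥0)) h ⟩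
        4ℚ * (a * b) * (10ℚ * devMass i x y) ≡⟨ regroup′ (a * b) (devMass i x y) ⟩
        40ℚ * (a * b * devMass i x y) ≤⟨ *-monoˡ-≤ (nonNegative⁻¹ 40ℚ) (share i x y) ⟩
        40ℚ * E₂ Π (liftedDev i) x y ∎
        where
        open ≤-Reasoning
        r r′ φ a b : ℚ
        r = realMass P x
        r′ = realMass P y
        φ = fakeMass P
        a = iw x
        b = iw y
        r≥0 = realMass≥0 P x
        r′≥0 = realMass≥0 P y
        φ≥0 = <⇒≤ (fakeMass>0 P)
        a≥0 = iw≥0 x
        b≥0 = iw≥0 y
        regroup : ∀ r r′ a b → ((r + r) * a) * ((r′ + r′) * b) ≡ 4ℚ * (a * b) * (r * r′)
        regroup = solve-∀ ℚ-ring
        regroup′ : ∀ ab d → 4ℚ * ab * (10ℚ * d) ≡ 40ℚ * (ab * d)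
        regroup′ = solve-∀ ℚ-ring

      -- Chebyshev's inequality: at a deviant pair the density falls from above `κ` to at most
      -- `½ * κ`, so `κ * κ * dev` is at most 4 times the squared difference, whose integral is at
      -- most `ε`.
      ∫∫-dev : ∀ i → 40ℚ * ∫ μ (λ x → ∫ μ (λ y → E₂ Π (liftedDev i) x y)) ≤ κ * κ
      ∫∫-dev i = *-cancelˡ-≤ 0<τ (begin
        κ * κ * (40ℚ * ∫ μ (λ x → ∫ μ (λ y → E₂ Π (liftedDev i) x y))) ≡⟨ cong (λ z → κ * κ * (40ℚ * z)) total ⟩
        κ * κ * (40ℚ * ∫ ν (λ u → ∫ ν (dev i u))) ≡⟨ regroup (κ * κ) _ ⟩
        40ℚ * (κ * κ * ∫ ν (λ u → ∫ ν (dev i u))) ≡⟨ cong (40ℚ *_) (sym (∫∫-*ˡ (κ * κ) (dev i))) ⟩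
        40ℚ * ∫ ν (λ u → ∫ ν (λ v → κ * κ * dev i u v)) ≤⟨ *-monoˡ-≤ (nonNegative⁻¹ 40ℚ) (∫∫-mono pointwise) ⟩
        40ℚ * ∫ ν (λ u → ∫ ν (λ v → 4ℚ * sq (inj₁ u) (inj₁ v))) ≡⟨ cong (40ℚ *_) (∫∫-*ˡ 4ℚ _) ⟩
        40ℚ * (4ℚ * ∫ ν (λ u → ∫ ν (λ v → sq (inj₁ u) (inj₁ v)))) ≤⟨ *-monoˡ-≤ (nonNegative⁻¹ 40ℚ)
            (*-monoˡ-≤ (nonNegative⁻¹ 4ℚ)
            (≤-trans (∫-mono (λ u → ∫-μ-≥ (sq≥0 (inj₁ u)))) (≤-trans (∫-μ-≥ (λ x → ∫-≥0 (sq≥0 x))) (norm≤ε i)))) ⟩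
        40ℚ * (4ℚ * ε) ≡⟨ trans (regroup″ ε) 160ε ⟩
        κ * κ * (κ * κ) ∎)
        where
        open ≤-Reasoning
        sq : A → A → ℚ
        sq x y = (g i x y - f i x y) * (g i x y - f i x y)
        sq≥0 : ∀ x y → 0ℚ ≤ sq x y
        sq≥0 x y = 0≤sq (g i x y - f i x y)
        total : ∫ μ (λ x → ∫ μ (λ y → E₂ Π (liftedDev i) x y)) ≡ ∫ ν (λ u → ∫ ν (dev i u))
        total = trans (∫∫-cong (λ x y → sym (*-identityʳ (E₂ Π (liftedDev i) x y))))
          (trans (sym (E₂-adjoint Π (liftedDev i) {λ _ _ → 1ℚ} ((λ _ _ _ _ → refl) , (λ _ _ _ _ → refl))))
          (trans (∫∫-lift (dev i) (λ _ _ → 1ℚ)) (∫∫-cong (λ u v → *-identityʳ (dev i u v)))))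
        regroup : ∀ k d → k * (40ℚ * d) ≡ 40ℚ * (k * d)
        regroup = solve-∀ ℚ-ring
        regroup″ : ∀ e → 40ℚ * (4ℚ * e) ≡ 160ℚ * e
        regroup″ = solve-∀ ℚ-ring
        certificate : ∀ k a b → 4ℚ * ((b - a) * (b - a)) ≡ k * k * (1ℚ * 1ℚ) + ((2ℚ * ((a - k) + (½ * k - b))) *
            (2ℚ * ((a - k) + (½ * k - b)) + 2ℚ * k))
        certificate = solve-∀ ℚ-ring
        trivial : ∀ {a b c} → c ≡ 0ℚ → 0ℚ ≤ b → κ * κ * c ≤ 4ℚ * b
        trivial {c = c} e h = subst (_≤ _) (sym (trans (cong (κ * κ *_) e) (*-zeroʳ (κ * κ))))
            (0≤* (nonNegative⁻¹ 4ℚ) h)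
        pointwise : ∀ u v → κ * κ * dev i u v ≤ 4ℚ * sq (inj₁ u) (inj₁ v)
        pointwise u v with f i (inj₁ u) (inj₁ v) ≤ᵗ κ | comparison (f i (inj₁ u) (inj₁ v)) κ | g i (inj₁ u) (inj₁ v)
            ≤ᵗ ½ * κ | comparison (g i (inj₁ u) (inj₁ v)) (½ * κ)
        ... | _ | above hf | _ | below hg = ≤-by _ (certificate κ (f i (inj₁ u) (inj₁ v)) (g i (inj₁ u) (inj₁ v)))
                (0≤* (0≤* 0≤2 gaps) (0≤+ (0≤* 0≤2 gaps) (0≤* 0≤2 (<⇒≤ 0<κ))))
          where
          gaps : 0ℚ ≤ (f i (inj₁ u) (inj₁ v) - κ) + (½ * κ - g i (inj₁ u) (inj₁ v))
          gaps = 0≤+ (gap (<⇒≤ hf)) (gap hg)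
        ... | _ | below hf | b | _ = trivial {a = 0ℚ} (*-zeroˡ (𝟙 b)) (sq≥0 (inj₁ u) (inj₁ v))
        ... | _ | above hf | _ | above hg = trivial {a = 0ℚ} (*-zeroʳ 1ℚ) (sq≥0 (inj₁ u) (inj₁ v))

      iκ : ℚ
      iκ = inv κ

      excess : Fin 5 → A → A → ℚ
      excess i x y = 𝟙 (small x) + 𝟙 (small y) + 40ℚ * E₂ Π (liftedDev i) x y

      excess≥0 : ∀ i x y → 0ℚ ≤ excess i x y
      excess≥0 i x y = 0≤+ (0≤+ (𝟙≥0 (small x)) (𝟙≥0 (small y))) (40E₂≥0 i x y)

      -- The weights suit the sizes at hand: `κ` multiplies an energy of constant order, while the
      -- constant `iκ` is paid only on exceptional cells, whose measure is of order κ². Both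
      -- contributions are of order κ.
      am-gm : ∀ a → a ≤ κ * (a * a) + iκ
      am-gm a with a ≤ᵗ iκ | comparison a iκ
      ... | _ | below h = ≤-trans h (subst (_≤ κ * (a * a) + iκ) (+-identityˡ iκ) (+-monoˡ-≤ iκ (0≤* (<⇒≤ 0<κ)
          (0≤sq a))))
      ... | _ | above h = ≤-by _ (identity κ iκ a (*-inv 0<κ))
          (0≤+ (0≤* (<⇒≤ 0<κ) (0≤* (<⇒≤ (<-trans (inv>0 0<κ) h)) (gap (<⇒≤ h)))) (inv≥0 0<κ))
        where
        expand : ∀ k i a → a * (k * i) + (k * (a * (a - i)) + i) ≡ k * (a * a) + i
        expand = solve-∀ ℚ-ring
        identity : ∀ k i a → k * i ≡ 1ℚ → k * (a * a) + i ≡ a + (k * (a * (a - i)) + i)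
        identity k i a e = trans (sym (expand k i a)) (cong (_+ (k * (a * (a - i)) + i)) (trans (cong (a *_) e)
            (*-identityʳ a)))

      bad-pointwise : ∀ i x y → f i x y * 𝟙 (bad i x y) ≤ κ * (f i x y * f i x y) + iκ * excess i x y + κ
      bad-pointwise i x y = cases (bad i x y) (why (comparison r φ) (comparison r′ φ) (comparison a κ)
          (comparison (r * r′) (10ℚ * devMass i x y)))
        where
        a : ℚ
        a = f i x y
        X : ℚ
        X = excess i x y
        aa≥0 : 0ℚ ≤ κ * (a * a)
        aa≥0 = 0≤* (<⇒≤ 0<κ) (0≤sq a)
        rest≥0 : 0ℚ ≤ iκ * X
        rest≥0 = 0≤* (inv≥0 0<κ) (excess≥0 i x y)
        by-excess : ∀ {X} → 1ℚ ≤ X → a ≤ κ * (a * a) + iκ * X + κ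
        by-excess {X} h = ≤-trans (am-gm a) (≤-by _ (identity (κ * (a * a)) iκ X κ) (0≤+ (0≤* (inv≥0 0<κ) (gap h))
            (<⇒≤ 0<κ)))
          where
          identity : ∀ s i x k → s + i * x + k ≡ s + i + (i * (x - 1ℚ) + k)
          identity = solve-∀ ℚ-ring
        by-low : ∀ {X} → 0ℚ ≤ X → a ≤ κ → a ≤ κ * (a * a) + iκ * X + κ
        by-low {X} X≥0 h = ≤-trans h (≤-by _ (+-comm (κ * (a * a) + iκ * X) κ) (0≤+ aa≥0 (0≤* (inv≥0 0<κ) X≥0)))
        cases : ∀ b → (b ≡ true → a ≤ κ * (a * a) + iκ * X + κ) → a * 𝟙 b ≤ κ * (a * a) + iκ * X + κ
        cases true h = subst (_≤ κ * (a * a) + iκ * X + κ) (sym (*-identityʳ a)) (h refl)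
        cases false h = subst (_≤ κ * (a * a) + iκ * X + κ) (sym (*-zeroʳ a)) (0≤+ (0≤+ aa≥0 rest≥0) (<⇒≤ 0<κ))
        1≤sum : ∀ {s t} → 0ℚ ≤ s → 0ℚ ≤ t → 1ℚ ≤ 1ℚ + s + t
        1≤sum {s} {t} hs ht = ≤-by _ (+-assoc 1ℚ s t) (0≤+ hs ht)
        1≤0+1+ : ∀ {t} → 0ℚ ≤ t → 1ℚ ≤ 0ℚ + 1ℚ + t
        1≤0+1+ {t} ht = ≤-by t refl ht
        r r′ φ Z : ℚ
        r = realMass P x
        r′ = realMass P y
        φ = fakeMass P
        Z = 40ℚ * E₂ Π (liftedDev i) x y
        why : ∀ {s s′ l m} → Comparison r φ s → Comparison r′ φ s′ → Comparison a κ l → Comparison (r * r′)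
            (10ℚ * devMass i x y) m →
          s ∨ s′ ∨ l ∨ m ≡ true → a ≤ κ * (a * a) + iκ * (𝟙 s + 𝟙 s′ + Z) + κ
        why {s′ = s′} (below _) _ _ _ _ = by-excess (1≤sum (𝟙≥0 s′) (40E₂≥0 i x y))
        why (above _) (below _) _ _ _ = by-excess (1≤0+1+ (40E₂≥0 i x y))
        why (above _) (above _) (below l) _ _ = by-low (0≤+ ≤-refl (40E₂≥0 i x y)) l
        why (above hx) (above hy) (above _) (below m) _ = by-excess (subst (1ℚ ≤_) (sym (+-identityˡ Z))
            (many-share i x y hx hy m))
        why (above _) (above _) (above _) (above _) ()

      -- A small set of cells could carry much of a sparse graph; the bounded energy of the coarse
      -- density excludes this through `am-gm`.
      bad-few : ∀ i → ∫ ν (λ u → ∫ ν (λ v → p i u v * 𝟙 (bad i (inj₁ u) (inj₁ v)))) ≤ 15ℚ * κ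
      bad-few i = begin
        ∫ ν (λ u → ∫ ν (λ v → p i u v * 𝟙 (bad i (inj₁ u) (inj₁ v)))) ≡⟨ sym (∫∫-lift (p i) (λ x y → 𝟙 (bad i x y))) ⟩
        ∫ μ (λ x → ∫ μ (λ y → lift (p i) x y * 𝟙 (bad i x y))) ≡⟨ E₂-adjoint Π (lift (p i)) (bad-invariant i) ⟩
        ∫ μ (λ x → ∫ μ (λ y → f i x y * 𝟙 (bad i x y))) ≤⟨ ∫∫-mono (bad-pointwise i) ⟩
        ∫ μ (λ x → ∫ μ (λ y → κ * (f i x y * f i x y) + iκ * excess i x y + κ))
          ≡⟨ trans (∫∫-+ _ _) (cong (_+ ∫ μ (λ x → ∫ μ (λ y → κ))) (trans (∫∫-+ _ _) (cong₂ _+_ (∫∫-*ˡ κ _)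
              (∫∫-*ˡ iκ (excess i))))) ⟩
        κ * energyᵢ P coarse≤T i + iκ * ∫ μ (λ x → ∫ μ (λ y → excess i x y)) + ∫ μ (λ x → ∫ μ (λ y → κ))
          ≤⟨ +-mono-≤ (+-mono-≤ (*-monoˡ-≤ (<⇒≤ 0<κ) (bounded P coarse≤T i)) (*-monoˡ-≤ (inv≥0 0<κ) ∫∫-excess)) ∫∫-κ ⟩
        κ * 2ℚ + iκ * (9ℚ * (κ * κ)) + 4ℚ * κ ≡⟨ identity κ iκ (*-inv 0<κ) ⟩
        15ℚ * κ ∎
        where
        open ≤-Reasoning
        expand : ∀ k i → k * 2ℚ + i * (9ℚ * (k * k)) + 4ℚ * k ≡ 2ℚ * k + 9ℚ * k * (k * i) + 4ℚ * k
        expand = solve-∀ ℚ-ring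
        collect : ∀ k → 2ℚ * k + 9ℚ * k * 1ℚ + 4ℚ * k ≡ 15ℚ * k
        collect = solve-∀ ℚ-ring
        identity : ∀ k i → k * i ≡ 1ℚ → k * 2ℚ + i * (9ℚ * (k * k)) + 4ℚ * k ≡ 15ℚ * k
        identity k i e = trans (expand k i) (trans (cong (λ z → 2ℚ * k + 9ℚ * k * z + 4ℚ * k) e) (collect k))
        m : ℚ
        m = ∫ μ (λ _ → 1ℚ)
        m≥0 : 0ℚ ≤ m
        m≥0 = ∫-≥0 (λ _ → 0≤1)
        S : ℚ
        S = ∫ μ (λ x → 𝟙 (small x))
        S≥0 : 0ℚ ≤ S
        S≥0 = ∫-≥0 (λ x → 𝟙≥0 (small x))
        ∫∫-κ : ∫ μ (λ x → ∫ μ (λ y → κ)) ≤ 4ℚ * κ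
        ∫∫-κ = subst (_≤ 4ℚ * κ) (sym (trans (∫-cong (λ x → ∫-const κ)) (∫-const (κ * m))))
          (≤-by _ (cert κ m) (0≤* (<⇒≤ 0<κ) (gap (*-mono-≤ m≥0 m≥0 ∫-μ-1≤2 ∫-μ-1≤2))))
          where
          cert : ∀ k m → 4ℚ * k ≡ k * m * m + k * (2ℚ * 2ℚ - m * m)
          cert = solve-∀ ℚ-ring
        Sm≤ : S * m ≤ 4ℚ * (κ * κ)
        Sm≤ = ≤-trans (*-mono-≤ S≥0 m≥0 ∫-small ∫-μ-1≤2) (≤-reflexive (cert (κ * κ)))
          where
          cert : ∀ k → 2ℚ * k * 2ℚ ≡ 4ℚ * k
          cert = solve-∀ ℚ-ring
        ∫∫-excess : ∫ μ (λ x → ∫ μ (λ y → excess i x y)) ≤ 9ℚ * (κ * κ)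
        ∫∫-excess = begin
          ∫ μ (λ x → ∫ μ (λ y → excess i x y)) ≡⟨ trans (∫∫-+ _ _) (cong₂ _+_ (∫∫-+ _ _) (∫∫-*ˡ 40ℚ _)) ⟩
          ∫ μ (λ x → ∫ μ (λ y → 𝟙 (small x))) + ∫ μ (λ x → ∫ μ (λ y → 𝟙 (small y))) + 40ℚ * ∫ μ (λ x →
              ∫ μ (λ y → E₂ Π (liftedDev i) x y))
            ≡⟨ cong (λ z → z + 40ℚ * ∫ μ (λ x → ∫ μ (λ y → E₂ Π (liftedDev i) x y)))
                (cong₂ _+_ (trans (∫-cong (λ x → ∫-const (𝟙 (small x)))) (∫-*ʳ m _)) (∫-const S)) ⟩
          S * m + S * m + 40ℚ * ∫ μ (λ x → ∫ μ (λ y → E₂ Π (liftedDev i) x y)) ≤⟨ +-mono-≤ (+-mono-≤ Sm≤ Sm≤)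
              (∫∫-dev i) ⟩
          4ℚ * (κ * κ) + 4ℚ * (κ * κ) + κ * κ ≡⟨ sum (κ * κ) ⟩
          9ℚ * (κ * κ) ∎
          where
          sum : ∀ k → 4ℚ * k + 4ℚ * k + k ≡ 9ℚ * k
          sum = solve-∀ ℚ-ring

      record Good (i : Fin 5) (x y : A) : Set where
        field
          large : fakeMass P < realMass P x
          dense : κ < f i x y
          few : 10ℚ * devMass i x y < realMass P x * realMass P y

      good : ∀ i x y → bad i x y ≡ false → Good i x y
      good i x y = unpack (comparison (realMass P x) (fakeMass P)) (comparison (realMass P y) (fakeMass P))
          (comparison (f i x y) κ)
          (comparison (realMass P x * realMass P y) (10ℚ * devMass i x y))
        where
        unpack : ∀ {s s′ l m} → Comparison (realMass P x) (fakeMass P) s → Comparison (realMass P y) (fakeMass P) s′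
            → Comparison (f i x y) κ l →
          Comparison (realMass P x * realMass P y) (10ℚ * devMass i x y) m → s ∨ s′ ∨ l ∨ m ≡ false → Good i x y
        unpack (above a) (above _) (above c) (above d) _ = record { large = a ; dense = c ; few = d }

      b : Fin 5 → V → V → ℚ
      b i u v = 𝟙 (not (deviant i u v))

      b-unit : ∀ i u → InUnit (b i u)
      b-unit i u v = 𝟙≥0 (not (deviant i u v)) , 𝟙≤1 (not (deviant i u v))

      class-unit : ∀ x → InUnit (inClass x)
      class-unit x u = 𝟙≥0 (sameSides P x (inj₁ u)) , 𝟙≤1 (sameSides P x (inj₁ u))

      -- The coarse density is constant on the cell and exceeds `κ`, so no pair in it is low; every
      -- pair missing from `b` is then counted by `dev`, and `few` applies.
      nearly-complete : ∀ i x y → Good i x y → 10ℚ * pairing (inClass x) (inClass y) (λ u v → 1ℚ - b i u v) ≤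
          realMass P x * realMass P y
      nearly-complete i x y G = ≤-trans (*-monoˡ-≤ (nonNegative⁻¹ 10ℚ) (∫∫-mono pointwise)) (<⇒≤ (Good.few G))
        where
        high : ∀ {u v} → sameSides P x (inj₁ u) ≡ true → sameSides P y (inj₁ v) ≡ true → low i (inj₁ u) (inj₁ v) ≡ false
        high h k = trans (sym (low-cong i h k)) (not-below (comparison (f i x y) κ))
          where
          not-below : ∀ {l} → Comparison (f i x y) κ l → l ≡ false
          not-below (below h) = contradiction (Good.dense G) (λ d → <-irrefl refl (<-≤-trans d h))
          not-below (above _) = refl
        complement : ∀ d → 1ℚ - 𝟙 (not d) ≡ 1ℚ * 𝟙 d
        complement true = refl
        complement false = refl
        equal : ∀ s t l d → (s ≡ true → t ≡ true → l ≡ false) → 𝟙 s * (𝟙 t * (1ℚ - 𝟙 (not d))) ≡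
            𝟙 s * (𝟙 t * (𝟙 (not l) * 𝟙 d))
        equal false t l d h = trans (*-zeroˡ (𝟙 t * (1ℚ - 𝟙 (not d)))) (sym (*-zeroˡ (𝟙 t * (𝟙 (not l) * 𝟙 d))))
        equal true false l d h = cong (1ℚ *_) (trans (*-zeroˡ (1ℚ - 𝟙 (not d))) (sym (*-zeroˡ (𝟙 (not l) * 𝟙 d))))
        equal true true l d h rewrite h refl refl = cong (λ z → 1ℚ * (1ℚ * z)) (complement d)
        pointwise : ∀ u v → inClass x u * (inClass y v * (1ℚ - b i u v)) ≤ inClass x u * (inClass y v * dev i u v)
        pointwise u v = ≤-reflexive (equal (sameSides P x (inj₁ u)) (sameSides P y (inj₁ v)) (low i (inj₁ u)
            (inj₁ v)) (deviant i u v) high)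

      α : ℚ
      α = ½ * κ

      α≥0 : 0ℚ ≤ α
      α≥0 = 0≤* 0≤½ (<⇒≤ 0<κ)

      -- The fine density `g` is cut down to the value `½ * κ` where it exceeds it and to 0
      -- elsewhere. Regularity from below survives the decrease, and the model becomes bounded by 1,
      -- which `g` need not be.
      q : Fin 5 → V → V → ℚ
      q i u v = α * b i u v

      model : ∀ i → Model (p i) (q i) (4ℚ * ℓ t)
      model i = record
        { p≥0 = p≥0 i
        ; q≥0 = λ u v → 0≤* α≥0 (proj₁ (b-unit i u v))
        ; q≤1 = λ u v → *-mono-≤ {q = 1ℚ} {s = 1ℚ} α≥0 (proj₁ (b-unit i u v)) α≤1 (proj₂ (b-unit i u v))
        ; cut = λ S S′ → ≤-trans (regular i S S′) (∫∫-mono (λ u v → *-monoˡ-≤ (𝟙≥0 (S u)) (*-monoˡ-≤ (𝟙≥0 (S′ v))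
            (+-monoʳ-≤ (p i u v) (neg-antimono-≤ (q≤g u v))))))
        }
        where
        α≤1 : α ≤ 1ℚ
        α≤1 = *-mono-≤ {q = 1ℚ} {s = 1ℚ} 0≤½ (<⇒≤ 0<κ) (≤-by ½ refl 0≤½) κ≤1
        bound : ∀ {z d} → 0ℚ ≤ z → Comparison z α d → α * 𝟙 (not d) ≤ z
        bound {z} z≥0 (below h) = subst (_≤ z) (sym (*-zeroʳ α)) z≥0
        bound {z} z≥0 (above h) = subst (_≤ z) (sym (*-identityʳ α)) (<⇒≤ h)
        q≤g : ∀ u v → q i u v ≤ g i (inj₁ u) (inj₁ v)
        q≤g u v = bound (density≥0 Q fine≤T i (inj₁ u) (inj₁ v)) (comparison (g i (inj₁ u) (inj₁ v)) α)

      scaled-triangles : triangles (q 0F ∘ᵏ q 1F) (q 2F ∘ᵏ q 3F) (q 4F) ≡ pow₅ α * triangles (b 0F ∘ᵏ b 1F)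
          (b 2F ∘ᵏ b 3F) (b 4F)
      scaled-triangles = trans (∫-cong (λ x → trans (∫∫-cong (λ z w →
          trans (cong₂ (λ r r′ → r * (q 4F w x * r′)) (scaled-∘ᵏ (b 0F) (b 1F) x z) (scaled-∘ᵏ (b 2F) (b 3F) z w))
            (regroup α ((b 0F ∘ᵏ b 1F) x z) (b 4F w x) ((b 2F ∘ᵏ b 3F) z w)))) (∫∫-*ˡ (pow₅ α) _))) (∫-*ˡ (pow₅ α) _)
        where
        scaled-∘ᵏ : ∀ (c d : V → V → ℚ) x z → ((λ u v → α * c u v) ∘ᵏ (λ u v → α * d u v)) x z ≡ α * α * (c ∘ᵏ d) x z
        scaled-∘ᵏ c d x z = trans (∫-cong (λ y → pull α (c x y) (d y z))) (∫-*ˡ (α * α) _)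
          where
          pull : ∀ a c d → a * c * (a * d) ≡ a * a * (c * d)
          pull = solve-∀ ℚ-ring
        regroup : ∀ a r c r′ → (a * a * r) * ((a * c) * (a * a * r′)) ≡ a * a * a * a * a * (r * (c * r′))
        regroup = solve-∀ ℚ-ring

      -- `Good` records a large class only for its first vertex; around the cycle every vertex is
      -- the first one of some edge, so all five masses exceed the fake mass of a class.
      good-cycle : ∀ {v₁ v₂ v₃ v₄ v₅ : V} → Good 0F (inj₁ v₁) (inj₁ v₂) → Good 1F (inj₁ v₂) (inj₁ v₃) →
          Good 2F (inj₁ v₃) (inj₁ v₄) →
        Good 3F (inj₁ v₄) (inj₁ v₅) → Good 4F (inj₁ v₅) (inj₁ v₁) →
        pow₅ α * (½ * pow₅ (κ * κ * halfPower t)) ≤ triangles (q 0F ∘ᵏ q 1F) (q 2F ∘ᵏ q 3F) (q 4F)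
      good-cycle {v₁} {v₂} {v₃} {v₄} {v₅} g₁ g₂ g₃ g₄ g₅ = subst (pow₅ α * (½ * pow₅ φ) ≤_) (sym scaled-triangles)
        (*-monoˡ-≤ pow₅≥0 (≤-trans (*-monoˡ-≤ 0≤½ masses)
          (five-cycles (class-unit (inj₁ v₁)) (class-unit (inj₁ v₂)) (class-unit (inj₁ v₃)) (class-unit (inj₁ v₄))
              (class-unit (inj₁ v₅))
            (b-unit 0F) (b-unit 1F) (b-unit 2F) (b-unit 3F) (b-unit 4F)
            (nearly-complete 0F _ _ g₁) (nearly-complete 1F _ _ g₂) (nearly-complete 2F _ _ g₃) (nearly-complete 3F
                _ _ g₄) (nearly-complete 4F _ _ g₅))))
        where
        φ : ℚ
        φ = κ * κ * halfPower t
        φ≥0 : 0ℚ ≤ φ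
        φ≥0 = 0≤* (<⇒≤ 0<τ) (<⇒≤ (halfPower>0 t))
        φ≤ : φ ≤ fakeMass P
        φ≤ = *-monoˡ-≤ (<⇒≤ 0<τ) (halfPower-antimono coarse≤t)
        pow₅≥0 : 0ℚ ≤ pow₅ α
        pow₅≥0 = 0≤* (0≤* (0≤* (0≤* α≥0 α≥0) α≥0) α≥0) α≥0
        φ≤r : ∀ {i x y} → Good i x y → φ ≤ realMass P x
        φ≤r G = ≤-trans φ≤ (<⇒≤ (Good.large G))
        masses : pow₅ φ ≤ realMass P (inj₁ v₁) * realMass P (inj₁ v₂) * realMass P (inj₁ v₃) * realMass P (inj₁ v₄)
            * realMass P (inj₁ v₅)
        masses = *-mono-≤ (0≤* (0≤* (0≤* φ≥0 φ≥0) φ≥0) φ≥0) φ≥0 (*-mono-≤ (0≤* (0≤* φ≥0 φ≥0) φ≥0) φ≥0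
            (*-mono-≤ (0≤* φ≥0 φ≥0) φ≥0
          (*-mono-≤ φ≥0 φ≥0 (φ≤r g₁) (φ≤r g₂)) (φ≤r g₃)) (φ≤r g₄)) (φ≤r g₅)

  -- Removal for graphs with few four-cycles

  8ℚ 64ℚ : ℚ
  8ℚ = 4ℚ + 4ℚ
  64ℚ = 8ℚ * 8ℚ

  pow₅>0 : ∀ {a} → 0ℚ < a → 0ℚ < pow₅ a
  pow₅>0 h = 0<* (0<* (0<* (0<* h h) h) h) h

  pow₅-mono : ∀ {a b} → 0ℚ ≤ a → a ≤ b → pow₅ a ≤ pow₅ b
  pow₅-mono a≥0 h = *-mono-≤ (0≤* (0≤* (0≤* a≥0 a≥0) a≥0) a≥0) a≥0 (*-mono-≤ (0≤* (0≤* a≥0 a≥0) a≥0) a≥0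
    (*-mono-≤ (0≤* a≥0 a≥0) a≥0 (*-mono-≤ a≥0 a≥0 h h) h) h) h

  module Constants {κ : ℚ} (0<κ : 0ℚ < κ) where

    -- The density of five-cycles that a good cycle of the coarse partition guarantees in the model.
    main : ℕ → ℚ
    main t = pow₅ (½ * κ) * (½ * pow₅ (κ * κ * halfPower t))

    main>0 : ∀ t → 0ℚ < main t
    main>0 t = 0<* (pow₅>0 (0<* (positive⁻¹ ½) 0<κ)) (0<* (positive⁻¹ ½) (pow₅>0 (0<* (0<* 0<κ 0<κ) (halfPower>0 t))))

    main-antimono : ∀ {s t} → s ℕ.≤ t → main t ≤ main s
    main-antimono {s} {t} h = *-monoˡ-≤ (<⇒≤ (pow₅>0 (0<* (positive⁻¹ ½) 0<κ))) (*-monoˡ-≤ 0≤½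
      (pow₅-mono (<⇒≤ (0<* (0<* 0<κ 0<κ) (halfPower>0 t))) (*-monoˡ-≤ (<⇒≤ (0<* 0<κ 0<κ)) (halfPower-antimono h))))

    -- `W` is the coefficient of `ℓ` in the error of `triangle-counting`. The two truncations cost
    -- `main / 8` each and the cut errors `main / 4`.
    K K′ W ℓ : ℕ → ℚ
    K t = 64ℚ * inv (main t)
    K′ t = 64ℚ * (inv (main t) * K t)
    W t = 8ℚ + 8ℚ * K t + 4ℚ * (K t * K′ t)
    ℓ t = ½ * ½ * main t * inv (W t)

    K>0 : ∀ t → 0ℚ < K t
    K>0 t = 0<* (positive⁻¹ 64ℚ) (inv>0 (main>0 t))

    K′>0 : ∀ t → 0ℚ < K′ t
    K′>0 t = 0<* (positive⁻¹ 64ℚ) (0<* (inv>0 (main>0 t)) (K>0 t))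

    W>0 : ∀ t → 0ℚ < W t
    W>0 t = 0<+ (0<+ (positive⁻¹ 8ℚ) (0≤* (nonNegative⁻¹ 8ℚ) (<⇒≤ (K>0 t)))) (0≤* (nonNegative⁻¹ 4ℚ)
        (0≤* (<⇒≤ (K>0 t)) (<⇒≤ (K′>0 t))))

    ℓ>0 : ∀ t → 0ℚ < ℓ t
    ℓ>0 t = 0<* (0<* (positive⁻¹ (½ * ½)) (main>0 t)) (inv>0 (W>0 t))

    -- K, K′ and ℓ are chosen to make the total error of the counting lemma half of the main term.
    error≡ : ∀ t → 1ℚ * (1ℚ * ((4ℚ * ℓ t + 4ℚ * ℓ t) + inv (K t) * 8ℚ)) + 1ℚ * (K t * ((4ℚ * ℓ t + 4ℚ * ℓ t) + inv
        (K′ t) * 8ℚ)) + K t * (K′ t * (4ℚ * ℓ t)) ≡ ½ * main t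
    error≡ t = trans (expand (ℓ t) (inv (K t)) (inv (K′ t)) (K t) (K′ t))
        (trans (cong₂ _+_ third (cong₂ _+_ first second)) (collect M))
      where
      M iM : ℚ
      M = main t
      iM = inv M
      expand : ∀ l i i′ k k′ → 1ℚ * (1ℚ * ((4ℚ * l + 4ℚ * l) + i * 8ℚ)) + 1ℚ * (k * ((4ℚ * l + 4ℚ * l) + i′ * 8ℚ)) +
          k * (k′ * (4ℚ * l))
        ≡ l * (8ℚ + 8ℚ * k + 4ℚ * (k * k′)) + (i * 8ℚ + k * (i′ * 8ℚ))
      expand = solve-∀ ℚ-ring
      M-iM : M * iM ≡ 1ℚ
      M-iM = *-inv (main>0 t)
      ½³ : ℚ
      ½³ = ½ * ½ * ½
      first : inv (K t) * 8ℚ ≡ ½³ * M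
      first = begin
        i * 8ℚ ≡⟨ sym (trans (cong (λ z → i * 8ℚ * z) M-iM) (*-identityʳ (i * 8ℚ))) ⟩
        i * 8ℚ * (M * iM) ≡⟨ regroup i M iM ⟩
        ½³ * M * (64ℚ * iM * i) ≡⟨ cong (½³ * M *_) (*-inv (K>0 t)) ⟩
        ½³ * M * 1ℚ ≡⟨ *-identityʳ (½³ * M) ⟩
        ½³ * M ∎
        where
        open ≡-Reasoning
        i : ℚ
        i = inv (K t)
        regroup : ∀ i m im → i * 8ℚ * (m * im) ≡ ½ * ½ * ½ * m * (64ℚ * im * i)
        regroup = solve-∀ ℚ-ring
      second : K t * (inv (K′ t) * 8ℚ) ≡ ½³ * M
      second = begin
        K t * (i * 8ℚ) ≡⟨ sym (trans (cong (λ z → K t * (i * 8ℚ) * z) M-iM) (*-identityʳ (K t * (i * 8ℚ)))) ⟩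
        K t * (i * 8ℚ) * (M * iM) ≡⟨ regroup (K t) i M iM ⟩
        ½³ * M * (64ℚ * (iM * K t) * i) ≡⟨ cong (½³ * M *_) (*-inv (K′>0 t)) ⟩
        ½³ * M * 1ℚ ≡⟨ *-identityʳ (½³ * M) ⟩
        ½³ * M ∎
        where
        open ≡-Reasoning
        i : ℚ
        i = inv (K′ t)
        regroup : ∀ k i m im → k * (i * 8ℚ) * (m * im) ≡ ½ * ½ * ½ * m * (64ℚ * (im * k) * i)
        regroup = solve-∀ ℚ-ring
      third : ℓ t * W t ≡ ½ * ½ * M
      third = trans (regroup M (inv (W t)) (W t)) (trans (cong (½ * ½ * M *_) (*-inv (W>0 t)))
          (*-identityʳ (½ * ½ * M)))
        where
        regroup : ∀ m i w → ½ * ½ * m * i * w ≡ ½ * ½ * m * (w * i)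
        regroup = solve-∀ ℚ-ring
      collect : ∀ m → ½ * ½ * m + (½ * ½ * ½ * m + ½ * ½ * ½ * m) ≡ ½ * m
      collect = solve-∀ ℚ-ring

    ε : ℚ
    ε = κ * κ * (κ * κ) * (+ 1 / 160)

    ε>0 : 0ℚ < ε
    ε>0 = 0<* (0<* (0<* 0<κ 0<κ) (0<* 0<κ 0<κ)) (positive⁻¹ (+ 1 / 160))

    160ε : 160ℚ * ε ≡ κ * κ * (κ * κ)
    160ε = identity (κ * κ * (κ * κ))
      where
      identity : ∀ k → 160ℚ * (k * (+ 1 / 160)) ≡ k
      identity = solve-∀ ℚ-ring

    rounds : ℕ
    rounds = proj₁ (archimedes energyCap ε>0)

    -- The number of bits of the fake vertices has to be fixed before the iteration starts; the
    -- tower bounds the cuts of all rounds together.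
    T : ℕ
    T = tower ℓ>0 rounds 0

    -- The level reached depends on the graphs. As `main` decreases, its value at `T` serves for
    -- every level; one half is lost to the counting error.
    c : ℚ
    c = ½ * main T

    c>0 : 0ℚ < c
    c>0 = 0<* (positive⁻¹ ½) (main>0 T)

    minClass : ℚ
    minClass = κ * κ * halfPower T

    minClass>0 : 0ℚ < minClass
    minClass>0 = 0<* (0<* 0<κ 0<κ) (halfPower>0 T)

  module _ {κ : ℚ} (0<κ : 0ℚ < κ) (κ≤1 : κ ≤ 1ℚ) {N : ℕ} (ν : Measure (Fin N)) (ν-1 : ∫ ν (λ _ → 1ℚ) ≡ 1ℚ) where

    open Constants 0<κ
    open CutDistance ν ν-1

    private
      0<τ : 0ℚ < κ * κ
      0<τ = 0<* 0<κ 0<κ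

      τ≤1 : κ * κ ≤ 1ℚ
      τ≤1 = *-mono-≤ {q = 1ℚ} {s = 1ℚ} (<⇒≤ 0<κ) (<⇒≤ 0<κ) κ≤1 κ≤1

      open Cuts ν ν-1 T (κ * κ) 0<τ τ≤1

    -- `k` stands for the averaging kernel of a partition, restricted to real vertices: its rows
    -- have mass at most 1, and fake mass bounds it by the inverse of `minClass`. Quantifying over
    -- all such kernels frees the condition from the partition.
    FewFourCycles : (V → V → ℚ) → Set
    FewFourCycles p = ∀ (k : V → V → ℚ) → (∀ u v → 0ℚ ≤ k u v) → (∀ u v → k u v ≤ inv minClass) → (∀ u → ∫ ν (k u) ≤
        1ℚ) →
      ∫ ν (λ u → ∫ ν (λ v → k u v * ∫ ν (λ w → p w u * p w v))) ≤ 2ℚ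

    energy-bound : ∀ {p : V → V → ℚ} → FewFourCycles p → ∀ P h → Partition.energy (partition P h) (lift p) ≤ 2ℚ
    energy-bound {p} few P h = ≤-trans (energy≤ (lift p)) (≤-trans (≤-reflexive reals) (few k (λ u v → K≥0 (inj₁ u)
        (inj₁ v)) k≤
        (λ u → subst (∫ ν (k u) ≤_) (∫K (inj₁ u)) (∫-μ-≥ (λ y → K≥0 (inj₁ u) y)))))
      where
      open Partition (partition P h) using (K≥0; energy≤; ∫K; weight) renaming (K to kernel)
      k : V → V → ℚ
      k u v = kernel (inj₁ u) (inj₁ v)
      minClass≤ : ∀ x → minClass ≤ weight x
      minClass≤ x = ≤-trans (*-monoˡ-≤ (<⇒≤ 0<τ) (halfPower-antimono h))
        (subst₂ _≤_ (+-identityˡ (fakeMass P)) (sym (class-mass P h x)) (+-monoˡ-≤ (fakeMass P) (realMass≥0 P x)))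
      k≤ : ∀ u v → k u v ≤ inv minClass
      k≤ u v = ≤-trans (subst (k u v ≤_) (*-identityˡ _) (*-monoʳ-≤ (inv≥0 (Partition.weight>0 (partition P h)
          (inj₁ u))) (𝟙≤1 (sameSides P (inj₁ u) (inj₁ v)))))
        (inv-antimono minClass>0 (minClass≤ (inj₁ u)))
      zeroˡ : ∀ k a → k * (0ℚ * a) ≡ 0ℚ
      zeroˡ = solve-∀ ℚ-ring
      zeroʳ : ∀ k a → k * (a * 0ℚ) ≡ 0ℚ
      zeroʳ = solve-∀ ℚ-ring
      F : A → A → A → ℚ
      F x y y′ = kernel y y′ * (lift p x y * lift p x y′)
      reals : ∫ μ (λ x → ∫ μ (λ y → ∫ μ (F x y))) ≡ ∫ ν (λ u → ∫ ν (λ v → k u v * ∫ ν (λ w → p w u * p w v)))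
      reals = begin
        ∫ μ (λ x → ∫ μ (λ y → ∫ μ (F x y)))
          ≡⟨ ∫-μ-real (λ x → ∫ μ (λ y → ∫ μ (F x y))) (λ b → trans (∫∫-cong (λ y y′ → zeroˡ (kernel y y′) 0ℚ))
              (trans (∫-cong (λ y → ∫-0)) ∫-0)) ⟩
        ∫ ν (λ w → ∫ μ (λ y → ∫ μ (F (inj₁ w) y)))
          ≡⟨ ∫-cong (λ w → ∫-μ-real (λ y → ∫ μ (F (inj₁ w) y)) (λ b → trans
              (∫-cong (λ y′ → zeroˡ (kernel (inj₂ b) y′) (lift p (inj₁ w) y′))) ∫-0)) ⟩
        ∫ ν (λ w → ∫ ν (λ u → ∫ μ (F (inj₁ w) (inj₁ u))))
          ≡⟨ ∫∫-cong (λ w u → ∫-μ-real (F (inj₁ w) (inj₁ u)) (λ b → zeroʳ (kernel (inj₁ u) (inj₂ b)) (p w u))) ⟩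
        ∫ ν (λ w → ∫ ν (λ u → ∫ ν (λ v → k u v * (p w u * p w v)))) ≡⟨ ∫-swap _ ⟩
        ∫ ν (λ u → ∫ ν (λ w → ∫ ν (λ v → k u v * (p w u * p w v)))) ≡⟨ ∫-cong (λ u → ∫-swap _) ⟩
        ∫ ν (λ u → ∫ ν (λ v → ∫ ν (λ w → k u v * (p w u * p w v)))) ≡⟨ ∫∫-cong (λ u v → ∫-*ˡ (k u v) _) ⟩
        ∫ ν (λ u → ∫ ν (λ v → k u v * ∫ ν (λ w → p w u * p w v))) ∎
        where open ≡-Reasoning

    -- One cycle of good coarse edges already yields `main t` in the model; the counting error is
    -- half of that, so the weighted graph itself keeps a constant amount.
    sparse-removal : ∀ (p : Fin 5 → V → V → ℚ) → (∀ i u v → 0ℚ ≤ p i u v) → (∀ i → FewFourCycles (p i)) →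
      ∫ ν (λ x → ∫ ν (λ y → (p 0F ∘ᵏ p 1F) x y * (p 0F ∘ᵏ p 1F) x y)) ≤ 8ℚ →
      ∫ ν (λ x → ∫ ν (λ y → (p 2F ∘ᵏ p 3F) x y * (p 2F ∘ᵏ p 3F) x y)) ≤ 8ℚ →
      Σ (Fin 5 → V → V → Bool) λ bad → (∀ i → ∫ ν (λ u → ∫ ν (λ v → p i u v * 𝟙 (bad i u v))) ≤ 15ℚ * κ) ×
        (∀ v₁ v₂ v₃ v₄ v₅ → bad 0F v₁ v₂ ≡ false → bad 1F v₂ v₃ ≡ false → bad 2F v₃ v₄ ≡ false → bad 3F v₄ v₅ ≡
            false → bad 4F v₅ v₁ ≡ false →
          c ≤ triangles (p 0F ∘ᵏ p 1F) (p 2F ∘ᵏ p 3F) (p 4F))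
    sparse-removal p p≥0 few L² L²′ = (λ i u v → bad i (inj₁ u) (inj₁ v)) , bad-few , λ v₁ v₂ v₃ v₄ v₅ g₁ g₂ g₃ g₄ g₅ →
        enough (good-cycle (good 0F _ _ g₁) (good 1F _ _ g₂) (good 2F _ _ g₃) (good 3F _ _ g₄) (good 4F _ _ g₅))
      where
      open Clean ν ν-1 T κ 0<κ κ≤1 0<τ τ≤1 p (λ P h i → energy-bound (few i) P h) p≥0 using (Levels; levels; totalEnergy; totalEnergy≥0; module OfLevels)
      start : energyCap < totalEnergy [] ℕ.z≤n + ♯ rounds * ε
      start = <-≤-trans (proj₂ (archimedes energyCap ε>0)) (subst (_≤ totalEnergy [] ℕ.z≤n + ♯ rounds * ε)
          (+-identityˡ (♯ rounds * ε))
        (+-monoˡ-≤ (♯ rounds * ε) (totalEnergy≥0 [] ℕ.z≤n)))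
      L : Levels ℓ ε
      L = levels ℓ>0 ε rounds 0 [] ℕ.z≤n ℕ.z≤n ℕ.≤-refl start
      open Levels L using (t; t≤T)
      open OfLevels L 160ε
      enough : main t ≤ triangles (q 0F ∘ᵏ q 1F) (q 2F ∘ᵏ q 3F) (q 4F) → c ≤ triangles (p 0F ∘ᵏ p 1F) (p 2F ∘ᵏ p 3F)
          (p 4F)
      enough h = begin
        ½ * main T ≤⟨ *-monoˡ-≤ 0≤½ (main-antimono t≤T) ⟩
        ½ * main t ≡⟨ half (main t) ⟩
        main t - ½ * main t ≤⟨ +-monoˡ-≤ (- (½ * main t)) h ⟩
        triangles (q 0F ∘ᵏ q 1F) (q 2F ∘ᵏ q 3F) (q 4F) - ½ * main t
          ≡⟨ cong (λ e → triangles (q 0F ∘ᵏ q 1F) (q 2F ∘ᵏ q 3F) (q 4F) - e) (sym (error≡ t)) ⟩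
        _ ≤⟨ triangle-counting (compose (model 0F) (model 1F)) (compose (model 2F) (model 3F)) (model 4F) L² L²′
            (K>0 t) (K′>0 t) ⟩
        triangles (p 0F ∘ᵏ p 1F) (p 2F ∘ᵏ p 3F) (p 4F) ∎
        where
        open ≤-Reasoning
        half : ∀ m → ½ * m ≡ m - ½ * m
        half = solve-∀ ℚ-ring

  -- Codegrees and four-cycles

  3ℚ 5ℚ 6ℚ : ℚ
  3ℚ = 2ℚ + 1ℚ
  5ℚ = 4ℚ + 1ℚ
  6ℚ = 3ℚ + 3ℚ

  vertices : ∀ N → Measure (Fin N)
  vertices N = counting (allFin N)

  ∫-vertices-1 : ∀ N → ∫ (vertices N) (λ _ → 1ℚ) ≡ ♯ N
  ∫-vertices-1 ℕ.zero = ∫-[] _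
  ∫-vertices-1 (suc N) = trans (∫-allFin-suc N _) (trans (cong (λ ζ → 1ℚ + ζ) (∫-vertices-1 N)) (sym (♯-suc N)))

  ∫∫-swap : ∀ {A B : Set} {μ : Measure A} {ν : Measure B} (G : A → A → B → B → ℚ) →
    ∫ μ (λ u → ∫ μ (λ v → ∫ ν (λ w → ∫ ν (λ w′ → G u v w w′)))) ≡
        ∫ ν (λ w → ∫ ν (λ w′ → ∫ μ (λ u → ∫ μ (λ v → G u v w w′))))
  ∫∫-swap G = trans (∫-cong (λ u → trans (∫-swap _) (∫-cong (λ w → ∫-swap _)))) (trans (∫-swap _)
      (∫-cong (λ w → ∫-swap _)))

  module Codegrees (N : ℕ) where

    V : Set
    V = Fin N

    #V : Measure V
    #V = vertices N

    δ : V → V → ℚ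
    δ u v = 𝟙 (does (u ≟ᶠ v))

    δ≤1 : ∀ u v → 0ℚ ≤ 1ℚ - δ u v
    δ≤1 u v = gap (𝟙≤1 (does (u ≟ᶠ v)))

    codegree : (V → V → ℚ) → V → V → ℚ
    codegree e u v = ∫ #V (λ w → e w u * e w v)

    transpose : (V → V → ℚ) → V → V → ℚ
    transpose e u v = e v u

    fourCycles : (V → V → ℚ) → ℚ
    fourCycles e = ∫ #V (λ u → ∫ #V (λ v → ∫ #V (λ w → ∫ #V (λ w′ → (1ℚ - δ u v) * ((1ℚ - δ w w′) * (e w u * e w v *
        (e w′ u * e w′ v)))))))

    fourCycles-transpose : ∀ e → fourCycles (transpose e) ≡ fourCycles e
    fourCycles-transpose e = trans (∫∫-swap _) (∫∫-cong (λ w w′ → ∫∫-cong (λ u v → regroup (1ℚ - δ u v)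
        (1ℚ - δ w w′) (e u w) (e v w) (e u w′) (e v w′))))
      where
      regroup : ∀ a b p q r s → a * (b * (p * q * (r * s))) ≡ b * (a * (p * r * (q * s)))
      regroup = solve-∀ ℚ-ring

    module ZeroOne (e : V → V → ℚ) (e≥0 : ∀ u v → 0ℚ ≤ e u v) (e-idem : ∀ u v → e u v * e u v ≡ e u v) where

      x : V → V → ℚ
      x = codegree e

      -- `x * x` counts ordered pairs of common neighbours and, the graph being 0-1 valued, its
      -- diagonal is `x`; what remains counts pairs of distinct ones.
      off-diagonal : V → V → ℚ
      off-diagonal u v = x u v * x u v - x u v

      off-diagonal≡ : ∀ u v → off-diagonal u v ≡ ∫ #V (λ w → ∫ #V (λ w′ → (1ℚ - δ w w′) * (e w u * e w v *
          (e w′ u * e w′ v))))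
      off-diagonal≡ u v = sym (begin
        ∫ #V (λ w → ∫ #V (λ w′ → (1ℚ - δ w w′) * (a w * a w′))) ≡⟨ ∫∫-cong (λ w w′ → distribute (δ w w′) (a w * a w′)) ⟩
        ∫ #V (λ w → ∫ #V (λ w′ → a w * a w′ - δ w w′ * (a w * a w′))) ≡⟨ ∫∫-- _ _ ⟩
        ∫ #V (λ w → ∫ #V (λ w′ → a w * a w′)) - ∫ #V (λ w → ∫ #V (λ w′ → δ w w′ * (a w * a w′)))
          ≡⟨ cong₂ _-_ (sym (∫-*-∫ a a)) (∫-cong (λ w → trans (∫-δ w (λ w′ → a w * a w′)) (idem w))) ⟩
        off-diagonal u v ∎)
        where
        open ≡-Reasoning
        a : V → ℚ
        a w = e w u * e w v
        distribute : ∀ d p → (1ℚ - d) * p ≡ p - d * p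
        distribute = solve-∀ ℚ-ring
        regroup : ∀ p q → p * q * (p * q) ≡ p * p * (q * q)
        regroup = solve-∀ ℚ-ring
        idem : ∀ w → a w * a w ≡ a w
        idem w = trans (regroup (e w u) (e w v)) (cong₂ _*_ (e-idem w u) (e-idem w v))

      off-diagonal≥0 : ∀ u v → 0ℚ ≤ off-diagonal u v
      off-diagonal≥0 u v = subst (0ℚ ≤_) (sym (off-diagonal≡ u v)) (∫∫-≥0 (λ w w′ → 0≤* (δ≤1 w w′)
          (0≤* (0≤* (e≥0 w u) (e≥0 w v)) (0≤* (e≥0 w′ u) (e≥0 w′ v)))))

      nd : ℚ
      nd = ∫ #V (λ u → ∫ #V (λ v → (1ℚ - δ u v) * off-diagonal u v))

      nd≡ : nd ≡ fourCycles e
      nd≡ = ∫∫-cong (λ u v → trans (cong ((1ℚ - δ u v) *_) (off-diagonal≡ u v)) (trans (sym (∫-*ˡ (1ℚ - δ u v) _))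
          (∫-cong (λ w → sym (∫-*ˡ (1ℚ - δ u v) _)))))

      edges : ℚ
      edges = ∫ #V (λ u → ∫ #V (λ w → e w u))

      degreeSquares : ℚ
      degreeSquares = ∫ #V (λ u → x u u * x u u)

      x≥0 : ∀ u v → 0ℚ ≤ x u v
      x≥0 u v = ∫-≥0 (λ w → 0≤* (e≥0 w u) (e≥0 w v))

      degree≡ : ∀ u → x u u ≡ ∫ #V (λ w → e w u)
      degree≡ u = ∫-cong (λ w → e-idem w u)

      δ-or : ∀ u v → (δ u v ≡ 1ℚ) ⊎ (δ u v ≡ 0ℚ)
      δ-or u v with does (u ≟ᶠ v)
      ... | true = inj₁ refl
      ... | false = inj₂ refl

      -- Off the diagonal this is `(x - 1)² ≥ 0`: codegrees above 1 are charged to four-cycles. On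
      -- the diagonal the degree itself is added.
      codegree≤ : ∀ u v → x u v ≤ 1ℚ + ((1ℚ - δ u v) * off-diagonal u v + δ u v * x u v)
      codegree≤ u v = by-δ (δ-or u v)
        where
        equal : ∀ z → 1ℚ + ((1ℚ - 1ℚ) * (z * z - z) + 1ℚ * z) ≡ z + 1ℚ
        equal = solve-∀ ℚ-ring
        unequal : ∀ z → 1ℚ + ((1ℚ - 0ℚ) * (z * z - z) + 0ℚ * z) ≡ z + (z - 1ℚ) * (z - 1ℚ)
        unequal = solve-∀ ℚ-ring
        by-δ : (δ u v ≡ 1ℚ) ⊎ (δ u v ≡ 0ℚ) → x u v ≤ 1ℚ + ((1ℚ - δ u v) * off-diagonal u v + δ u v * x u v)
        by-δ (inj₁ d) rewrite d = ≤-by 1ℚ (equal (x u v)) 0≤1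
        by-δ (inj₂ d) rewrite d = ≤-by _ (unequal (x u v)) (0≤sq (x u v - 1ℚ))

      square≤ : ∀ u v → x u v * x u v ≤ 1ℚ + (2ℚ * ((1ℚ - δ u v) * off-diagonal u v) + δ u v * (x u v * x u v))
      square≤ u v = by-δ (δ-or u v)
        where
        equal : ∀ z → 1ℚ + (2ℚ * ((1ℚ - 1ℚ) * (z * z - z)) + 1ℚ * (z * z)) ≡ z * z + 1ℚ
        equal = solve-∀ ℚ-ring
        unequal : ∀ z → 1ℚ + (2ℚ * ((1ℚ - 0ℚ) * (z * z - z)) + 0ℚ * (z * z)) ≡ z * z + (z - 1ℚ) * (z - 1ℚ)
        unequal = solve-∀ ℚ-ring
        by-δ : (δ u v ≡ 1ℚ) ⊎ (δ u v ≡ 0ℚ) → x u v * x u v ≤ 1ℚ + (2ℚ * ((1ℚ - δ u v) * off-diagonal u v) + δ u v *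
            (x u v * x u v))
        by-δ (inj₁ d) rewrite d = ≤-by 1ℚ (equal (x u v)) 0≤1
        by-δ (inj₂ d) rewrite d = ≤-by _ (unequal (x u v)) (0≤sq (x u v - 1ℚ))

      ∫∫-1 : ∫ #V (λ u → ∫ #V (λ v → 1ℚ)) ≡ ♯ N * ♯ N
      ∫∫-1 = trans (∫-cong (λ u → ∫-vertices-1 N)) (trans (∫-const (♯ N)) (cong (♯ N *_) (∫-vertices-1 N)))

      diagonal : ∀ (f : V → V → ℚ) → ∫ #V (λ u → ∫ #V (λ v → δ u v * f u v)) ≡ ∫ #V (λ u → f u u)
      diagonal f = ∫-cong (λ u → ∫-δ u (f u))

      ∫∫-codegree≤ : ∫ #V (λ u → ∫ #V (λ v → x u v)) ≤ ♯ N * ♯ N + (nd + edges)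
      ∫∫-codegree≤ = ≤-trans (∫∫-mono codegree≤) (≤-reflexive (trans (∫∫-+ _ _) (cong₂ _+_ ∫∫-1 (trans (∫∫-+ _ _)
          (cong (λ ζ → nd + ζ) (trans (diagonal x) (∫-cong degree≡)))))))

      ∫∫-square≤ : ∫ #V (λ u → ∫ #V (λ v → x u v * x u v)) ≤ ♯ N * ♯ N + (2ℚ * nd + degreeSquares)
      ∫∫-square≤ = ≤-trans (∫∫-mono square≤) (≤-reflexive (trans (∫∫-+ _ _) (cong₂ _+_ ∫∫-1 (trans (∫∫-+ _ _)
          (cong₂ _+_ (∫∫-*ˡ 2ℚ _) (diagonal (λ u v → x u v * x u v)))))))

      edges≤ : ∀ S → (S + S) * edges ≤ degreeSquares + S * S * ♯ N
      edges≤ S = begin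
        (S + S) * edges ≡⟨ sym (∫-*ˡ (S + S) _) ⟩
        ∫ #V (λ u → (S + S) * ∫ #V (λ w → e w u)) ≤⟨ ∫-mono (λ u → ≤-by _ (certificate S (x u u)
            (∫ #V (λ w → e w u)) (degree≡ u)) (0≤sq (x u u - S))) ⟩
        ∫ #V (λ u → x u u * x u u + S * S) ≡⟨ trans (∫-+ _ _) (cong (λ ζ → degreeSquares + ζ)
            (trans (∫-const (S * S)) (cong (S * S *_) (∫-vertices-1 N)))) ⟩
        degreeSquares + S * S * ♯ N ∎
        where
        open ≤-Reasoning
        identity : ∀ S d → d * d + S * S ≡ (S + S) * d + (d - S) * (d - S)
        identity = solve-∀ ℚ-ring
        certificate : ∀ S d d′ → d ≡ d′ → d * d + S * S ≡ (S + S) * d′ + (d - S) * (d - S)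
        certificate S d _ refl = identity S d

    open ZeroOne

    -- Two neighbours `w`, `w′` of `u` have `u` as a common neighbour in the transposed graph.
    degreeSquares≡ : ∀ (e : V → V → ℚ) e≥0 e-idem → degreeSquares e e≥0 e-idem ≡
        ∫ #V (λ w → ∫ #V (λ w′ → codegree (transpose e) w w′))
    degreeSquares≡ e e≥0 e-idem = trans (∫-cong (λ u → trans (cong₂ _*_ (degree≡ e e≥0 e-idem u) (degree≡ e e≥0
        e-idem u)) (∫-*-∫ _ _)))
      (trans (∫-swap _) (∫-cong (λ w → ∫-swap _)))

    -- A pair of two-step paths from `x` to `z` through `y` and `y′` splits into a common neighbour
    -- `x` and a common neighbour `z` of `y` and `y′`.
    path-squares : ∀ (e e′ : V → V → ℚ) → ∫ #V (λ x → ∫ #V (λ z → ∫ #V (λ y → e x y * e′ y z) * ∫ #V (λ y →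
        e x y * e′ y z))) ≡
      ∫ #V (λ y → ∫ #V (λ y′ → codegree e y y′ * codegree (transpose e′) y y′))
    path-squares e e′ = trans (∫∫-cong (λ x z → ∫-*-∫ _ _)) (trans (∫∫-swap _) (∫∫-cong (λ y y′ →
        trans (∫∫-cong (λ x z → regroup (e x y) (e′ y z) (e x y′) (e′ y′ z))) (sym (∫-*-∫ (λ x → e x y * e x y′)
            (λ z → e′ y z * e′ y′ z))))))
      where
      regroup : ∀ a b c d → a * b * (c * d) ≡ (a * c) * (b * d)
      regroup = solve-∀ ℚ-ring

    record FewCycles (m : ℚ) (e : V → V → ℚ) : Set where
      field
        e≥0 : ∀ u v → 0ℚ ≤ e u v
        e-idem : ∀ u v → e u v * e u v ≡ e u v
        few : fourCycles e ≤ ½ * m * (♯ N * ♯ N)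

    open FewCycles

    few-transpose : ∀ {m e} → FewCycles m e → FewCycles m (transpose e)
    few-transpose {m} {e} F = record { e≥0 = λ u v → e≥0 F v u ; e-idem = λ u v → e-idem F v u ; few =
        ≤-trans (≤-reflexive (fourCycles-transpose e)) (few F) }

    module Normalised (S m : ℚ) (0<m : 0ℚ < m) (m≤1 : m ≤ 1ℚ) (S≥0 : 0ℚ ≤ S) (S² : S * S ≡ ♯ N) (6≤Sm : 6ℚ ≤ S * m) where

      n : ℚ
      n = ♯ N

      6≤S : 6ℚ ≤ S
      6≤S = ≤-trans 6≤Sm (subst (S * m ≤_) (*-identityʳ S) (*-monoˡ-≤ S≥0 m≤1))

      0<S : 0ℚ < S
      0<S = <-≤-trans (positive⁻¹ 6ℚ) 6≤S

      0<n : 0ℚ < n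
      0<n = subst (0ℚ <_) S² (0<* 0<S 0<S)

      1≤n : 1ℚ ≤ n
      1≤n = subst (1ℚ ≤_) S² (*-mono-≤ {p = 1ℚ} {r = 1ℚ} 0≤1 0≤1 1≤S 1≤S)
        where
        1≤S : 1ℚ ≤ S
        1≤S = ≤-trans (≤-by 5ℚ refl (nonNegative⁻¹ 5ℚ)) 6≤S

      n≤n² : n ≤ n * n
      n≤n² = subst (_≤ n * n) (*-identityʳ n) (*-monoˡ-≤ (<⇒≤ 0<n) 1≤n)

      module Bounds {e : V → V → ℚ} (F : FewCycles m e) where

        nd≤ : ∀ {e} (F : FewCycles m e) → nd e (e≥0 F) (e-idem F) ≤ ½ * m * (n * n)
        nd≤ F = ≤-trans (≤-reflexive (nd≡ _ (e≥0 F) (e-idem F))) (few F)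

        n²≥0 : 0ℚ ≤ n * n
        n²≥0 = 0≤sq n

        D E : ℚ
        D = degreeSquares e (e≥0 F) (e-idem F)
        E = edges e (e≥0 F) (e-idem F)

        -- A bootstrap: `D` is a sum of codegrees, hence at most n² plus the four-cycles plus `E`,
        -- while `2 E ≤ D + n`. Eliminating `E` bounds `D` by itself with coefficient one half.
        D≤ : D ≤ 4ℚ * (n * n)
        D≤ = ≤-by _ (certificate D E n m (nd (transpose e) (e≥0 F′) (e-idem F′)))
          (0≤+ (0≤+ (0≤+ (0≤* 0≤2 (gap first)) (gap second)) (0≤+ (gap n≤n²) (0≤* 0≤2 (gap (nd≤ F′)))))
              (0≤* (gap m≤1) n²≥0))
          where
          F′ : FewCycles m (transpose e)
          F′ = few-transpose F
          first : D ≤ n * n + (nd (transpose e) (e≥0 F′) (e-idem F′) + E)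
          first = subst₂ _≤_ (sym (degreeSquares≡ e (e≥0 F) (e-idem F)))
              (cong (λ z → n * n + (nd (transpose e) (e≥0 F′) (e-idem F′) + z)) (∫-swap _))
            (∫∫-codegree≤ (transpose e) (e≥0 F′) (e-idem F′))
          second : (1ℚ + 1ℚ) * E ≤ D + 1ℚ * 1ℚ * n
          second = edges≤ e (e≥0 F) (e-idem F) 1ℚ
          certificate : ∀ D E n m k → 4ℚ * (n * n) ≡ D + (2ℚ * (n * n + (k + E) - D) + (D + 1ℚ * 1ℚ * n - (1ℚ + 1ℚ)
              * E) + (n * n - n + 2ℚ * (½ * m * (n * n) - k)) + (1ℚ - m) * (n * n))
          certificate = solve-∀ ℚ-ring

        codegree-squares≤ : ∫ #V (λ u → ∫ #V (λ v → codegree e u v * codegree e u v)) ≤ 8ℚ * (n * n)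
        codegree-squares≤ = ≤-trans (∫∫-square≤ e (e≥0 F) (e-idem F))
            (≤-by _ (certificate D n m (nd e (e≥0 F) (e-idem F)))
            (0≤+ (0≤+ (0≤* 0≤2 (gap (nd≤ F))) (gap D≤)) (0≤+ (0≤* (gap m≤1) n²≥0) (0≤* 0≤2 n²≥0))))
          where
          certificate : ∀ D n m k → 8ℚ * (n * n) ≡ n * n + (2ℚ * k + D) + (2ℚ * (½ * m * (n * n) - k) +
              (4ℚ * (n * n) - D) + ((1ℚ - m) * (n * n) + 2ℚ * (n * n)))
          certificate = solve-∀ ℚ-ring

        -- With the optimal weight, `2 S E` is at most `D + S² n`, hence at most 5 n², which
        -- `6 ≤ S m` turns into the claim.
        E≤ : E ≤ ½ * m * (n * n)
        E≤ = *-cancelˡ-≤ (0<+ 0<S S≥0) (≤-by _ (trans (scale-up S m n) (certificate E S D n (S * m) S²))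
            (0≤+ (0≤+ (gap (edges≤ e (e≥0 F) (e-idem F) S)) (gap D≤)) (0≤+ (0≤* (gap 6≤Sm) n²≥0) n²≥0)))
          where
          scale-up : ∀ S m n → (S + S) * (½ * m * (n * n)) ≡ S * m * (n * n)
          scale-up = solve-∀ ℚ-ring
          identity : ∀ E S D n k → k * (n * n) ≡ (S + S) * E + (D + n * n - (S + S) * E + (4ℚ * (n * n) - D) +
              ((k - 6ℚ) * (n * n) + n * n))
          identity = solve-∀ ℚ-ring
          certificate : ∀ E S D n k → S * S ≡ n → k * (n * n) ≡ (S + S) * E + (D + S * S * n - (S + S) * E +
              (4ℚ * (n * n) - D) + ((k - 6ℚ) * (n * n) + n * n))
          certificate E S D n k refl = identity E S D (S * S) k

      iN : ℚ
      iN = inv n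

      n-iN : n * iN ≡ 1ℚ
      n-iN = *-inv 0<n

      ν : Measure V
      ν = scale iN (inv≥0 0<n) #V

      ν-1 : ∫ ν (λ _ → 1ℚ) ≡ 1ℚ
      ν-1 = trans (∫-scale _) (trans (cong (iN *_) (∫-vertices-1 N)) (trans (*-comm iN n) n-iN))

      ∫∫-ν : ∀ (f : V → V → ℚ) → ∫ ν (λ u → ∫ ν (f u)) ≡ iN * iN * ∫ #V (λ u → ∫ #V (f u))
      ∫∫-ν f = trans (∫-scale _) (trans (cong (iN *_) (trans (∫-cong (λ u → ∫-scale (f u))) (∫-*ˡ iN _)))
          (sym (*-assoc iN iN _)))

      iN²-≤ : ∀ {a c} → a ≤ c * (n * n) → iN * iN * a ≤ c
      iN²-≤ {a} {c} h = ≤-trans (*-monoˡ-≤ (0≤sq iN) h) (≤-reflexive (trans (regroup iN c n)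
          (trans (cong₂ (λ z z′ → c * (z * z′)) n-iN n-iN) (*-identityʳ c))))
        where
        regroup : ∀ i c n → i * i * (c * (n * n)) ≡ c * ((n * i) * (n * i))
        regroup = solve-∀ ℚ-ring

      rescale : ∀ (a b : V → ℚ) → ∫ ν (λ w → (S * a w) * (S * b w)) ≡ ∫ #V (λ w → a w * b w)
      rescale a b = trans (∫-scale _) (trans (cong (iN *_) (trans (∫-cong (λ w → regroup S (a w) (b w)))
          (∫-*ˡ (S * S) _)))
          (trans (cong (λ z → iN * (z * ∫ #V (λ w → a w * b w))) S²) (trans (regroup′ iN n _)
              (trans (cong (_* ∫ #V (λ w → a w * b w)) n-iN) (*-identityˡ _)))))
        where
        regroup : ∀ s a b → (s * a) * (s * b) ≡ s * s * (a * b)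
        regroup = solve-∀ ℚ-ring
        regroup′ : ∀ i n z → i * (n * z) ≡ n * i * z
        regroup′ = solve-∀ ℚ-ring

      -- The 1 in `codegree≤` integrates to at most 1 against `k`. The extra terms have normalised
      -- total at most `m`, from four-cycles and edges in equal parts, and `k` is at most `inv m`,
      -- which gives another 1.
      few-four-cycles : ∀ {e} → FewCycles m e → ∀ (k : V → V → ℚ) → (∀ u v → 0ℚ ≤ k u v) → (∀ u v → k u v ≤ inv m) →
          (∀ u → ∫ ν (k u) ≤ 1ℚ) →
        ∫ ν (λ u → ∫ ν (λ v → k u v * ∫ ν (λ w → (S * e w u) * (S * e w v)))) ≤ 2ℚ
      few-four-cycles {e} F k k≥0 k≤ ∫k≤1 = begin
        ∫ ν (λ u → ∫ ν (λ v → k u v * ∫ ν (λ w → (S * e w u) * (S * e w v)))) ≡⟨ ∫∫-cong (λ u v → cong (k u v *_)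
            (rescale (λ w → e w u) (λ w → e w v))) ⟩
        ∫ ν (λ u → ∫ ν (λ v → k u v * codegree e u v)) ≤⟨ ∫∫-mono pointwise ⟩
        ∫ ν (λ u → ∫ ν (λ v → k u v + inv m * extra u v)) ≡⟨ trans (∫∫-+ _ _) (cong (λ ζ → ∫ ν (λ u → ∫ ν (k u)) +
            ζ) (trans (∫∫-*ˡ (inv m) extra) (cong (inv m *_) (∫∫-ν extra)))) ⟩
        ∫ ν (λ u → ∫ ν (k u)) + inv m * (iN * iN * ∫ #V (λ u → ∫ #V (extra u)))
          ≤⟨ +-mono-≤ (CutDistance.∫≤ ν ν-1 ∫k≤1) (*-monoˡ-≤ (inv≥0 0<m) (iN²-≤ total)) ⟩
        1ℚ + inv m * m ≡⟨ cong (λ ζ → 1ℚ + ζ) (trans (*-comm (inv m) m) (*-inv 0<m)) ⟩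
        2ℚ ∎
        where
        open ≤-Reasoning
        extra : V → V → ℚ
        extra u v = (1ℚ - δ u v) * off-diagonal e (e≥0 F) (e-idem F) u v + δ u v * codegree e u v
        extra≥0 : ∀ u v → 0ℚ ≤ extra u v
        extra≥0 u v = 0≤+ (0≤* (δ≤1 u v) (off-diagonal≥0 e (e≥0 F) (e-idem F) u v)) (0≤* (𝟙≥0 (does (u ≟ᶠ v)))
            (x≥0 e (e≥0 F) (e-idem F) u v))
        certificate : ∀ k x b → k + b * x ≡ k * (1ℚ + x) + (b - k) * x
        certificate = solve-∀ ℚ-ring
        pointwise : ∀ u v → k u v * codegree e u v ≤ k u v + inv m * extra u v
        pointwise u v = ≤-trans (*-monoˡ-≤ (k≥0 u v) (codegree≤ e (e≥0 F) (e-idem F) u v))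
            (≤-by _ (certificate (k u v) (extra u v) (inv m)) (0≤* (gap (k≤ u v)) (extra≥0 u v)))
        halves : ∀ m n → ½ * m * (n * n) + ½ * m * (n * n) ≡ m * (n * n)
        halves = solve-∀ ℚ-ring
        total : ∫ #V (λ u → ∫ #V (extra u)) ≤ m * (n * n)
        total = subst₂ _≤_ (sym (trans (∫∫-+ _ _) (cong (λ ζ → nd e (e≥0 F) (e-idem F) + ζ)
            (trans (diagonal e (e≥0 F) (e-idem F) (codegree e)) (∫-cong (degree≡ e (e≥0 F) (e-idem F)))))))
          (halves m n) (+-mono-≤ (Bounds.nd≤ F F) (Bounds.E≤ F))

      open CutDistance ν ν-1

      -- The product of codegrees from `path-squares` is split by `2 X Y ≤ X² + Y²`, so each graph
      -- needs only its own second moment.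
      path-L² : ∀ {e e′} → FewCycles m e → FewCycles m e′ →
        ∫ ν (λ x → ∫ ν (λ z → ((λ u v → S * e u v) ∘ᵏ (λ u v → S * e′ u v)) x z * ((λ u v → S * e u v) ∘ᵏ (λ u v →
            S * e′ u v)) x z)) ≤ 8ℚ
      path-L² {e} {e′} F F′ = begin
        ∫ ν (λ x → ∫ ν (λ z → ((λ u v → S * e u v) ∘ᵏ (λ u v → S * e′ u v)) x z * ((λ u v → S * e u v) ∘ᵏ (λ u v →
            S * e′ u v)) x z))
          ≡⟨ ∫∫-cong (λ x z → cong₂ _*_ (rescale (e x) (λ y → e′ y z)) (rescale (e x) (λ y → e′ y z))) ⟩
        ∫ ν (λ x → ∫ ν (λ z → ∫ #V (λ y → e x y * e′ y z) * ∫ #V (λ y → e x y * e′ y z))) ≡⟨ ∫∫-ν _ ⟩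
        iN * iN * ∫ #V (λ x → ∫ #V (λ z → ∫ #V (λ y → e x y * e′ y z) * ∫ #V (λ y → e x y * e′ y z))) ≤⟨ iN²-≤
            (subst (_≤ 8ℚ * (n * n)) (sym (path-squares e e′)) total) ⟩
        8ℚ ∎
        where
        open ≤-Reasoning
        X Y : V → V → ℚ
        X = codegree e
        Y = codegree (transpose e′)
        total : ∫ #V (λ y → ∫ #V (λ y′ → X y y′ * Y y y′)) ≤ 8ℚ * (n * n)
        total = *-cancelˡ-≤ {2ℚ} (positive⁻¹ 2ℚ) (begin
          2ℚ * ∫ #V (λ y → ∫ #V (λ y′ → X y y′ * Y y y′)) ≡⟨ double (∫ #V (λ y → ∫ #V (λ y′ → X y y′ * Y y y′))) ⟩
          ∫ #V (λ y → ∫ #V (λ y′ → X y y′ * Y y y′)) + ∫ #V (λ y → ∫ #V (λ y′ → X y y′ * Y y y′)) ≡⟨ sym (∫∫-+ _ _) ⟩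
          ∫ #V (λ y → ∫ #V (λ y′ → X y y′ * Y y y′ + X y y′ * Y y y′)) ≤⟨ ∫∫-mono (λ y y′ → ≤-by-sq (X y y′) (Y y y′)) ⟩
          ∫ #V (λ y → ∫ #V (λ y′ → X y y′ * X y y′ + Y y y′ * Y y y′)) ≡⟨ ∫∫-+ _ _ ⟩
          ∫ #V (λ y → ∫ #V (λ y′ → X y y′ * X y y′)) + ∫ #V (λ y → ∫ #V (λ y′ → Y y y′ * Y y y′))
            ≤⟨ +-mono-≤ (Bounds.codegree-squares≤ F) (Bounds.codegree-squares≤ (few-transpose F′)) ⟩
          8ℚ * (n * n) + 8ℚ * (n * n) ≡⟨ sym (double (8ℚ * (n * n))) ⟩
          2ℚ * (8ℚ * (n * n)) ∎)
          where
          double : ∀ z → 2ℚ * z ≡ z + z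
          double = solve-∀ ℚ-ring

  -- Indicators and sums over tuples

  ⟦_⟧ : {P : Set} → Dec P → ℚ
  ⟦ d ⟧ = 𝟙 (does d)

  ⟦⟧≥0 : {P : Set} (d : Dec P) → 0ℚ ≤ ⟦ d ⟧
  ⟦⟧≥0 d = 𝟙≥0 (does d)

  ⟦⟧-yes : {P : Set} (d : Dec P) → P → ⟦ d ⟧ ≡ 1ℚ
  ⟦⟧-yes (yes _) p = refl
  ⟦⟧-yes (no ¬p) p = contradiction p ¬p

  ⟦⟧-no : {P : Set} (d : Dec P) → ¬ P → ⟦ d ⟧ ≡ 0ℚ
  ⟦⟧-no (yes p) ¬p = contradiction p ¬p
  ⟦⟧-no (no _) ¬p = refl

  -- Peels one indicator off a product while putting its proposition at the disposal of the
  -- remaining estimate; `provide` is the converse on the right-hand side.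
  assume : {P : Set} (d : Dec P) {x z : ℚ} → (P → x ≤ z) → 0ℚ ≤ z → ⟦ d ⟧ * x ≤ z
  assume (yes p) {x} {z} h z≥0 = subst (_≤ z) (sym (*-identityˡ x)) (h p)
  assume (no _) {x} {z} h z≥0 = subst (_≤ z) (sym (*-zeroˡ x)) z≥0

  assume-not : {P : Set} (d : Dec P) {x z : ℚ} → (¬ P → x ≤ z) → 0ℚ ≤ z → (1ℚ - ⟦ d ⟧) * x ≤ z
  assume-not (yes p) {x} {z} h z≥0 = subst (_≤ z) (sym (*-zeroˡ x)) z≥0
  assume-not (no ¬p) {x} {z} h z≥0 = subst (_≤ z) (sym (*-identityˡ x)) (h ¬p)

  provide : {P : Set} (d : Dec P) {x z : ℚ} → P → x ≤ z → x ≤ ⟦ d ⟧ * z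
  provide d {x} {z} p h = subst (x ≤_) (sym (trans (cong (_* z) (⟦⟧-yes d p)) (*-identityˡ z))) h

  at-most-one : ∀ {n} {P : Fin n → Set} (P? : ∀ j → Dec (P j)) → (∀ j k → P j → P k → j ≡ k) →
    (∫ (vertices n) (λ j → ⟦ P? j ⟧) ≡ 0ℚ) ⊎ (∫ (vertices n) (λ j → ⟦ P? j ⟧) ≡ 1ℚ)
  at-most-one P? unique with any? P?
  ... | no none = inj₁ (trans (∫-cong (λ j → ⟦⟧-no (P? j) (λ p → none (j , p)))) ∫-0)
  ... | yes (j , p) = inj₂ (trans (∫-cong same) (∫-δ j (λ _ → 1ℚ)))
    where
    same : ∀ k → ⟦ P? k ⟧ ≡ ⟦ j ≟ᶠ k ⟧ * 1ℚ
    same k with j ≟ᶠ k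
    ... | yes refl = ⟦⟧-yes (P? j) p
    ... | no j≢k = ⟦⟧-no (P? k) (λ q → j≢k (unique j k p q))

  at-most-one-≤ : ∀ {n} {P : Fin n → Set} (P? : ∀ j → Dec (P j)) → (∀ j k → P j → P k → j ≡ k) → ∫ (vertices n)
      (λ j → ⟦ P? j ⟧) ≤ 1ℚ
  at-most-one-≤ P? unique with at-most-one P? unique
  ... | inj₁ e = subst (_≤ 1ℚ) (sym e) 0≤1
  ... | inj₂ e = ≤-reflexive e

  ∫-filter : ∀ {A : Set} {P : A → Set} (P? : ∀ x → Dec (P x)) xs f → ∫ (counting (filter P? xs)) f ≡ ∫ (counting xs)
      (λ x → ⟦ P? x ⟧ * f x)
  ∫-filter P? [] f = trans (∫-[] f) (sym (∫-[] _))
  ∫-filter P? (x ∷ xs) f with P? x in eq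
  ... | yes p = trans (∫-∷ x (filter P? xs) f) (trans (cong₂ _+_ (sym (trans (cong (_* f x) (⟦⟧-yes (P? x) p))
      (*-identityˡ (f x)))) (∫-filter P? xs f)) (sym (∫-∷ x xs _)))
  ... | no ¬p = trans (∫-filter P? xs f)
      (sym (trans (∫-∷ x xs _) (trans (cong (_+ ∫ (counting xs) (λ y → ⟦ P? y ⟧ * f y))
      (trans (cong (_* f x) (⟦⟧-no (P? x) ¬p)) (*-zeroˡ (f x)))) (+-identityˡ _))))

  ∫-concatMap : ∀ {A B : Set} (g : A → List B) xs f → ∫ (counting (concatMap g xs)) f ≡ ∫ (counting xs) (λ x →
      ∫ (counting (g x)) f)
  ∫-concatMap g [] f = trans (∫-[] f) (sym (∫-[] _))
  ∫-concatMap g (x ∷ xs) f = trans (∫-++ (g x) _ f) (trans (cong (λ ζ → ∫ (counting (g x)) f + ζ) (∫-concatMap g xs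
      f)) (sym (∫-∷ x xs _)))

  ∫-length : ∀ {A : Set} (xs : List A) → ∫ (counting xs) (λ _ → 1ℚ) ≡ ♯ (length xs)
  ∫-length [] = ∫-[] _
  ∫-length (x ∷ xs) = trans (∫-∷ x xs _) (trans (cong (λ ζ → 1ℚ + ζ) (∫-length xs)) (sym (♯-suc (length xs))))

  ♯-count : ∀ {A : Set} {P : A → Set} (P? : ∀ x → Dec (P x)) xs → ♯ (count P? xs) ≡ ∫ (counting xs) (λ x → ⟦ P? x ⟧)
  ♯-count P? xs = trans (sym (∫-length (filter P? xs))) (trans (∫-filter P? xs _) (∫-cong (λ x → *-identityʳ ⟦ P? x ⟧)))

  ∫-elems : ∀ {n} (X : Subset n) f → ∫ (counting (elems X)) f ≡ ∫ (vertices n) (λ j → ⟦ j ∈? X ⟧ * f (val j))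
  ∫-elems {n} X f = trans (∫-map val (filter (_∈? X) (allFin n)) f) (∫-filter (_∈? X) (allFin n) _)

  ∫-tuples-suc : ∀ {A : Set} k (L : Fin (suc k) → List A) f →
    ∫ (counting (tuples (suc k) L)) f ≡ ∫ (counting (L zero)) (λ x → ∫ (counting (tuples k (λ i → L (suc i))))
        (λ y → f (x ∷ y)))
  ∫-tuples-suc k L f = trans (∫-concatMap _ (L zero) f) (∫-cong (λ x → ∫-map (x ∷_) (tuples k (λ i → L (suc i))) f))

  ∏ : ∀ {A : Set} k → (Fin k → A → ℚ) → Vec A k → ℚ
  ∏ ℕ.zero g [] = 1ℚ
  ∏ (suc k) g (x ∷ y) = g zero x * ∏ k (λ i → g (suc i)) y

  ∏∫ : ∀ {A : Set} k → (Fin k → List A) → (Fin k → A → ℚ) → ℚ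
  ∏∫ ℕ.zero L g = 1ℚ
  ∏∫ (suc k) L g = ∫ (counting (L zero)) (g zero) * ∏∫ k (λ i → L (suc i)) (λ i → g (suc i))

  ∫-tuples-∏ : ∀ {A : Set} k (L : Fin k → List A) (g : Fin k → A → ℚ) → ∫ (counting (tuples k L)) (∏ k g) ≡ ∏∫ k L g
  ∫-tuples-∏ ℕ.zero L g = trans (∫-∷ [] [] _) (cong (λ ζ → 1ℚ + ζ) (∫-[] _))
  ∫-tuples-∏ (suc k) L g = trans (∫-tuples-suc k L _) (trans (∫-cong (λ x → ∫-*ˡ (g zero x) _))
    (trans (∫-*ʳ _ (g zero)) (cong (∫ (counting (L zero)) (g zero) *_) (∫-tuples-∏ k (λ i → L (suc i)) (λ i →
        g (suc i))))))

  ♯-size : ∀ {n} (X : Subset n) → ♯ ∣ X ∣ ≡ ∫ (vertices n) (λ j → 𝟙 (Vec.lookup X j))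
  ♯-size {ℕ.zero} [] = sym (∫-[] _)
  ♯-size {suc n} (true ∷ X) = trans (♯-suc ∣ X ∣) (trans (cong (λ ζ → 1ℚ + ζ) (♯-size X)) (sym (∫-allFin-suc n _)))
  ♯-size {suc n} (false ∷ X) = trans (♯-size X) (trans (sym (+-identityˡ _)) (sym (∫-allFin-suc n _)))

  ⟦∈⟧ : ∀ {n} (X : Subset n) j → ⟦ j ∈? X ⟧ ≡ 𝟙 (Vec.lookup X j)
  ⟦∈⟧ (true ∷ X) zero = refl
  ⟦∈⟧ (false ∷ X) zero = refl
  ⟦∈⟧ (b ∷ X) (suc j) = ⟦∈⟧ X j

  -- The graphs of a linear equation

  place : ∀ {N} → Fin N → ℤ
  place u = + toℕ u

  place-injective : ∀ {N} {u v : Fin N} → place u ≡ place v → u ≡ v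
  place-injective e = toℕ-injective (ℤ.+-injective e)

  val-injective : ∀ {n} {j k : Fin n} → val j ≡ val k → j ≡ k
  val-injective e = toℕ-injective (ℕ.suc-injective (ℤ.+-injective e))

  *-cancelˡ : ∀ {a x y} → a ≢ + 0 → a ℤ.* x ≡ a ℤ.* y → x ≡ y
  *-cancelˡ {a} {x} {y} a≢0 = ℤ.*-cancelˡ-≡ a x y {{ℤ.≢-nonZero a≢0}}

  drop-indicator : ∀ {N} {A} z → 0ℚ ≤ A → ∫ (vertices N) (λ v → A * ⟦ place v ℤ.≟ z ⟧) ≤ A
  drop-indicator {N} {A} z A≥0 = ≤-trans (≤-reflexive (∫-*ˡ A _)) (subst (A * ∫ (vertices N) (λ v → ⟦ place v ℤ.≟ z
      ⟧) ≤_) (*-identityʳ A)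
    (*-monoˡ-≤ A≥0 (at-most-one-≤ (λ v → place v ℤ.≟ z) (λ u v e f → place-injective (trans e (sym f))))))

  provideʳ : {P : Set} (d : Dec P) {x z : ℚ} → P → x ≤ z → x ≤ z * ⟦ d ⟧
  provideʳ d {x} {z} p h = subst (x ≤_) (*-comm ⟦ d ⟧ z) (provide d p h)

  step? : ∀ {N} (a : ℤ) (u v : Fin N) (x : ℤ) → Dec (place v ℤ.- place u ≡ a ℤ.* x)
  step? a u v x = place v ℤ.- place u ℤ.≟ a ℤ.* x

  edge : ∀ {n N} → ℤ → Subset n → Fin N → Fin N → ℚ
  edge a X u v = ∫ (counting (elems X)) (λ x → ⟦ step? a u v x ⟧)

  edge≡ : ∀ {n N} a (X : Subset n) (u v : Fin N) → edge a X u v ≡ ∫ (vertices n) (λ j → ⟦ (j ∈? X) ×-dec step? a u v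
      (val j) ⟧)
  edge≡ a X u v = trans (∫-elems X _) (∫-cong (λ j → sym (𝟙-∧ (does (j ∈? X)) (does (step? a u v (val j))))))

  edge-0-1 : ∀ {n N a} → a ≢ + 0 → ∀ (X : Subset n) (u v : Fin N) → (edge a X u v ≡ 0ℚ) ⊎ (edge a X u v ≡ 1ℚ)
  edge-0-1 {a = a} a≢0 X u v = subst (λ z → (z ≡ 0ℚ) ⊎ (z ≡ 1ℚ)) (sym (edge≡ a X u v))
    (at-most-one (λ j → (j ∈? X) ×-dec step? a u v (val j)) (λ j k p q → val-injective (*-cancelˡ a≢0
        (trans (sym (proj₂ p)) (proj₂ q)))))

  edge-idem : ∀ {n N a} → a ≢ + 0 → ∀ (X : Subset n) (u v : Fin N) → edge a X u v * edge a X u v ≡ edge a X u v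
  edge-idem a≢0 X u v with edge-0-1 a≢0 X u v
  ... | inj₁ e = trans (cong₂ _*_ e e) (sym e)
  ... | inj₂ e = trans (cong₂ _*_ e e) (sym e)

  edge≥0 : ∀ {n N} a (X : Subset n) (u v : Fin N) → 0ℚ ≤ edge a X u v
  edge≥0 a X u v = ∫-≥0 (λ x → ⟦⟧≥0 (step? a u v x))

  module _ (N : ℕ) where

    open Codegrees N

    module Rectangles {n : ℕ} {a : ℤ} (a≢0 : a ≢ + 0) (X : Subset n) where

      quadruples : Measure (Vec ℤ 4)
      quadruples = counting (tuples 4 (λ _ → elems X))

      -- Numbered so that the entries on the two sides of the additive equation are the two pairs of
      -- opposite edges of the four-cycle; both pairs have the sum `u + v - w - w′`.
      sides : V → V → V → V → Fin 4 → ℤ → ℚ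
      sides u v w w′ 0F x = ⟦ step? a w u x ⟧
      sides u v w w′ 1F x = ⟦ step? a w′ v x ⟧
      sides u v w w′ 2F x = ⟦ step? a w v x ⟧
      sides u v w w′ 3F x = ⟦ step? a w′ u x ⟧

      rectangle : V → V → V → V → Vec ℤ 4 → ℚ
      rectangle u v w w′ y = (1ℚ - ⟦ u ≟ᶠ v ⟧) * ((1ℚ - ⟦ w ≟ᶠ w′ ⟧) * ∏ 4 (sides u v w w′) y)

      expand : ∀ u v w w′ → (1ℚ - δ u v) * ((1ℚ - δ w w′) * (edge a X w u * edge a X w v * (edge a X w′ u * edge a X
          w′ v))) ≡ ∫ quadruples (rectangle u v w w′)
      expand u v w w′ = trans (cong (λ z → (1ℚ - δ u v) * ((1ℚ - δ w w′) * z)) (trans (regroup (edge a X w u)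
          (edge a X w v) (edge a X w′ u) (edge a X w′ v)) (sym (∫-tuples-∏ 4 (λ _ → elems X) (sides u v w w′)))))
        (sym (trans (∫-*ˡ (1ℚ - δ u v) _) (cong ((1ℚ - δ u v) *_) (∫-*ˡ (1ℚ - δ w w′) _))))
        where
        regroup : ∀ p q r s → p * q * (r * s) ≡ p * (s * (q * (r * 1ℚ)))
        regroup = solve-∀ ℚ-ring

      -- Once the quadruple and `u` are given, the other three vertices are forced, so a quadruple
      -- accounts for at most `N` four-cycles.
      determined : Vec ℤ 4 → V → V → V → V → ℚ
      determined y@(y₁ ∷ y₂ ∷ y₃ ∷ y₄ ∷ []) u v w w′ =
        ⟦ nontrivAddSol? y ⟧ * ⟦ place v ℤ.≟ place u ℤ.- a ℤ.* y₁ ℤ.+ a ℤ.* y₃ ⟧ * ⟦ place w ℤ.≟ place u ℤ.- a ℤ.*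
            y₁ ⟧ * ⟦ place w′ ℤ.≟ place u ℤ.- a ℤ.* y₄ ⟧

      determined≥0 : ∀ y u v w w′ → 0ℚ ≤ determined y u v w w′
      determined≥0 y@(y₁ ∷ y₂ ∷ y₃ ∷ y₄ ∷ []) u v w w′ = 0≤* (0≤* (0≤* (⟦⟧≥0 (nontrivAddSol? y))
          (⟦⟧≥0 (place v ℤ.≟ place u ℤ.- a ℤ.* y₁ ℤ.+ a ℤ.* y₃))) (⟦⟧≥0 (place w ℤ.≟ place u ℤ.- a ℤ.* y₁)))
          (⟦⟧≥0 (place w′ ℤ.≟ place u ℤ.- a ℤ.* y₄))

      rectangle≤ : ∀ y u v w w′ → rectangle u v w w′ y ≤ determined y u v w w′
      rectangle≤ y@(y₁ ∷ y₂ ∷ y₃ ∷ y₄ ∷ []) u v w w′ =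
        assume-not (u ≟ᶠ v) (λ u≢v → assume-not (w ≟ᶠ w′) (λ w≢w′ → assume (step? a w u y₁) (λ h₁ →
            assume (step? a w′ v y₂) (λ h₂ →
          assume (step? a w v y₃) (λ h₃ → assume (step? a w′ u y₄) (λ h₄ →
            provideʳ (place w′ ℤ.≟ place u ℤ.- a ℤ.* y₄) (from-difference {place u} {place w′} h₄)
                (provideʳ (place w ℤ.≟ place u ℤ.- a ℤ.* y₁) (from-difference {place u} {place w} h₁)
              (provideʳ (place v ℤ.≟ place u ℤ.- a ℤ.* y₁ ℤ.+ a ℤ.* y₃) (trans (back (place v) (place w))
                  (cong₂ ℤ._+_ {place w} (from-difference {place u} {place w} h₁) h₃))
                (≤-reflexive (sym (⟦⟧-yes (nontrivAddSol? y) (solution h₁ h₂ h₃ h₄ , nontrivial u≢v w≢w′ h₁ h₃ h₄)))))))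
            ≥0) ≥0) ≥0) ≥0) ≥0) ≥0
        where
        ≥0 = determined≥0 y u v w w′
        identity : ∀ p q → q ≡ p ℤ.- (p ℤ.- q)
        identity = ℤ-Solver.solve-∀
        back : ∀ p q → p ≡ q ℤ.+ (p ℤ.- q)
        back = ℤ-Solver.solve-∀
        from-difference : ∀ {p q s} → p ℤ.- q ≡ s → q ≡ p ℤ.- s
        from-difference {p} {q} h = trans (identity p q) (cong (λ z → p ℤ.- z) h)
        solution : place u ℤ.- place w ≡ a ℤ.* y₁ → place v ℤ.- place w′ ≡ a ℤ.* y₂ → place v ℤ.- place w ≡
            a ℤ.* y₃ → place u ℤ.- place w′ ≡ a ℤ.* y₄ → y₁ ℤ.+ y₂ ≡ y₃ ℤ.+ y₄
        solution h₁ h₂ h₃ h₄ = *-cancelˡ a≢0 (begin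
          a ℤ.* (y₁ ℤ.+ y₂) ≡⟨ ℤ.*-distribˡ-+ a y₁ y₂ ⟩
          a ℤ.* y₁ ℤ.+ a ℤ.* y₂ ≡⟨ sym (cong₂ ℤ._+_ h₁ h₂) ⟩
          (place u ℤ.- place w) ℤ.+ (place v ℤ.- place w′) ≡⟨ exchange (place u) (place v) (place w) (place w′) ⟩
          (place v ℤ.- place w) ℤ.+ (place u ℤ.- place w′) ≡⟨ cong₂ ℤ._+_ h₃ h₄ ⟩
          a ℤ.* y₃ ℤ.+ a ℤ.* y₄ ≡⟨ sym (ℤ.*-distribˡ-+ a y₃ y₄) ⟩
          a ℤ.* (y₃ ℤ.+ y₄) ∎)
          where
          open ≡-Reasoning
          exchange : ∀ p q r s → (p ℤ.- r) ℤ.+ (q ℤ.- s) ≡ (q ℤ.- r) ℤ.+ (p ℤ.- s)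
          exchange = ℤ-Solver.solve-∀
        nontrivial : u ≢ v → w ≢ w′ → place u ℤ.- place w ≡ a ℤ.* y₁ → place v ℤ.- place w ≡ a ℤ.* y₃ → place u ℤ.-
            place w′ ≡ a ℤ.* y₄ → ¬ Trivial y
        -- Equal first and third entries would put `u` and `v` at the same distance from `w`; equal
        -- first and fourth entries would force `w = w′`.
        nontrivial u≢v w≢w′ h₁ h₃ h₄ (inj₁ (e , _)) = u≢v (place-injective (trans (back (place u) (place w))
            (trans (cong (λ z → place w ℤ.+ z) (trans h₁ (trans (cong (a ℤ.*_) e) (sym h₃))))
            (sym (back (place v) (place w))))))
        nontrivial u≢v w≢w′ h₁ h₃ h₄ (inj₂ (e , _)) = w≢w′ (place-injective (trans (from-difference {place u}
            {place w} h₁) (trans (cong (λ z → place u ℤ.- a ℤ.* z) e) (sym (from-difference {place u} {place w′} h₄)))))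

      ∫-determined : ∀ y → ∫ #V (λ u → ∫ #V (λ v → ∫ #V (λ w → ∫ #V (λ w′ → determined y u v w w′)))) ≤
          ⟦ nontrivAddSol? y ⟧ * ♯ N
      ∫-determined y@(y₁ ∷ y₂ ∷ y₃ ∷ y₄ ∷ []) = ≤-trans (∫-mono (λ u →
          ≤-trans (∫-mono (λ v → ≤-trans (∫-mono (λ w → drop-indicator (place u ℤ.- a ℤ.* y₄)
              (0≤* (0≤* s≥0 (⟦⟧≥0 (place v ℤ.≟ place u ℤ.- a ℤ.* y₁ ℤ.+ a ℤ.* y₃))) (⟦⟧≥0 (place w ℤ.≟ place u ℤ.- a
              ℤ.* y₁)))))
              (drop-indicator (place u ℤ.- a ℤ.* y₁) (0≤* s≥0 (⟦⟧≥0 (place v ℤ.≟ place u ℤ.- a ℤ.* y₁ ℤ.+ a ℤ.* y₃))))))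
            (drop-indicator (place u ℤ.- a ℤ.* y₁ ℤ.+ a ℤ.* y₃) s≥0)))
          (≤-reflexive (trans (∫-const _) (cong (⟦ nontrivAddSol? y ⟧ *_) (∫-vertices-1 N))))
        where
        s≥0 = ⟦⟧≥0 (nontrivAddSol? y)

      fourCycles≤ : fourCycles (edge a X) ≤ ♯ (nontrivEnergy X) * ♯ N
      fourCycles≤ = begin
        fourCycles (edge a X) ≡⟨ ∫∫-cong (λ u v → ∫∫-cong (expand u v)) ⟩
        ∫ #V (λ u → ∫ #V (λ v → ∫ #V (λ w → ∫ #V (λ w′ → ∫ quadruples (rectangle u v w w′)))))
          ≡⟨ ∫-cong (λ u → trans (∫-cong (λ v → trans (∫-cong (λ w → ∫-swap _)) (∫-swap _))) (∫-swap _)) ⟩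
        ∫ #V (λ u → ∫ quadruples (λ y → ∫ #V (λ v → ∫ #V (λ w → ∫ #V (λ w′ → rectangle u v w w′ y))))) ≡⟨ ∫-swap _ ⟩
        ∫ quadruples (λ y → ∫ #V (λ u → ∫ #V (λ v → ∫ #V (λ w → ∫ #V (λ w′ → rectangle u v w w′ y)))))
          ≤⟨ ∫-mono (λ y → ≤-trans (∫∫-mono (λ u v → ∫∫-mono (rectangle≤ y u v))) (∫-determined y)) ⟩
        ∫ quadruples (λ y → ⟦ nontrivAddSol? y ⟧ * ♯ N) ≡⟨ ∫-*ʳ (♯ N) _ ⟩
        ∫ quadruples (λ y → ⟦ nontrivAddSol? y ⟧) * ♯ N ≡⟨ cong (_* ♯ N) (sym (♯-count nontrivAddSol? _)) ⟩
        ♯ (nontrivEnergy X) * ♯ N ∎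
        where open ≤-Reasoning

    module Pentagons {n : ℕ} (a : Fin 5 → ℤ) (X : Fin 5 → Subset n) where

      e : Fin 5 → V → V → ℚ
      e i = edge (a i) (X i)

      solutions : Measure (Vec ℤ 5)
      solutions = counting (tuples 5 (λ i → elems (X i)))

      path : Fin 5 → Fin 5 → V → V → ℚ
      path i j x z = ∫ #V (λ y → e i x y * e j y z)

      pentagons : ℚ
      pentagons = ∫ #V (λ x → ∫ #V (λ z → ∫ #V (λ w → path 0F 1F x z * (e 4F w x * path 2F 3F z w))))

      sides : V → V → V → V → V → Fin 5 → ℤ → ℚ
      sides x z w y y′ 0F t = ⟦ step? (a 0F) x y t ⟧
      sides x z w y y′ 1F t = ⟦ step? (a 1F) y z t ⟧
      sides x z w y y′ 2F t = ⟦ step? (a 2F) z y′ t ⟧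
      sides x z w y y′ 3F t = ⟦ step? (a 3F) y′ w t ⟧
      sides x z w y y′ 4F t = ⟦ step? (a 4F) w x t ⟧

      expand : ∀ x z w → path 0F 1F x z * (e 4F w x * path 2F 3F z w) ≡
          ∫ #V (λ y → ∫ #V (λ y′ → ∫ solutions (∏ 5 (sides x z w y y′))))
      expand x z w = trans (cong (path 0F 1F x z *_) (sym (∫-*ˡ (e 4F w x) _))) (trans (∫-*-∫ _ _) (∫∫-cong (λ y y′ →
          trans (regroup (e 0F x y) (e 1F y z) (e 4F w x) (e 2F z y′) (e 3F y′ w))
              (sym (∫-tuples-∏ 5 (λ i → elems (X i)) (sides x z w y y′))))))
        where
        regroup : ∀ p q r s t → p * q * (r * (s * t)) ≡ p * (q * (s * (t * (r * 1ℚ))))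
        regroup = solve-∀ ℚ-ring

      lin? : ∀ y → Dec (linComb a y ≡ + 0)
      lin? y = linComb a y ℤ.≟ + 0

      -- From `x` the vertices `y` and `z` are reached forwards and `w` and `y′` backwards around
      -- the cycle; the side from `z` to `y′` is left to the linear equation.
      determined : Vec ℤ 5 → V → V → V → V → V → ℚ
      determined t@(t₀ ∷ t₁ ∷ t₂ ∷ t₃ ∷ t₄ ∷ []) x z w y y′ =
        ⟦ lin? t ⟧ * ⟦ place z ℤ.≟ place x ℤ.+ a 0F ℤ.* t₀ ℤ.+ a 1F ℤ.* t₁ ⟧ * ⟦ place w ℤ.≟ place x ℤ.- a 4F ℤ.* t₄ ⟧
          * ⟦ place y ℤ.≟ place x ℤ.+ a 0F ℤ.* t₀ ⟧ * ⟦ place y′ ℤ.≟ place x ℤ.- a 4F ℤ.* t₄ ℤ.- a 3F ℤ.* t₃ ⟧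

      determined≥0 : ∀ t x z w y y′ → 0ℚ ≤ determined t x z w y y′
      determined≥0 t@(t₀ ∷ t₁ ∷ t₂ ∷ t₃ ∷ t₄ ∷ []) x z w y y′ =
        0≤* (0≤* (0≤* (0≤* (⟦⟧≥0 (lin? t)) (⟦⟧≥0 (place z ℤ.≟ place x ℤ.+ a 0F ℤ.* t₀ ℤ.+ a 1F ℤ.* t₁)))
            (⟦⟧≥0 (place w ℤ.≟ place x ℤ.- a 4F ℤ.* t₄))) (⟦⟧≥0 (place y ℤ.≟ place x ℤ.+ a 0F ℤ.* t₀)))
            (⟦⟧≥0 (place y′ ℤ.≟ place x ℤ.- a 4F ℤ.* t₄ ℤ.- a 3F ℤ.* t₃))

      sides≤ : ∀ t x z w y y′ → ∏ 5 (sides x z w y y′) t ≤ determined t x z w y y′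
      sides≤ t@(t₀ ∷ t₁ ∷ t₂ ∷ t₃ ∷ t₄ ∷ []) x z w y y′ =
        assume (step? (a 0F) x y t₀) (λ h₀ → assume (step? (a 1F) y z t₁) (λ h₁ → assume (step? (a 2F) z y′ t₂) (λ h₂ →
          assume (step? (a 3F) y′ w t₃) (λ h₃ → assume (step? (a 4F) w x t₄) (λ h₄ →
            provideʳ (place y′ ℤ.≟ place x ℤ.- a 4F ℤ.* t₄ ℤ.- a 3F ℤ.* t₃) (trans (from-difference {place w} h₃)
                (cong (λ p → p ℤ.- a 3F ℤ.* t₃) (from-difference {place x} {place w} h₄)))
              (provideʳ (place y ℤ.≟ place x ℤ.+ a 0F ℤ.* t₀) (forward {place y} {place x} h₀)
                  (provideʳ (place w ℤ.≟ place x ℤ.- a 4F ℤ.* t₄) (from-difference {place x} {place w} h₄)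
                (provideʳ (place z ℤ.≟ place x ℤ.+ a 0F ℤ.* t₀ ℤ.+ a 1F ℤ.* t₁) (trans (forward {place z} {place y}
                    h₁) (cong (λ p → p ℤ.+ a 1F ℤ.* t₁) (forward {place y} {place x} h₀)))
                  (≤-reflexive (sym (⟦⟧-yes (lin? t) (closed h₀ h₁ h₂ h₃ h₄))))))))
            ≥0) ≥0) ≥0) ≥0) ≥0
        where
        ≥0 = determined≥0 t x z w y y′
        identity : ∀ p q → q ≡ p ℤ.- (p ℤ.- q)
        identity = ℤ-Solver.solve-∀
        identity′ : ∀ p q → p ≡ q ℤ.+ (p ℤ.- q)
        identity′ = ℤ-Solver.solve-∀
        from-difference : ∀ {p q s} → p ℤ.- q ≡ s → q ≡ p ℤ.- s
        from-difference {p} {q} h = trans (identity p q) (cong (λ z → p ℤ.- z) h)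
        forward : ∀ {p q s} → p ℤ.- q ≡ s → p ≡ q ℤ.+ s
        forward {p} {q} h = trans (identity′ p q) (cong (λ z → q ℤ.+ z) h)
        telescope : ∀ p₀ p₁ p₂ p₃ p₄ → (p₁ ℤ.- p₀) ℤ.+ ((p₂ ℤ.- p₁) ℤ.+ ((p₃ ℤ.- p₂) ℤ.+ ((p₄ ℤ.- p₃) ℤ.+
            ((p₀ ℤ.- p₄) ℤ.+ + 0)))) ≡ + 0
        telescope = ℤ-Solver.solve-∀
        closed : place y ℤ.- place x ≡ a 0F ℤ.* t₀ → place z ℤ.- place y ≡ a 1F ℤ.* t₁ → place y′ ℤ.- place z ≡
            a 2F ℤ.* t₂ → place w ℤ.- place y′ ≡ a 3F ℤ.* t₃ → place x ℤ.- place w ≡ a 4F ℤ.* t₄ → linComb a t ≡ + 0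
        closed h₀ h₁ h₂ h₃ h₄ = trans (sym (cong₂ ℤ._+_ h₀ (cong₂ ℤ._+_ h₁ (cong₂ ℤ._+_ h₂ (cong₂ ℤ._+_ h₃
            (cong (ℤ._+ + 0) h₄)))))) (telescope (place x) (place y) (place z) (place y′) (place w))

      ∫-determined : ∀ t → ∫ #V (λ x → ∫ #V (λ z → ∫ #V (λ w → ∫ #V (λ y → ∫ #V (λ y′ → determined t x z w y y′)))))
          ≤ ⟦ lin? t ⟧ * ♯ N
      ∫-determined t@(t₀ ∷ t₁ ∷ t₂ ∷ t₃ ∷ t₄ ∷ []) = ≤-trans (∫-mono (λ x →
          ≤-trans (∫-mono (λ z → ≤-trans (∫-mono (λ w → ≤-trans (∫-mono (λ y → drop-indicator (place x ℤ.- a 4F ℤ.*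
              t₄ ℤ.- a 3F ℤ.* t₃) (0≤* (0≤* (0≤* s≥0 (⟦⟧≥0 (place z ℤ.≟ place x ℤ.+ a 0F ℤ.* t₀ ℤ.+ a 1F ℤ.* t₁)))
              (⟦⟧≥0 (place w ℤ.≟ place x ℤ.- a 4F ℤ.* t₄))) (⟦⟧≥0 (place y ℤ.≟ place x ℤ.+ a 0F ℤ.* t₀)))))
              (drop-indicator (place x ℤ.+ a 0F ℤ.* t₀) (0≤* (0≤* s≥0 (⟦⟧≥0 (place z ℤ.≟ place x ℤ.+ a 0F ℤ.* t₀ ℤ.+
                  a 1F ℤ.* t₁))) (⟦⟧≥0 (place w ℤ.≟ place x ℤ.- a 4F ℤ.* t₄))))))
              (drop-indicator (place x ℤ.- a 4F ℤ.* t₄) (0≤* s≥0 (⟦⟧≥0 (place z ℤ.≟ place x ℤ.+ a 0F ℤ.* t₀ ℤ.+ a 1F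
                  ℤ.* t₁))))))
            (drop-indicator (place x ℤ.+ a 0F ℤ.* t₀ ℤ.+ a 1F ℤ.* t₁) s≥0)))
          (≤-reflexive (trans (∫-const _) (cong (⟦ lin? t ⟧ *_) (∫-vertices-1 N))))
        where
        s≥0 = ⟦⟧≥0 (lin? t)

      pentagons≤ : pentagons ≤ ♯ (numSols a X) * ♯ N
      pentagons≤ = begin
        pentagons ≡⟨ ∫-cong (λ x → ∫∫-cong (expand x)) ⟩
        ∫ #V (λ x → ∫ #V (λ z → ∫ #V (λ w → ∫ #V (λ y → ∫ #V (λ y′ → ∫ solutions (∏ 5 (sides x z w y y′)))))))
          ≡⟨ ∫-cong (λ x → trans (∫-cong (λ z → trans (∫-cong (λ w → trans (∫-cong (λ y → ∫-swap _)) (∫-swap _)))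
              (∫-swap _))) (∫-swap _)) ⟩
        ∫ #V (λ x → ∫ solutions (λ t → ∫ #V (λ z → ∫ #V (λ w → ∫ #V (λ y → ∫ #V (λ y′ → ∏ 5 (sides x z w y y′)
            t)))))) ≡⟨ ∫-swap _ ⟩
        ∫ solutions (λ t → ∫ #V (λ x → ∫ #V (λ z → ∫ #V (λ w → ∫ #V (λ y → ∫ #V (λ y′ → ∏ 5 (sides x z w y y′) t))))))
          ≤⟨ ∫-mono (λ t → ≤-trans (∫-mono (λ x → ∫∫-mono (λ z w → ∫∫-mono (sides≤ t x z w)))) (∫-determined t)) ⟩
        ∫ solutions (λ t → ⟦ lin? t ⟧ * ♯ N) ≡⟨ ∫-*ʳ (♯ N) _ ⟩
        ∫ solutions (λ t → ⟦ lin? t ⟧) * ♯ N ≡⟨ cong (_* ♯ N) (sym (♯-count lin? _)) ⟩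
        ♯ (numSols a X) * ♯ N ∎
        where open ≤-Reasoning

  -- Removing the elements on many bad edges

  term≤∫ : ∀ {N} (f : Fin N → ℚ) → (∀ v → 0ℚ ≤ f v) → ∀ v → f v ≤ ∫ (vertices N) f
  term≤∫ f f≥0 v = subst (_≤ ∫ (vertices _) f) (∫-δ v f)
    (∫-mono (λ w → subst (𝟙 (does (v ≟ᶠ w)) * f w ≤_) (*-identityˡ (f w)) (*-monoʳ-≤ (f≥0 w) (𝟙≤1 (does (v ≟ᶠ w))))))

  ∫-injection : ∀ {n N} (h : Fin n → Fin N) → (∀ s t → h s ≡ h t → s ≡ t) → (f : Fin N → ℚ) → (∀ v → 0ℚ ≤ f v) →
    ∫ (vertices n) (λ t → f (h t)) ≤ ∫ (vertices N) f
  ∫-injection {n} {N} h inj f f≥0 = begin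
    ∫ (vertices n) (λ t → f (h t)) ≡⟨ ∫-cong (λ t → sym (∫-δ (h t) f)) ⟩
    ∫ (vertices n) (λ t → ∫ (vertices N) (λ v → ⟦ h t ≟ᶠ v ⟧ * f v)) ≡⟨ ∫-swap _ ⟩
    ∫ (vertices N) (λ v → ∫ (vertices n) (λ t → ⟦ h t ≟ᶠ v ⟧ * f v)) ≡⟨ ∫-cong (λ v → ∫-*ʳ (f v) _) ⟩
    ∫ (vertices N) (λ v → ∫ (vertices n) (λ t → ⟦ h t ≟ᶠ v ⟧) * f v)
      ≤⟨ ∫-mono (λ v → subst (∫ (vertices n) (λ t → ⟦ h t ≟ᶠ v ⟧) * f v ≤_) (*-identityˡ (f v))
           (*-monoʳ-≤ (f≥0 v) (at-most-one-≤ (λ t → h t ≟ᶠ v) (λ s t p q → inj s t (trans p (sym q)))))) ⟩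
    ∫ (vertices N) f ∎
    where open ≤-Reasoning

  -- Adding `∣ a ∣ * n` makes every displacement a natural number. For negative `a` the truncated
  -- subtraction is exact because `val j` is at most `n`.
  shift : ∀ {n} (a : ℤ) (j : Fin n) → Σ ℕ λ P → P ℕ.≤ ℤ.∣ a ∣ ℕ.* n ℕ.+ ℤ.∣ a ∣ ℕ.* n × + P ≡ + (ℤ.∣ a ∣ ℕ.* n) ℤ.+
      a ℤ.* val j
  shift {n} (+ k) j = k ℕ.* n ℕ.+ k ℕ.* suc (toℕ j) , ℕ.+-monoʳ-≤ (k ℕ.* n) (ℕ.*-monoʳ-≤ k (toℕ<n j)) ,
    trans (ℤ.pos-+ (k ℕ.* n) (k ℕ.* suc (toℕ j))) (cong (λ z → + (k ℕ.* n) ℤ.+ z) (ℤ.pos-* k (suc (toℕ j))))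
  shift {n} -[1+ k ] j = suc k ℕ.* n ∸ suc k ℕ.* suc (toℕ j) , ℕ.≤-trans (ℕ.m∸n≤m (suc k ℕ.* n) (suc k ℕ.* suc
      (toℕ j))) (ℕ.m≤m+n (suc k ℕ.* n) (suc k ℕ.* n)) ,
    sym (trans (ℤ.m-n≡m⊖n (suc k ℕ.* n) (suc k ℕ.* suc (toℕ j))) (ℤ.⊖-≥ (ℕ.*-monoʳ-≤ (suc k) (toℕ<n j))))

  module Translates {n N : ℕ} where

    translate : ∀ k → k ℕ.+ n ℕ.≤ N → Fin n → Fin N
    translate k h t = fromℕ< (ℕ.<-≤-trans (ℕ.+-monoʳ-< k (toℕ<n t)) h)

    place-translate : ∀ k h t → place (translate k h t) ≡ + k ℤ.+ + toℕ t
    place-translate k h t = trans (cong +_ (toℕ-fromℕ< _)) (ℤ.pos-+ k (toℕ t))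

    translate-injective : ∀ k h s t → translate k h s ≡ translate k h t → s ≡ t
    translate-injective k h s t e = toℕ-injective (ℕ.+-cancelˡ-≡ k (toℕ s) (toℕ t)
      (trans (sym (toℕ-fromℕ< _)) (trans (cong toℕ e) (toℕ-fromℕ< _))))

    badEdges : ℤ → (Fin N → Fin N → Bool) → Fin n → ℚ
    badEdges a bad j = ∫ (vertices N) (λ u → ∫ (vertices N) (λ v → ⟦ step? a u v (val j) ⟧ * 𝟙 (bad u v)))

    -- Different translates start at different vertices, so their bad edges, all labelled by the
    -- same element, are counted separately.
    translates-bad : ∀ a bad j k k′ h h′ → + k′ ℤ.- + k ≡ a ℤ.* val j →
      ∫ (vertices n) (λ t → 𝟙 (bad (translate k h t) (translate k′ h′ t))) ≤ badEdges a bad j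
    translates-bad a bad j k k′ h h′ e = ≤-trans (∫-mono below-edge) (∫-injection (translate k h)
        (translate-injective k h) F F≥0)
      where
      term : Fin N → Fin N → ℚ
      term u v = ⟦ step? a u v (val j) ⟧ * 𝟙 (bad u v)
      term≥0 : ∀ u v → 0ℚ ≤ term u v
      term≥0 u v = 0≤* (⟦⟧≥0 (step? a u v (val j))) (𝟙≥0 (bad u v))
      F : Fin N → ℚ
      F u = ∫ (vertices N) (term u)
      F≥0 : ∀ u → 0ℚ ≤ F u
      F≥0 u = ∫-≥0 (term≥0 u)
      cancel : ∀ p q r → (p ℤ.+ r) ℤ.- (q ℤ.+ r) ≡ p ℤ.- q
      cancel = ℤ-Solver.solve-∀
      below-edge : ∀ t → 𝟙 (bad (translate k h t) (translate k′ h′ t)) ≤ F (translate k h t)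
      below-edge t = ≤-trans (provide (step? a (translate k h t) (translate k′ h′ t) (val j))
          (trans (cong₂ ℤ._-_ (place-translate k′ h′ t) (place-translate k h t)) (trans (cancel (+ k′) (+ k)
              (+ toℕ t)) e)) ≤-refl)
        (term≤∫ (term (translate k h t)) (term≥0 (translate k h t)) (translate k′ h′ t))

    ∫-badEdges : ∀ a bad (X : Subset n) → ∫ (vertices n) (λ j → ⟦ j ∈? X ⟧ * badEdges a bad j) ≡ ∫ (vertices N)
        (λ u → ∫ (vertices N) (λ v → edge a X u v * 𝟙 (bad u v)))
    ∫-badEdges a bad X = trans (sym (∫-elems X (λ x → ∫ (vertices N) (λ u → ∫ (vertices N) (λ v → ⟦ step? a u v x ⟧
        * 𝟙 (bad u v))))))
      (trans (∫-swap _) (∫-cong (λ u → trans (∫-swap _) (∫-cong (λ v → ∫-*ʳ (𝟙 (bad u v)) _)))))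

  magnitude : (Fin 5 → ℤ) → ℕ
  magnitude a = ℤ.∣ a 0F ∣ ℕ.+ (ℤ.∣ a 1F ∣ ℕ.+ (ℤ.∣ a 2F ∣ ℕ.+ (ℤ.∣ a 3F ∣ ℕ.+ ℤ.∣ a 4F ∣)))

  module Reduced {n N : ℕ} (a : Fin 5 → ℤ) (X : Fin 5 → Subset n) (room : suc (magnitude a ℕ.+ magnitude a) ℕ.* n ℕ.≤ N)
    (bad : Fin 5 → Fin N → Fin N → Bool)
    (no-good-cycle : ∀ v₁ v₂ v₃ v₄ v₅ → ¬ (bad 0F v₁ v₂ ≡ false × bad 1F v₂ v₃ ≡ false × bad 2F v₃ v₄ ≡ false × bad
        3F v₄ v₅ ≡ false × bad 4F v₅ v₁ ≡ false))
    where

    open Translates {n} {N}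

    β : Fin 5 → Fin n → ℚ
    β i = badEdges (a i) (bad i)

    removed : Fin 5 → Fin n → Bool
    removed i j = ♯ n ≤ᵗ 5ℚ * β i j

    Y : Fin 5 → Subset n
    Y i = tabulate (λ j → lookup (X i) j ∧ not (removed i j))

    Y-lookup : ∀ i {j} → j ∈ Y i → lookup (X i) j ≡ true × not (removed i j) ≡ true
    Y-lookup i {j} h = ∧-true (lookup (X i) j) (not (removed i j))
        (trans (sym (lookup∘tabulate (λ j → lookup (X i) j ∧ not (removed i j)) j)) ([]=⇒lookup h))

    Y⊆X : ∀ i → Y i ⊆ X i
    Y⊆X i {j} h = lookup⇒[]= j (X i) (proj₁ (Y-lookup i h))

    few-bad : ∀ i {j} → j ∈ Y i → 5ℚ * β i j < ♯ n
    few-bad i {j} h = strict (comparison (♯ n) (5ℚ * β i j)) (proj₂ (Y-lookup i h))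
      where
      strict : ∀ {b} → Comparison (♯ n) (5ℚ * β i j) b → not b ≡ true → 5ℚ * β i j < ♯ n
      strict (above p) _ = p

    module Cycle (j : Fin 5 → Fin n) (lin : linComb a (val (j 0F) ∷ val (j 1F) ∷ val (j 2F) ∷ val (j 3F) ∷ val (j 4F) ∷ []) ≡ + 0) where

      b P : Fin 5 → ℕ
      b i = ℤ.∣ a i ∣ ℕ.* n
      P i = proj₁ (shift (a i) (j i))

      P≤ : ∀ i → P i ℕ.≤ b i ℕ.+ b i
      P≤ i = proj₁ (proj₂ (shift (a i) (j i)))

      b≤ : ∀ i → b i ℕ.≤ b i ℕ.+ b i
      b≤ i = ℕ.m≤m+n (b i) (b i)

      sum₅ : (Fin 5 → ℕ) → ℕ
      sum₅ f = f 0F ℕ.+ (f 1F ℕ.+ (f 2F ℕ.+ (f 3F ℕ.+ f 4F)))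

      -- Vertex `i` of the cycle is the sum of five summands, of which those before `i` have already
      -- moved from `b` to `P = b + s`. Every summand stays between 0 and `2 b`, so all partial sums
      -- fit into the interval whatever the signs of the coefficients.
      offsets : Fin 5 → Fin 5 → ℕ
      offsets 0F = b
      offsets 1F = λ { 0F → P 0F ; i → b i }
      offsets 2F = λ { 0F → P 0F ; 1F → P 1F ; i → b i }
      offsets 3F = λ { 0F → P 0F ; 1F → P 1F ; 2F → P 2F ; i → b i }
      offsets 4F = λ { 0F → P 0F ; 1F → P 1F ; 2F → P 2F ; 3F → P 3F ; i → b i }

      k : Fin 5 → ℕ
      k i = sum₅ (offsets i)

      offsets≤ : ∀ i l → offsets i l ℕ.≤ b l ℕ.+ b l
      offsets≤ 0F l = b≤ l
      offsets≤ 1F 0F = P≤ 0F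
      offsets≤ 1F (suc l) = b≤ (suc l)
      offsets≤ 2F 0F = P≤ 0F
      offsets≤ 2F 1F = P≤ 1F
      offsets≤ 2F (suc (suc l)) = b≤ (suc (suc l))
      offsets≤ 3F 0F = P≤ 0F
      offsets≤ 3F 1F = P≤ 1F
      offsets≤ 3F 2F = P≤ 2F
      offsets≤ 3F (suc (suc (suc l))) = b≤ (suc (suc (suc l)))
      offsets≤ 4F 0F = P≤ 0F
      offsets≤ 4F 1F = P≤ 1F
      offsets≤ 4F 2F = P≤ 2F
      offsets≤ 4F 3F = P≤ 3F
      offsets≤ 4F 4F = b≤ 4F

      k≤ : ∀ i → k i ℕ.+ n ℕ.≤ N
      k≤ i = ℕ.≤-trans (ℕ.+-monoˡ-≤ n (ℕ.+-mono-≤ (offsets≤ i 0F) (ℕ.+-mono-≤ (offsets≤ i 1F)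
          (ℕ.+-mono-≤ (offsets≤ i 2F) (ℕ.+-mono-≤ (offsets≤ i 3F) (offsets≤ i 4F))))))
        (ℕ.≤-trans (ℕ.≤-reflexive (collect ℤ.∣ a 0F ∣ ℤ.∣ a 1F ∣ ℤ.∣ a 2F ∣ ℤ.∣ a 3F ∣ ℤ.∣ a 4F ∣ n)) room)
        where
        collect : ∀ p q r s t n → (p ℕ.* n ℕ.+ p ℕ.* n) ℕ.+ ((q ℕ.* n ℕ.+ q ℕ.* n) ℕ.+ ((r ℕ.* n ℕ.+ r ℕ.* n) ℕ.+
            ((s ℕ.* n ℕ.+ s ℕ.* n) ℕ.+ (t ℕ.* n ℕ.+ t ℕ.* n)))) ℕ.+ n
          ≡ suc ((p ℕ.+ (q ℕ.+ (r ℕ.+ (s ℕ.+ t)))) ℕ.+ (p ℕ.+ (q ℕ.+ (r ℕ.+ (s ℕ.+ t))))) ℕ.* n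
        collect = ℕ-Solver.solve-∀

      s : Fin 5 → ℤ
      s i = a i ℤ.* val (j i)

      +P : ∀ i → + P i ≡ + b i ℤ.+ s i
      +P i = proj₂ (proj₂ (shift (a i) (j i)))

      +sum₅ : ∀ f → + sum₅ f ≡ + f 0F ℤ.+ (+ f 1F ℤ.+ (+ f 2F ℤ.+ (+ f 3F ℤ.+ + f 4F)))
      +sum₅ f = trans (ℤ.pos-+ (f 0F) _) (cong (λ z → + f 0F ℤ.+ z) (trans (ℤ.pos-+ (f 1F) _)
          (cong (λ z → + f 1F ℤ.+ z) (trans (ℤ.pos-+ (f 2F) _) (cong (λ z → + f 2F ℤ.+ z) (ℤ.pos-+ (f 3F) (f 4F)))))))

      gap₀ : + k 1F ℤ.- + k 0F ≡ s 0F
      gap₀ = trans (cong₂ ℤ._-_ (trans (+sum₅ (offsets 1F))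
          (cong (λ z → z ℤ.+ (+ b 1F ℤ.+ (+ b 2F ℤ.+ (+ b 3F ℤ.+ + b 4F)))) (+P 0F))) (+sum₅ (offsets 0F)))
        (identity (s 0F) (+ b 0F) (+ b 1F ℤ.+ (+ b 2F ℤ.+ (+ b 3F ℤ.+ + b 4F))))
        where
        identity : ∀ s b r → ((b ℤ.+ s) ℤ.+ r) ℤ.- (b ℤ.+ r) ≡ s
        identity = ℤ-Solver.solve-∀

      gap₁ : + k 2F ℤ.- + k 1F ≡ s 1F
      gap₁ = trans (cong₂ ℤ._-_ (trans (+sum₅ (offsets 2F))
          (cong (λ z → + P 0F ℤ.+ (z ℤ.+ (+ b 2F ℤ.+ (+ b 3F ℤ.+ + b 4F)))) (+P 1F))) (+sum₅ (offsets 1F)))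
        (identity (s 1F) (+ b 1F) (+ P 0F) (+ b 2F ℤ.+ (+ b 3F ℤ.+ + b 4F)))
        where
        identity : ∀ s b p r → (p ℤ.+ ((b ℤ.+ s) ℤ.+ r)) ℤ.- (p ℤ.+ (b ℤ.+ r)) ≡ s
        identity = ℤ-Solver.solve-∀

      gap₂ : + k 3F ℤ.- + k 2F ≡ s 2F
      gap₂ = trans (cong₂ ℤ._-_ (trans (+sum₅ (offsets 3F))
          (cong (λ z → + P 0F ℤ.+ (+ P 1F ℤ.+ (z ℤ.+ (+ b 3F ℤ.+ + b 4F)))) (+P 2F))) (+sum₅ (offsets 2F)))
        (identity (s 2F) (+ b 2F) (+ P 0F) (+ P 1F) (+ b 3F ℤ.+ + b 4F))
        where
        identity : ∀ s b p q r → (p ℤ.+ (q ℤ.+ ((b ℤ.+ s) ℤ.+ r))) ℤ.- (p ℤ.+ (q ℤ.+ (b ℤ.+ r))) ≡ s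
        identity = ℤ-Solver.solve-∀

      gap₃ : + k 4F ℤ.- + k 3F ≡ s 3F
      gap₃ = trans (cong₂ ℤ._-_ (trans (+sum₅ (offsets 4F))
          (cong (λ z → + P 0F ℤ.+ (+ P 1F ℤ.+ (+ P 2F ℤ.+ (z ℤ.+ + b 4F)))) (+P 3F))) (+sum₅ (offsets 3F)))
        (identity (s 3F) (+ b 3F) (+ P 0F) (+ P 1F) (+ P 2F) (+ b 4F))
        where
        identity : ∀ s b p q q′ r → (p ℤ.+ (q ℤ.+ (q′ ℤ.+ ((b ℤ.+ s) ℤ.+ r)))) ℤ.-
            (p ℤ.+ (q ℤ.+ (q′ ℤ.+ (b ℤ.+ r)))) ≡ s
        identity = ℤ-Solver.solve-∀

      -- The closing edge: the first four displacements have been added, and the equation says that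
      -- the fifth brings the path back.
      gap₄ : + k 0F ℤ.- + k 4F ≡ s 4F
      gap₄ = trans (cong₂ ℤ._-_ (+sum₅ (offsets 0F)) (trans (+sum₅ (offsets 4F)) (cong₂ ℤ._+_ (+P 0F)
          (cong₂ ℤ._+_ (+P 1F) (cong₂ ℤ._+_ (+P 2F) (cong (λ z → z ℤ.+ + b 4F) (+P 3F)))))))
        (trans (identity (s 0F) (s 1F) (s 2F) (s 3F) (s 4F) (+ b 0F) (+ b 1F) (+ b 2F) (+ b 3F) (+ b 4F))
            (trans (cong (λ z → s 4F ℤ.- z) lin) (ℤ.+-identityʳ (s 4F))))
        where
        identity : ∀ s₀ s₁ s₂ s₃ s₄ b₀ b₁ b₂ b₃ b₄ → (b₀ ℤ.+ (b₁ ℤ.+ (b₂ ℤ.+ (b₃ ℤ.+ b₄)))) ℤ.- ((b₀ ℤ.+ s₀) ℤ.+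
            ((b₁ ℤ.+ s₁) ℤ.+ ((b₂ ℤ.+ s₂) ℤ.+ ((b₃ ℤ.+ s₃) ℤ.+ b₄))))
          ≡ s₄ ℤ.- (s₀ ℤ.+ (s₁ ℤ.+ (s₂ ℤ.+ (s₃ ℤ.+ (s₄ ℤ.+ + 0)))))
        identity = ℤ-Solver.solve-∀

      v : Fin 5 → Fin n → Fin N
      v i = translate (k i) (k≤ i)

      bad-somewhere : ∀ t → 1ℚ ≤ 𝟙 (bad 0F (v 0F t) (v 1F t)) + (𝟙 (bad 1F (v 1F t) (v 2F t)) +
          (𝟙 (bad 2F (v 2F t) (v 3F t)) + (𝟙 (bad 3F (v 3F t) (v 4F t)) + 𝟙 (bad 4F (v 4F t) (v 0F t)))))
      bad-somewhere t = some _ _ _ _ _ (no-good-cycle (v 0F t) (v 1F t) (v 2F t) (v 3F t) (v 4F t))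
        where
        right : ∀ c {z} → 1ℚ ≤ z → 1ℚ ≤ 𝟙 c + z
        right c {z} h = ≤-trans h (subst (_≤ 𝟙 c + z) (+-identityˡ z) (+-monoˡ-≤ z (𝟙≥0 c)))
        left : ∀ {z} → 0ℚ ≤ z → 1ℚ ≤ 1ℚ + z
        left {z} h = ≤-by z refl h
        some : ∀ c₀ c₁ c₂ c₃ c₄ → ¬ (c₀ ≡ false × c₁ ≡ false × c₂ ≡ false × c₃ ≡ false × c₄ ≡ false) → 1ℚ ≤
            𝟙 c₀ + (𝟙 c₁ + (𝟙 c₂ + (𝟙 c₃ + 𝟙 c₄)))
        some true c₁ c₂ c₃ c₄ h = left (0≤+ (𝟙≥0 c₁) (0≤+ (𝟙≥0 c₂) (0≤+ (𝟙≥0 c₃) (𝟙≥0 c₄))))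
        some false true c₂ c₃ c₄ h = right false (left (0≤+ (𝟙≥0 c₂) (0≤+ (𝟙≥0 c₃) (𝟙≥0 c₄))))
        some false false true c₃ c₄ h = right false (right false (left (0≤+ (𝟙≥0 c₃) (𝟙≥0 c₄))))
        some false false false true c₄ h = right false (right false (right false (left (𝟙≥0 c₄))))
        some false false false false true h = right false (right false (right false (right false ≤-refl)))
        some false false false false false h = contradiction (refl , refl , refl , refl , refl) h

      n≤ : ♯ n ≤ β 0F (j 0F) + (β 1F (j 1F) + (β 2F (j 2F) + (β 3F (j 3F) + β 4F (j 4F))))
      n≤ = begin
        ♯ n ≡⟨ sym (∫-vertices-1 n) ⟩
        ∫ (vertices n) (λ _ → 1ℚ) ≤⟨ ∫-mono bad-somewhere ⟩
        ∫ (vertices n) (λ t → E 0F 1F t + (E 1F 2F t + (E 2F 3F t + (E 3F 4F t + E 4F 0F t))))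
          ≡⟨ trans (∫-+ _ _) (cong (λ z → I 0F 1F + z) (trans (∫-+ _ _) (cong (λ z → I 1F 2F + z) (trans (∫-+ _ _)
              (cong (λ z → I 2F 3F + z) (∫-+ _ _)))))) ⟩
        I 0F 1F + (I 1F 2F + (I 2F 3F + (I 3F 4F + I 4F 0F)))
          ≤⟨ +-mono-≤ (each 0F 1F gap₀) (+-mono-≤ (each 1F 2F gap₁) (+-mono-≤ (each 2F 3F gap₂)
              (+-mono-≤ (each 3F 4F gap₃) (each 4F 0F gap₄)))) ⟩
        β 0F (j 0F) + (β 1F (j 1F) + (β 2F (j 2F) + (β 3F (j 3F) + β 4F (j 4F)))) ∎
        where
        open ≤-Reasoning
        E : Fin 5 → Fin 5 → Fin n → ℚ
        E i i′ t = 𝟙 (bad i (v i t) (v i′ t))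
        I : Fin 5 → Fin 5 → ℚ
        I i i′ = ∫ (vertices n) (E i i′)
        each : ∀ i i′ → + k i′ ℤ.- + k i ≡ s i → I i i′ ≤ β i (j i)
        each i i′ = translates-bad (a i) (bad i) (j i) (k i) (k i′) (k≤ i) (k≤ i′)

      -- The n translates of a solution are five-cycles, each with a bad edge, but every element of
      -- Y i lies on fewer than n / 5 bad edges.
      impossible : ¬ (∀ i → j i ∈ Y i)
      impossible h = <-irrefl refl (<-≤-trans (+-mono-< (few-bad 0F (h 0F)) (+-mono-< (few-bad 1F (h 1F))
          (+-mono-< (few-bad 2F (h 2F)) (+-mono-< (few-bad 3F (h 3F)) (few-bad 4F (h 4F))))))
          (subst₂ _≤_ (five (♯ n)) (distribute (β 0F (j 0F)) (β 1F (j 1F)) (β 2F (j 2F)) (β 3F (j 3F))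
              (β 4F (j 4F))) (*-monoˡ-≤ (nonNegative⁻¹ 5ℚ) n≤)))
        where
        five : ∀ x → 5ℚ * x ≡ x + (x + (x + (x + x)))
        five = solve-∀ ℚ-ring
        distribute : ∀ p q r s t → 5ℚ * (p + (q + (r + (s + t)))) ≡ 5ℚ * p + (5ℚ * q + (5ℚ * r + (5ℚ * s + 5ℚ * t)))
        distribute = solve-∀ ℚ-ring

    elems-0 : ∀ (Z : Subset n) {f : ℤ → ℚ} → (∀ j → j ∈ Z → f (val j) ≡ 0ℚ) → ∫ (counting (elems Z)) f ≡ 0ℚ
    elems-0 Z {f} h = trans (∫-elems Z f) (trans (∫-cong (λ j → vanish (j ∈? Z) (h j))) ∫-0)
      where
      vanish : ∀ {P : Set} (d : Dec P) {x} → (P → x ≡ 0ℚ) → ⟦ d ⟧ * x ≡ 0ℚ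
      vanish (yes p) h = trans (*-identityˡ _) (h p)
      vanish (no _) {x} h = *-zeroˡ x

    Y-solution-free : numSols a Y ≡ 0
    Y-solution-free = ♯-injective (trans (♯-count (λ v → linComb a v ℤ.≟ + 0) _)
      (trans (∫-tuples-suc 4 L _) (elems-0 (Y 0F) (λ j₀ h₀ →
        trans (∫-tuples-suc 3 (λ i → L (suc i)) _) (elems-0 (Y 1F) (λ j₁ h₁ →
          trans (∫-tuples-suc 2 (λ i → L (suc (suc i))) _) (elems-0 (Y 2F) (λ j₂ h₂ →
            trans (∫-tuples-suc 1 (λ i → L (suc (suc (suc i)))) _) (elems-0 (Y 3F) (λ j₃ h₃ →
              trans (∫-tuples-suc 0 (λ i → L (suc (suc (suc (suc i))))) _) (elems-0 (Y 4F) (λ j₄ h₄ →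
                trans (∫-∷ [] _ _) (trans (cong₂ _+_ (⟦⟧-no (linComb a (val j₀ ∷ val j₁ ∷ val j₂ ∷ val j₃ ∷ val j₄
                    ∷ []) ℤ.≟ + 0) (λ lin →
                  Cycle.impossible (λ { 0F → j₀ ; 1F → j₁ ; 2F → j₂ ; 3F → j₃ ; 4F → j₄ }) lin
                    (λ { 0F → h₀ ; 1F → h₁ ; 2F → h₂ ; 3F → h₃ ; 4F → h₄ }))) (∫-[] _)) (+-identityˡ 0ℚ))))))))))))))
      where
      L : Fin 5 → List ℤ
      L i = elems (Y i)

    -- Markov's inequality: a removed element carries at least `n / 5` bad edges, and over `X i`
    -- these add up to the bad edges of the graph.
    removed-size : ∀ i → ♯ n * ♯ (∣ X i ∣ ∸ ∣ Y i ∣) ≤ 5ℚ * ∫ (vertices N) (λ u → ∫ (vertices N) (λ v →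
        edge (a i) (X i) u v * 𝟙 (bad i u v)))
    removed-size i = begin
      ♯ n * ♯ (∣ X i ∣ ∸ ∣ Y i ∣) ≡⟨ cong (♯ n *_) size ⟩
      ♯ n * ∫ (vertices n) (λ j → 𝟙 (lookup (X i) j) * 𝟙 (removed i j)) ≡⟨ sym (∫-*ˡ (♯ n) _) ⟩
      ∫ (vertices n) (λ j → ♯ n * (𝟙 (lookup (X i) j) * 𝟙 (removed i j))) ≤⟨ ∫-mono pointwise ⟩
      ∫ (vertices n) (λ j → 5ℚ * (⟦ j ∈? X i ⟧ * β i j)) ≡⟨ ∫-*ˡ 5ℚ _ ⟩
      5ℚ * ∫ (vertices n) (λ j → ⟦ j ∈? X i ⟧ * β i j) ≡⟨ cong (5ℚ *_) (∫-badEdges (a i) (bad i) (X i)) ⟩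
      5ℚ * ∫ (vertices N) (λ u → ∫ (vertices N) (λ v → edge (a i) (X i) u v * 𝟙 (bad i u v))) ∎
      where
      open ≤-Reasoning
      split : ∀ x r → 𝟙 x ≡ 𝟙 (x ∧ not r) + 𝟙 x * 𝟙 r
      split true true = refl
      split true false = refl
      split false r = trans (sym (*-zeroˡ (𝟙 r))) (sym (+-identityˡ (0ℚ * 𝟙 r)))
      cancel : ∀ {p q r} → p + q ≡ p + r → q ≡ r
      cancel {p} {q} {r} h = trans (sym (identity p q)) (trans (cong (λ z → - p + z) h) (identity p r))
        where
        identity : ∀ p q → - p + (p + q) ≡ q
        identity = solve-∀ ℚ-ring
      size : ♯ (∣ X i ∣ ∸ ∣ Y i ∣) ≡ ∫ (vertices n) (λ j → 𝟙 (lookup (X i) j) * 𝟙 (removed i j))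
      size = cancel {♯ ∣ Y i ∣} (trans (sym (♯-+ ∣ Y i ∣ _)) (trans (cong ♯ (ℕ.m+[n∸m]≡n (p⊆q⇒∣p∣≤∣q∣ (Y⊆X i))))
        (trans (♯-size (X i)) (trans (∫-cong (λ j → split (lookup (X i) j) (removed i j))) (trans (∫-+ _ _)
            (cong (λ z → z + ∫ (vertices n) (λ j → 𝟙 (lookup (X i) j) * 𝟙 (removed i j)))
          (sym (trans (♯-size (Y i)) (∫-cong (λ j → cong 𝟙 (lookup∘tabulate (λ j → lookup (X i) j ∧ not
              (removed i j)) j)))))))))))
      β≥0 : ∀ j → 0ℚ ≤ β i j
      β≥0 j = ∫∫-≥0 (λ u v → 0≤* (⟦⟧≥0 (step? (a i) u v (val j))) (𝟙≥0 (bad i u v)))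
      often : ∀ j {b} → Comparison (♯ n) (5ℚ * β i j) b → ♯ n * 𝟙 b ≤ 5ℚ * β i j
      often j (below h) = subst (_≤ 5ℚ * β i j) (sym (*-identityʳ (♯ n))) h
      often j (above _) = subst (_≤ 5ℚ * β i j) (sym (*-zeroʳ (♯ n))) (0≤* (nonNegative⁻¹ 5ℚ) (β≥0 j))
      pointwise : ∀ j → ♯ n * (𝟙 (lookup (X i) j) * 𝟙 (removed i j)) ≤ 5ℚ * (⟦ j ∈? X i ⟧ * β i j)
      pointwise j = subst₂ _≤_ (left-comm (𝟙 (lookup (X i) j)) (♯ n) (𝟙 (removed i j)))
        (trans (left-comm (𝟙 (lookup (X i) j)) 5ℚ (β i j)) (cong (λ z → 5ℚ * (z * β i j)) (sym (⟦∈⟧ (X i) j))))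
        (*-monoˡ-≤ (𝟙≥0 (lookup (X i) j)) (often j (comparison (♯ n) (5ℚ * β i j))))

  -- Choice of the parameters

  -- If the old square is too small, `s` grows by one, and `2 s ≤ s² + 1` keeps the new square below
  -- twice the old one plus 2.
  square-between : ∀ m → 1 ℕ.≤ m → Σ ℕ λ s → m ℕ.≤ s ℕ.* s × s ℕ.* s ℕ.≤ 4 ℕ.* m
  square-between (suc zero) _ = 1 , ℕ.≤-refl , ℕ.s≤s ℕ.z≤n
  square-between (suc (suc m)) _ with square-between (suc m) (ℕ.s≤s ℕ.z≤n)
  ... | s , lower , upper with suc (suc m) ℕ.≤? s ℕ.* s
  ...   | yes h = s , h , ℕ.≤-trans upper (ℕ.*-monoʳ-≤ 4 (ℕ.n≤1+n (suc m)))
  ...   | no h = suc s , ℕ.≤-trans (ℕ.s≤s lower) (subst (suc (s ℕ.* s) ℕ.≤_) (sym (expand s))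
      (ℕ.s≤s (ℕ.m≤m+n (s ℕ.* s) (s ℕ.+ s)))) ,
          ℕ.≤-trans (ℕ.≤-reflexive (expand s)) (ℕ.≤-trans (ℕ.s≤s (ℕ.+-monoʳ-≤ (s ℕ.* s) (double≤ s))) final)
    where
    expand : ∀ s → suc s ℕ.* suc s ≡ suc (s ℕ.* s ℕ.+ (s ℕ.+ s))
    expand = ℕ-Solver.solve-∀
    double≤ : ∀ s → s ℕ.+ s ℕ.≤ suc (s ℕ.* s)
    double≤ zero = ℕ.z≤n
    double≤ (suc s) = ℕ.≤-trans (ℕ.m≤m+n (suc s ℕ.+ suc s) (s ℕ.* s)) (ℕ.≤-reflexive (sym (identity s)))
      where
      identity : ∀ s → suc (suc s ℕ.* suc s) ≡ suc s ℕ.+ suc s ℕ.+ s ℕ.* s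
      identity = ℕ-Solver.solve-∀
    s²≤ : s ℕ.* s ℕ.≤ suc m
    s²≤ = ℕ.≤-pred (ℕ.≰⇒> h)
    final : suc (s ℕ.* s ℕ.+ suc (s ℕ.* s)) ℕ.≤ 4 ℕ.* suc (suc m)
    final = ℕ.≤-trans (ℕ.s≤s (ℕ.+-mono-≤ s²≤ (ℕ.s≤s s²≤))) (ℕ.≤-trans (ℕ.m≤m+n _ (suc m ℕ.+ suc m ℕ.+ 2))
        (ℕ.≤-reflexive (identity m)))
      where
      identity : ∀ m → suc (suc m ℕ.+ suc (suc m)) ℕ.+ (suc m ℕ.+ suc m ℕ.+ 2) ≡ 4 ℕ.* suc (suc m)
      identity = ℕ-Solver.solve-∀

  square-cancel-≤ : ∀ {k s} → k ℕ.* k ℕ.≤ s ℕ.* s → k ℕ.≤ s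
  square-cancel-≤ {k} {s} h with k ℕ.≤? s
  ... | yes p = p
  ... | no p = contradiction h (ℕ.<⇒≱ (ℕ.*-mono-< (ℕ.≰⇒> p) (ℕ.≰⇒> p)))

  ♯-square : ∀ x → ♯ (x ℕ.^ 2) ≡ ♯ x * ♯ x
  ♯-square x = trans (♯-* x (x ℕ.* 1)) (cong (λ y → ♯ x * ♯ y) (ℕ.*-identityʳ x))

  ♯-cube : ∀ x → ♯ (x ℕ.^ 3) ≡ ♯ x * (♯ x * ♯ x)
  ♯-cube x = trans (♯-* x (x ℕ.^ 2)) (cong (♯ x *_) (♯-square x))

  0<⊓ : ∀ {p q} → 0ℚ < p → 0ℚ < q → 0ℚ < p ⊓ q
  0<⊓ {p} {q} hp hq with ≤-total p q
  ... | inj₁ h = subst (0ℚ <_) (sym (p≤q⇒p⊓q≡p h)) hp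
  ... | inj₂ h = subst (0ℚ <_) (sym (p≥q⇒p⊓q≡q h)) hq

  abstract
    -- 15 from `bad-few` times 5 from `removed-size`; abstract, so that it acts as a symbol in the
    -- identities below.
    75ℚ : ℚ
    75ℚ = 15ℚ * 5ℚ

    75ℚ≡ : 75ℚ ≡ 15ℚ * 5ℚ
    75ℚ≡ = refl

    1≤75ℚ : 1ℚ ≤ 75ℚ
    1≤75ℚ = *-mono-≤ {p = 1ℚ} {r = 1ℚ} 0≤1 0≤1 (≤-by (15ℚ - 1ℚ) refl (nonNegative⁻¹ (15ℚ - 1ℚ))) (≤-by 4ℚ refl
        (nonNegative⁻¹ 4ℚ))

  module Thresholds (a : Fin 5 → ℤ) (a≢0 : ∀ i → a i ≢ + 0) (ε : ℚ) (0<ε : 0ℚ < ε) where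

    private
      Lₙ : ℕ
      Lₙ = suc (magnitude a ℕ.+ magnitude a)

      L : ℚ
      L = ♯ Lₙ

      1≤L : 1ℚ ≤ L
      1≤L = ♯-mono {1} {Lₙ} (ℕ.s≤s ℕ.z≤n)

      0≤L : 0ℚ ≤ L
      0≤L = ♯≥0 Lₙ

      0<600L² : 0ℚ < (8ℚ * 75ℚ) * (L * L)
      0<600L² = 0<* (0<* (positive⁻¹ 8ℚ) (<-≤-trans 0<1 1≤75ℚ)) (0<* 0<L 0<L)
        where
        0<L : 0ℚ < L
        0<L = <-≤-trans 0<1 1≤L

      -- Chosen backwards from `R²≤`: `x R ≤ 75 κ S³` and `S² ≤ 4 L x` give `R² ≤ (600 κ L)² L x`,
      -- and `L ≤ L²` rounds this up to `(600 κ L²)² x`. The minimum with 1 ensures `κ ≤ 1`.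
      κ : ℚ
      κ = (ε ⊓ 1ℚ) * inv ((8ℚ * 75ℚ) * (L * L))

      0<ε⊓1 : 0ℚ < ε ⊓ 1ℚ
      0<ε⊓1 = 0<⊓ 0<ε 0<1

      0<κ : 0ℚ < κ
      0<κ = 0<* 0<ε⊓1 (inv>0 0<600L²)

      600κL² : κ * ((8ℚ * 75ℚ) * (L * L)) ≡ ε ⊓ 1ℚ
      600κL² = trans (*-assoc (ε ⊓ 1ℚ) _ _) (trans (cong ((ε ⊓ 1ℚ) *_) (trans (*-comm _ ((8ℚ * 75ℚ) * (L * L)))
          (*-inv 0<600L²))) (*-identityʳ (ε ⊓ 1ℚ)))

      κ≤1 : κ ≤ 1ℚ
      κ≤1 = ≤-trans (subst (_≤ κ * ((8ℚ * 75ℚ) * (L * L))) (*-identityʳ κ) (*-monoˡ-≤ (<⇒≤ 0<κ) 1≤600L²))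
          (subst (_≤ 1ℚ) (sym 600κL²) (p⊓q≤q ε 1ℚ))
        where
        1≤600L² : 1ℚ ≤ (8ℚ * 75ℚ) * (L * L)
        1≤600L² = *-mono-≤ {p = 1ℚ} {r = 1ℚ} 0≤1 0≤1 (*-mono-≤ {p = 1ℚ} {q = 8ℚ} {r = 1ℚ} 0≤1 0≤1 (≤-by (8ℚ - 1ℚ)
            refl (nonNegative⁻¹ (8ℚ - 1ℚ))) 1≤75ℚ)
          (*-mono-≤ {p = 1ℚ} {r = 1ℚ} 0≤1 0≤1 1≤L 1≤L)

    open Constants 0<κ using (c; c>0; minClass; minClass>0; T)

    private
      minClass≤1 : minClass ≤ 1ℚ
      minClass≤1 = *-mono-≤ {q = 1ℚ} {s = 1ℚ} (0≤* κ≥0 κ≥0) (<⇒≤ (halfPower>0 T)) (*-mono-≤ {q = 1ℚ} {s = 1ℚ} κ≥0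
          κ≥0 κ≤1 κ≤1) (halfPower-antimono {0} {T} ℕ.z≤n)
        where
        κ≥0 : 0ℚ ≤ κ
        κ≥0 = <⇒≤ 0<κ

      k₀ : ℕ
      k₀ = proj₁ (archimedes 6ℚ minClass>0)

    -- Since `s * s ≥ n`, this forces `s ≥ k₀` and therefore `S * minClass ≥ 6`, as `E≤` requires.
    n₀ : ℕ
    n₀ = suc (k₀ ℕ.* k₀)

    -- The first half bounds the four-cycles as `FewCycles` demands; the second keeps the five-cycle
    -- density strictly below `c`.
    δ : ℚ
    δ = (½ * minClass) ⊓ (½ * c)

    0<δ : 0ℚ < δ
    0<δ = 0<⊓ (0<* (positive⁻¹ ½) minClass>0) (0<* (positive⁻¹ ½) c>0)

    module _ (n : ℕ) (n≥n₀ : n₀ ℕ.≤ n) (X : Fin 5 → Subset n)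
      (fewAdd : ∀ i → ♯ (nontrivEnergy (X i)) ≤ δ * ♯ n)
      (fewSols : ♯ (numSols a X ℕ.^ 2) ≤ (δ * δ) * ♯ (n ℕ.^ 3)) where

      private
        1≤Ln : 1 ℕ.≤ Lₙ ℕ.* n
        1≤Ln = ℕ.*-mono-≤ {1} {Lₙ} {1} {n} (ℕ.s≤s ℕ.z≤n) (ℕ.≤-trans (ℕ.s≤s ℕ.z≤n) n≥n₀)

        s N : ℕ
        s = proj₁ (square-between (Lₙ ℕ.* n) 1≤Ln)
        N = s ℕ.* s

        Ln≤N : Lₙ ℕ.* n ℕ.≤ N
        Ln≤N = proj₁ (proj₂ (square-between (Lₙ ℕ.* n) 1≤Ln))

        N≤4Ln : N ℕ.≤ 4 ℕ.* (Lₙ ℕ.* n)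
        N≤4Ln = proj₂ (proj₂ (square-between (Lₙ ℕ.* n) 1≤Ln))

        n≤N : n ℕ.≤ N
        n≤N = ℕ.≤-trans (ℕ.m≤m+n n ((magnitude a ℕ.+ magnitude a) ℕ.* n)) Ln≤N

        k₀≤s : k₀ ℕ.≤ s
        k₀≤s = square-cancel-≤ (ℕ.≤-trans (ℕ.n≤1+n _) (ℕ.≤-trans n≥n₀ n≤N))

        S x : ℚ
        S = ♯ s
        x = ♯ n

        S≥0 : 0ℚ ≤ S
        S≥0 = ♯≥0 s

        x≥0 : 0ℚ ≤ x
        x≥0 = ♯≥0 n

        0<x : 0ℚ < x
        0<x = <-≤-trans 0<1 (♯-mono {1} {n} (ℕ.≤-trans (ℕ.s≤s ℕ.z≤n) n≥n₀))

        S² : S * S ≡ ♯ N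
        S² = sym (♯-* s s)

        x≤S² : x ≤ S * S
        x≤S² = subst (x ≤_) (sym S²) (♯-mono n≤N)

        S²≤ : S * S ≤ 4ℚ * (L * x)
        S²≤ = subst₂ _≤_ (sym S²) (trans (♯-* 4 (Lₙ ℕ.* n)) (cong (4ℚ *_) (♯-* Lₙ n))) (♯-mono N≤4Ln)

        6≤Sm : 6ℚ ≤ S * minClass
        6≤Sm = ≤-trans (<⇒≤ (proj₂ (archimedes 6ℚ minClass>0))) (*-monoʳ-≤ (<⇒≤ minClass>0) (♯-mono k₀≤s))

        open Codegrees N using (V; module Normalised; FewCycles)
        open Normalised S minClass minClass>0 minClass≤1 S≥0 S² 6≤Sm using (ν; ν-1; few-four-cycles; path-L²; rescale; ∫∫-ν; iN; n-iN; 0<S; 0<n)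
        open CutDistance ν ν-1 using (triangles; _∘ᵏ_)
        open Pentagons N a X using (e; path; pentagons; pentagons≤)

        few : ∀ i → FewCycles minClass (e i)
        few i = record
          { e≥0 = edge≥0 (a i) (X i)
          ; e-idem = edge-idem (a≢0 i) (X i)
          ; few = ≤-trans (Rectangles.fourCycles≤ N (a≢0 i) (X i)) (subst (♯ (nontrivEnergy (X i)) * ♯ N ≤_)
              (*-assoc (½ * minClass) (♯ N) (♯ N))
              (*-monoʳ-≤ (♯≥0 N) (≤-trans (fewAdd i) (*-mono-≤ (<⇒≤ 0<δ) x≥0 (p⊓q≤p (½ * minClass) (½ * c))
                  (♯-mono n≤N)))))
          }

        p : Fin 5 → V → V → ℚ
        p i u v = S * e i u v

        removal : Σ (Fin 5 → V → V → Bool) λ bad → (∀ i → ∫ ν (λ u → ∫ ν (λ v → p i u v * 𝟙 (bad i u v))) ≤ 15ℚ * κ) ×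
          (∀ v₁ v₂ v₃ v₄ v₅ → bad 0F v₁ v₂ ≡ false → bad 1F v₂ v₃ ≡ false → bad 2F v₃ v₄ ≡ false → bad 3F v₄ v₅ ≡
              false → bad 4F v₅ v₁ ≡ false →
            c ≤ triangles (p 0F ∘ᵏ p 1F) (p 2F ∘ᵏ p 3F) (p 4F))
        removal = sparse-removal 0<κ κ≤1 ν ν-1 p (λ i u v → 0≤* S≥0 (FewCycles.e≥0 (few i) u v)) (λ i →
            few-four-cycles (few i)) (path-L² (few 0F) (few 1F)) (path-L² (few 2F) (few 3F))

        bad : Fin 5 → V → V → Bool
        bad = proj₁ removal

        -- Both factors `S` of a composed pair are absorbed by the normalisation of the middle
        -- integral; one `S` for the fifth edge and three factors `iN` remain.
        triangles≡ : triangles (p 0F ∘ᵏ p 1F) (p 2F ∘ᵏ p 3F) (p 4F) ≡ iN * iN * iN * (S * pentagons)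
        triangles≡ = begin
          triangles (p 0F ∘ᵏ p 1F) (p 2F ∘ᵏ p 3F) (p 4F)
            ≡⟨ ∫-cong (λ u → ∫∫-cong (λ v w → trans (cong₂ (λ r r′ → r * (p 4F w u * r′)) (rescale (e 0F u) (λ y →
                e 1F y v)) (rescale (e 2F v) (λ y → e 3F y w)))
                 (regroup (path 0F 1F u v) S (e 4F w u) (path 2F 3F v w)))) ⟩
          ∫ ν (λ u → ∫ ν (λ v → ∫ ν (λ w → S * (path 0F 1F u v * (e 4F w u * path 2F 3F v w)))))
            ≡⟨ trans (∫-cong (λ u → ∫∫-*ˡ S _)) (∫-*ˡ S _) ⟩
          S * ∫ ν (λ u → ∫ ν (λ v → ∫ ν (λ w → path 0F 1F u v * (e 4F w u * path 2F 3F v w))))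
            ≡⟨ cong (S *_) (trans (∫-cong (λ u → ∫∫-ν (λ v w → path 0F 1F u v * (e 4F w u * path 2F 3F v w))))
                (trans (∫-*ˡ (iN * iN) _) (cong (iN * iN *_) (∫-scale _)))) ⟩
          S * (iN * iN * (iN * pentagons)) ≡⟨ regroup′ S iN pentagons ⟩
          iN * iN * iN * (S * pentagons) ∎
          where
          open ≡-Reasoning
          regroup : ∀ r s e r′ → r * (s * e * r′) ≡ s * (r * (e * r′))
          regroup = solve-∀ ℚ-ring
          regroup′ : ∀ s i z → s * (i * i * (i * z)) ≡ i * i * i * (s * z)
          regroup′ = solve-∀ ℚ-ring

        -- The hypothesis bounds the square, and `n ≤ S²` replaces the cube of `n` by the square of
        -- `S³`, so that a root can be taken.
        numSols≤ : ♯ (numSols a X) ≤ δ * (S * (S * S))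
        numSols≤ = sq-cancel-≤ (0≤* (<⇒≤ 0<δ) (0≤* S≥0 (0≤* S≥0 S≥0))) (begin
          ♯ (numSols a X) * ♯ (numSols a X) ≡⟨ sym (♯-square (numSols a X)) ⟩
          ♯ (numSols a X ℕ.^ 2) ≤⟨ fewSols ⟩
          δ * δ * ♯ (n ℕ.^ 3) ≡⟨ cong (δ * δ *_) (♯-cube n) ⟩
          δ * δ * (x * (x * x)) ≤⟨ *-monoˡ-≤ (0≤sq δ) (*-mono-≤ x≥0 (0≤sq x) x≤S² (*-mono-≤ x≥0 x≥0 x≤S² x≤S²)) ⟩
          δ * δ * (S * S * (S * S * (S * S))) ≡⟨ regroup δ S ⟩
          δ * (S * (S * S)) * (δ * (S * (S * S))) ∎)
          where
          open ≤-Reasoning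
          regroup : ∀ d s → d * d * (s * s * (s * s * (s * s))) ≡ d * (s * (s * s)) * (d * (s * (s * s)))
          regroup = solve-∀ ℚ-ring

        triangles≤δ : triangles (p 0F ∘ᵏ p 1F) (p 2F ∘ᵏ p 3F) (p 4F) ≤ δ
        triangles≤δ = begin
          triangles (p 0F ∘ᵏ p 1F) (p 2F ∘ᵏ p 3F) (p 4F) ≡⟨ triangles≡ ⟩
          iN * iN * iN * (S * pentagons) ≤⟨ *-monoˡ-≤ (0≤* (0≤* iN≥0 iN≥0) iN≥0) (*-monoˡ-≤ S≥0 (≤-trans pentagons≤
              (*-monoʳ-≤ (♯≥0 N) numSols≤))) ⟩
          iN * iN * iN * (S * (δ * (S * (S * S)) * ♯ N)) ≡⟨ regroup iN S δ (♯ N) ⟩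
          δ * ((S * S * iN) * (S * S * iN) * (♯ N * iN)) ≡⟨ cong (λ z → δ * ((z * iN) * (z * iN) * (♯ N * iN))) S² ⟩
          δ * ((♯ N * iN) * (♯ N * iN) * (♯ N * iN)) ≡⟨ cong (λ z → δ * (z * z * z)) n-iN ⟩
          δ * 1ℚ ≡⟨ *-identityʳ δ ⟩
          δ ∎
          where
          open ≤-Reasoning
          iN≥0 : 0ℚ ≤ iN
          iN≥0 = inv≥0 0<n
          regroup : ∀ i s d m → i * i * i * (s * (d * (s * (s * s)) * m)) ≡ d * ((s * s * i) * (s * s * i) * (m * i))
          regroup = solve-∀ ℚ-ring

        δ<c : δ < c
        δ<c = ≤-<-trans (p⊓q≤q (½ * minClass) (½ * c)) (subst₂ _<_ (+-identityˡ (½ * c)) (halves c)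
            (+-monoˡ-< (½ * c) (0<* (positive⁻¹ ½) c>0)))
          where
          halves : ∀ c → ½ * c + ½ * c ≡ c
          halves = solve-∀ ℚ-ring

        no-good-cycle : ∀ v₁ v₂ v₃ v₄ v₅ → ¬ (bad 0F v₁ v₂ ≡ false × bad 1F v₂ v₃ ≡ false × bad 2F v₃ v₄ ≡
            false × bad 3F v₄ v₅ ≡ false × bad 4F v₅ v₁ ≡ false)
        no-good-cycle v₁ v₂ v₃ v₄ v₅ (h₁ , h₂ , h₃ , h₄ , h₅) =
          <-irrefl refl (<-≤-trans δ<c (≤-trans (proj₂ (proj₂ removal) v₁ v₂ v₃ v₄ v₅ h₁ h₂ h₃ h₄ h₅) triangles≤δ))

        open Reduced a X Ln≤N bad no-good-cycle using (Y; Y⊆X; Y-solution-free; removed-size)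

        module Size (i : Fin 5) where
          R W : ℚ
          R = ♯ (∣ X i ∣ ∸ ∣ Y i ∣)
          W = ∫ (vertices N) (λ u → ∫ (vertices N) (λ v → e i u v * 𝟙 (bad i u v)))

          W≤ : W ≤ 15ℚ * κ * (S * (S * S))
          W≤ = *-cancelˡ-≤ 0<S (begin
            S * W ≡⟨ sym (trans (cong (λ z → z * z * (S * W)) n-iN) (*-identityˡ (S * W))) ⟩
            (♯ N * iN) * (♯ N * iN) * (S * W) ≡⟨ regroup (♯ N) iN (S * W) ⟩
            ♯ N * ♯ N * (iN * iN * (S * W)) ≡⟨ cong (λ z → ♯ N * ♯ N * (iN * iN * z)) (trans (sym (∫∫-*ˡ S _))
                (∫∫-cong (λ u v → sym (*-assoc S (e i u v) (𝟙 (bad i u v)))))) ⟩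
            ♯ N * ♯ N * (iN * iN * ∫ (vertices N) (λ u → ∫ (vertices N) (λ v → p i u v * 𝟙 (bad i u v)))) ≡⟨ cong
                (♯ N * ♯ N *_) (sym (∫∫-ν (λ u v → p i u v * 𝟙 (bad i u v)))) ⟩
            ♯ N * ♯ N * ∫ ν (λ u → ∫ ν (λ v → p i u v * 𝟙 (bad i u v))) ≤⟨ *-monoˡ-≤ (0≤sq (♯ N))
                (proj₁ (proj₂ removal) i) ⟩
            ♯ N * ♯ N * (15ℚ * κ) ≡⟨ cong (λ z → z * z * (15ℚ * κ)) (sym S²) ⟩
            S * S * (S * S) * (15ℚ * κ) ≡⟨ regroup′ S (15ℚ * κ) ⟩
            S * (15ℚ * κ * (S * (S * S))) ∎)
            where
            open ≤-Reasoning
            regroup : ∀ m i z → (m * i) * (m * i) * z ≡ m * m * (i * i * z)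
            regroup = solve-∀ ℚ-ring
            regroup′ : ∀ s k → s * s * (s * s) * k ≡ s * (k * (s * (s * s)))
            regroup′ = solve-∀ ℚ-ring

          xR≤ : x * R ≤ 75ℚ * κ * (S * (S * S))
          xR≤ = ≤-trans (removed-size i) (≤-trans (*-monoˡ-≤ (nonNegative⁻¹ 5ℚ) W≤)
              (≤-reflexive (regroup κ (S * (S * S)))))
            where
            expand : ∀ k z → 5ℚ * (15ℚ * k * z) ≡ 15ℚ * 5ℚ * k * z
            expand = solve-∀ ℚ-ring
            regroup : ∀ k z → 5ℚ * (15ℚ * k * z) ≡ 75ℚ * k * z
            regroup k z = trans (expand k z) (cong (λ h → h * k * z) (sym 75ℚ≡))

          R²≤ : R * R ≤ (ε * ε) * x
          R²≤ = *-cancelˡ-≤ (0<* 0<x 0<x) (begin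
            x * x * (R * R) ≡⟨ regroup₁ x R ⟩
            x * R * (x * R) ≤⟨ *-mono-≤ xR≥0 xR≥0 xR≤ xR≤ ⟩
            75ℚ * κ * (S * (S * S)) * (75ℚ * κ * (S * (S * S))) ≡⟨ regroup₂ (75ℚ * κ) S ⟩
            (75ℚ * κ) * (75ℚ * κ) * ((S * S) * ((S * S) * (S * S))) ≤⟨ *-monoˡ-≤ (0≤sq (75ℚ * κ)) (*-mono-≤ S²≥0
                (0≤* S²≥0 S²≥0) S²≤ (*-mono-≤ S²≥0 S²≥0 S²≤ S²≤)) ⟩
            (75ℚ * κ) * (75ℚ * κ) * ((4ℚ * (L * x)) * ((4ℚ * (L * x)) * (4ℚ * (L * x)))) ≡⟨ regroup₃ 75ℚ κ L x ⟩
            ((8ℚ * 75ℚ) * κ * L) * ((8ℚ * 75ℚ) * κ * L) * (x * (x * x)) * L ≤⟨ *-monoˡ-≤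
                (0≤* (0≤sq ((8ℚ * 75ℚ) * κ * L)) (0≤* x≥0 (0≤sq x))) L≤L² ⟩
            ((8ℚ * 75ℚ) * κ * L) * ((8ℚ * 75ℚ) * κ * L) * (x * (x * x)) * (L * L) ≡⟨ regroup₄ (8ℚ * 75ℚ) κ L x ⟩
            x * x * ((κ * ((8ℚ * 75ℚ) * (L * L))) * (κ * ((8ℚ * 75ℚ) * (L * L))) * x) ≡⟨ cong (λ z →
                x * x * (z * z * x)) 600κL² ⟩
            x * x * ((ε ⊓ 1ℚ) * (ε ⊓ 1ℚ) * x)
              ≤⟨ *-monoˡ-≤ (0≤sq x) (*-monoʳ-≤ x≥0 (*-mono-≤ (<⇒≤ 0<ε⊓1) (<⇒≤ 0<ε⊓1) (p⊓q≤p ε 1ℚ) (p⊓q≤p ε 1ℚ))) ⟩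
            x * x * (ε * ε * x) ∎)
            where
            open ≤-Reasoning
            xR≥0 : 0ℚ ≤ x * R
            xR≥0 = 0≤* x≥0 (♯≥0 (∣ X i ∣ ∸ ∣ Y i ∣))
            S²≥0 : 0ℚ ≤ S * S
            S²≥0 = 0≤sq S
            L≤L² : L ≤ L * L
            L≤L² = subst (_≤ L * L) (*-identityʳ L) (*-monoˡ-≤ 0≤L 1≤L)
            regroup₁ : ∀ x r → x * x * (r * r) ≡ x * r * (x * r)
            regroup₁ = solve-∀ ℚ-ring
            regroup₂ : ∀ k s → k * (s * (s * s)) * (k * (s * (s * s))) ≡ k * k * ((s * s) * ((s * s) * (s * s)))
            regroup₂ = solve-∀ ℚ-ring
            regroup₃ : ∀ h k l x → (h * k) * (h * k) * ((4ℚ * (l * x)) * ((4ℚ * (l * x)) * (4ℚ * (l * x)))) ≡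
                (8ℚ * h * k * l) * (8ℚ * h * k * l) * (x * (x * x)) * l
            regroup₃ = solve-∀ ℚ-ring
            regroup₄ : ∀ h k l x → (h * k * l) * (h * k * l) * (x * (x * x)) * (l * l) ≡
                x * x * ((k * (h * (l * l))) * (k * (h * (l * l))) * x)
            regroup₄ = solve-∀ ℚ-ring

      solution-free-subsets : Σ (Fin 5 → Subset n) λ Y → (∀ i → Y i ⊆ X i) × (∀ i → ♯ ((∣ X i ∣ ∸ ∣ Y i ∣) ℕ.^ 2) ≤
          (ε * ε) * ♯ n) × numSols a Y ≡ 0
      solution-free-subsets = Y , Y⊆X , (λ i → subst (_≤ (ε * ε) * ♯ n) (sym (♯-square (∣ X i ∣ ∸ ∣ Y i ∣)))
          (Size.R²≤ i)) , Y-solution-free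

open import Defs
open import Data.Nat using (ℕ; _≥_; _∸_; _^_)
open import Data.Integer using (ℤ; +_; _+_)
open import Data.Rational using (ℚ; Positive; _≤_; _*_; _/_; positive)
open import Data.Rational.Properties using (positive⁻¹)
open import Data.Fin using (Fin)
open import Data.Fin.Patterns using (0F; 1F; 2F; 3F; 4F)
open import Data.Fin.Subset using (Subset; _⊆_; ∣_∣)
open import Data.Product using (Σ; _×_; _,_)
open import Relation.Binary.PropositionalEquality using (_≡_; _≢_)

theorem1p17 : (a : Fin 5 → ℤ) → (∀ i → a i ≢ + 0) → a 0F + a 1F + a 2F + a 3F + a 4F ≡ + 0 →
    (ε : ℚ) → Positive ε →
    Σ ℚ λ δ → Positive δ × Σ ℕ λ n₀ →
    (n : ℕ) → n ≥ n₀ → (X : Fin 5 → Subset n) →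
    (∀ i → (+ nontrivEnergy (X i) / 1) ≤ δ * (+ n / 1)) →
    (+ (numSols a X ^ 2) / 1) ≤ (δ * δ) * (+ (n ^ 3) / 1) →
    Σ (Fin 5 → Subset n) λ Y →
    (∀ i → Y i ⊆ X i) ×
    (∀ i → (+ ((∣ X i ∣ ∸ ∣ Y i ∣) ^ 2) / 1) ≤ (ε * ε) * (+ n / 1)) ×
    numSols a Y ≡ 0
theorem1p17 a a≢0 _ ε ε>0 = δ , positive 0<δ , n₀ , solution-free-subsets
  where open Thresholds a a≢0 ε (positive⁻¹ ε {{ε>0}})
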